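{- Let $F=\breve F(\alpha_1,\dots,\alpha_t)$ be a fence. A basis of $A_T(F)$ is \[ \mathcal B_A(F)=\bigcup_{i=1}^t\{\alpha_i\chi_x+\chi_{s_{i-1}}+\chi_{s_i}: x\in\breve S_i\}, \] and consequently $\dim A_T(F)=\sum_{i=1}^t(\alpha_i-1)$.
   Context: Fences: let $\alpha=(\alpha_1,\dots,\alpha_t)$ be positive integers with $t\ge2$ and $\alpha_1,\alpha_t\ge2$. Put $a_0=0$, $a_i=\alpha_1+\dots+\alpha_i$, $n=a_t-1$. The fence $\breve F(\alpha)$ is the poset on $\{x_1,\dots,x_n\}$ whose cover relations are: for $1\le j\le n-1$ with $a_{i-1}\le j<a_i$, $x_j\lessdot x_{j+1}$ if $i$ is odd and $x_j\gtrdot x_{j+1}$ if $i$ is even. Segments: $S_1=\{x_j:1\le j\le a_1\}$, $S_i=\{x_j:a_{i-1}\le j\le a_i\}$ for $2\le i\le t-1$, $S_t=\{x_j:a_{t-1}\le j\le n\}$. Shared elements are $s_i=x_{a_i}$, $i\in[t-1]$; $\breve S_i$ is the set of non-shared elements of $S_i$. Convention: $\chi_{s_0}$ and $\chi_{s_t}$ are identically zero. $\mathcal J(F)$ is the set of order ideals. For $q\in F$, $I\in\mathcal J(F)$: $\chi_q(I)=1$ if $q\in\max(I)$, else $0$; $T_q(I)=1$ if $q\in\min(F\setminus I)$, $-1$ if $q\in\max(I)$, $0$ otherwise. For $f:\mathcal J(F)\to\mathbb R$, write $f\equiv\text{const}$ if $f=c+\sum_{q\in F}c_qT_q$ for real constants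 $c,c_q$. $A_T(F)=\{f\in\operatorname{Span}_{\mathbb R}\{\chi_q:q\in F\}: f\equiv\text{const}\}$. -}

module Defs where

open import Level using (0ℓ)
open import Algebra.Bundles using (CommutativeRing)
import Algebra.Properties.AbelianGroup
import Algebra.Properties.CommutativeMonoid.Sum
import Algebra.Properties.CommutativeSemigroup
open import Data.Bool.Base using (if_then_else_)
open import Data.Empty using (⊥-elim)
open import Data.Fin.Base using (Fin; toℕ; fromℕ<)
import Data.Fin.Properties as Fin
open import Data.Fin.Subset using (Subset; _∈_; _∉_)
open import Data.Fin.Subset.Properties using (_∈?_)
open import Data.Integer.Base as ℤ using (ℤ; +_)
import Data.Integer.Properties as ℤ
open import Data.List.Base as List using (List; concatMap; filter; allFin)
open import Data.List.Relation.Unary.All using (All)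
open import Data.Nat.Base as ℕ using (ℕ; zero; suc; z≤n; s≤s)
open import Data.Nat.Divisibility using (_∣_; _∣?_)
import Data.Nat.Properties as ℕ
open import Data.Product.Base using (Σ; ∃; ∃-syntax; _×_; _,_)
open import Data.Rational.Base as ℚ using (ℚ; 0ℚ; 1ℚ; ½)
import Data.Rational.Properties as ℚ
open import Data.Sum.Base using (_⊎_; inj₁; inj₂)
open import Data.Vec.Base using (Vec; []; _∷_; lookup)
import Data.Vec.Base as Vec
open import Relation.Binary.Construct.Closure.ReflexiveTransitive using (Star; _◅_; _◅◅_) renaming (ε to nil)
open import Relation.Binary.Core using (Rel)
open import Relation.Binary.Definitions using (Decidable; tri<; tri≈; tri>)
open import Relation.Binary.PropositionalEquality as ≡ using (_≡_; _≢_; cong; cong₂; subst)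
open import Relation.Binary.Structures using (IsDecPartialOrder)
open import Relation.Nullary using (¬_; Dec; yes; no; does; contradiction)
open import Relation.Nullary.Decidable using (map′; _×-dec_; _⊎-dec_; _→-dec_; ¬?; dec-true; dec-false)
open import Relation.Unary using (Pred)

-- The field of real numbers: Cauchy sequences of rationals with a modulus of
-- convergence, considered up to sequences tending to 0.
module Reals where

  IsCauchy : (ℕ → ℚ) → Set
  IsCauchy x = ∀ ε → 0ℚ ℚ.< ε →
    ∃ λ N → ∀ m n → N ℕ.≤ m → N ℕ.≤ n → ℚ.∣ x m ℚ.- x n ∣ ℚ.< ε

  record ℝ : Set where
    constructor mkℝ
    field
      seq      : ℕ → ℚ
      isCauchy : IsCauchy seq
  open ℝ public

  infix 4 _≈_
  record _≈_ (x y : ℝ) : Set where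
    constructor mk≈
    field
      converge : ∀ ε → 0ℚ ℚ.< ε →
        ∃ λ N → ∀ n → N ℕ.≤ n → ℚ.∣ seq x n ℚ.- seq y n ∣ ℚ.< ε
  open _≈_ public

  private
    module ℚ-Group = Algebra.Properties.AbelianGroup ℚ.+-0-abelianGroup
    module ℚ-Semigroup = Algebra.Properties.CommutativeSemigroup
      (CommutativeRing.+-commutativeSemigroup ℚ.+-*-commutativeRing)

    open ℚ.≤-Reasoning

    ½ε+½ε : ∀ ε → ε ℚ.* ½ ℚ.+ ε ℚ.* ½ ≡ ε
    ½ε+½ε ε = ≡.trans (≡.sym (ℚ.*-distribˡ-+ ε ½ ½)) (ℚ.*-identityʳ ε)

    -‿split : ∀ p q → p ≡ (p ℚ.- q) ℚ.+ q
    -‿split p q = ≡.sym (ℚ-Group.//-rightDividesˡ q p)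

    -‿via : ∀ p q r → p ℚ.- r ≡ (p ℚ.- q) ℚ.+ (q ℚ.- r)
    -‿via p q r = ≡.trans (cong (ℚ._- r) (-‿split p q)) (ℚ.+-assoc (p ℚ.- q) q (ℚ.- r))

    neg-swap : ∀ p q → ℚ.- (p ℚ.- q) ≡ q ℚ.- p
    neg-swap p q = ≡.trans (ℚ.neg-distrib-+ p (ℚ.- q))
      (≡.trans (ℚ.+-comm (ℚ.- p) (ℚ.- (ℚ.- q))) (cong (ℚ._- p) (ℚ-Group.⁻¹-involutive q)))

    neg-neg : ∀ p q → q ℚ.- p ≡ (ℚ.- p) ℚ.- (ℚ.- q)
    neg-neg p q = ≡.trans (≡.sym (neg-swap p q)) (ℚ.neg-distrib-+ p (ℚ.- q))

    +-‿+ : ∀ p q p′ q′ → (p ℚ.+ q) ℚ.- (p′ ℚ.+ q′) ≡ (p ℚ.- p′) ℚ.+ (q ℚ.- q′)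
    +-‿+ p q p′ q′ = ≡.trans (cong ((p ℚ.+ q) ℚ.+_) (ℚ.neg-distrib-+ p′ q′))
      (ℚ-Semigroup.interchange p q (ℚ.- p′) (ℚ.- q′))

    *-‿distrib : ∀ p q r → p ℚ.* q ℚ.- p ℚ.* r ≡ p ℚ.* (q ℚ.- r)
    *-‿distrib p q r = ≡.trans (cong (p ℚ.* q ℚ.+_) (ℚ.neg-distribʳ-* p r)) (≡.sym (ℚ.*-distribˡ-+ p q (ℚ.- r)))

    *-‿* : ∀ p q p′ q′ → (p ℚ.* q) ℚ.- (p′ ℚ.* q′) ≡ p ℚ.* (q ℚ.- q′) ℚ.+ q′ ℚ.* (p ℚ.- p′)
    *-‿* p q p′ q′ = ≡.trans (-‿via (p ℚ.* q) (p ℚ.* q′) (p′ ℚ.* q′)) (cong₂ ℚ._+_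
      (*-‿distrib p q q′)
      (≡.trans (cong₂ ℚ._-_ (ℚ.*-comm p q′) (ℚ.*-comm p′ q′)) (*-‿distrib q′ p p′)))

    0<½ε : ∀ {ε} → 0ℚ ℚ.< ε → 0ℚ ℚ.< ε ℚ.* ½
    0<½ε {ε} 0<ε = subst (ℚ._< ε ℚ.* ½) (ℚ.*-zeroˡ ½) (ℚ.*-monoˡ-<-pos ½ 0<ε)

    ∣-∣-comm : ∀ p q → ℚ.∣ p ℚ.- q ∣ ≡ ℚ.∣ q ℚ.- p ∣
    ∣-∣-comm p q = ≡.trans (≡.sym (ℚ.∣-p∣≡∣p∣ (p ℚ.- q)))
      (cong ℚ.∣_∣ (neg-swap p q))

    ∣p-p∣<ε : ∀ p {ε} → 0ℚ ℚ.< ε → ℚ.∣ p ℚ.- p ∣ ℚ.< ε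
    ∣p-p∣<ε p {ε} = subst (ℚ._< ε) (≡.sym (cong ℚ.∣_∣ (ℚ.+-inverseʳ p)))

    ∣sum∣<ε : ∀ {ε r} p q → r ≡ p ℚ.+ q → ℚ.∣ p ∣ ℚ.< ε ℚ.* ½ → ℚ.∣ q ∣ ℚ.< ε ℚ.* ½ → ℚ.∣ r ∣ ℚ.< ε
    ∣sum∣<ε {ε} {r} p q r≡p+q ∣p∣< ∣q∣< = begin-strict
      ℚ.∣ r ∣                  ≡⟨ cong ℚ.∣_∣ r≡p+q ⟩
      ℚ.∣ p ℚ.+ q ∣            ≤⟨ ℚ.∣p+q∣≤∣p∣+∣q∣ p q ⟩
      ℚ.∣ p ∣ ℚ.+ ℚ.∣ q ∣      <⟨ ℚ.+-mono-< ∣p∣< ∣q∣< ⟩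
      ε ℚ.* ½ ℚ.+ ε ℚ.* ½      ≡⟨ ½ε+½ε ε ⟩
      ε                        ∎

    ∣+-+∣<ε : ∀ {ε} p q p′ q′ → ℚ.∣ p ℚ.- p′ ∣ ℚ.< ε ℚ.* ½ → ℚ.∣ q ℚ.- q′ ∣ ℚ.< ε ℚ.* ½ →
              ℚ.∣ (p ℚ.+ q) ℚ.- (p′ ℚ.+ q′) ∣ ℚ.< ε
    ∣+-+∣<ε p q p′ q′ = ∣sum∣<ε (p ℚ.- p′) (q ℚ.- q′)
      (+-‿+ p q p′ q′)

    EventuallyBounded : (ℕ → ℚ) → Set
    EventuallyBounded x = ∃ λ B → ℚ.Positive B × ∃ λ N → ∀ n → N ℕ.≤ n → ℚ.∣ x n ∣ ℚ.< B

    bounded : ∀ x → EventuallyBounded (seq x)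
    bounded x with isCauchy x 1ℚ (ℚ.positive⁻¹ 1ℚ)
    ... | N , close = 1ℚ ℚ.+ c , ℚ.pos+nonNeg⇒pos 1ℚ c , N , λ n N≤n → begin-strict
      ℚ.∣ seq x n ∣                            ≡⟨ cong ℚ.∣_∣ (-‿split (seq x n) (seq x N)) ⟩
      ℚ.∣ (seq x n ℚ.- seq x N) ℚ.+ seq x N ∣  ≤⟨ ℚ.∣p+q∣≤∣p∣+∣q∣ (seq x n ℚ.- seq x N) (seq x N) ⟩
      ℚ.∣ seq x n ℚ.- seq x N ∣ ℚ.+ c          <⟨ ℚ.+-monoˡ-< c (close n N N≤n ℕ.≤-refl) ⟩
      1ℚ ℚ.+ c                                 ∎
      where
      c = ℚ.∣ seq x N ∣
      instance _ = ℚ.∣-∣-nonNeg (seq x N)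

    -- δ = ε / (2 B)
    scale : ∀ B → ℚ.Positive B → ∀ {ε} → 0ℚ ℚ.< ε → ∃ λ δ → 0ℚ ℚ.< δ × B ℚ.* δ ≡ ε ℚ.* ½
    scale B B>0 {ε} 0<ε = (ℚ.1/ B) ℚ.* (ε ℚ.* ½)
      , subst (ℚ._< (ℚ.1/ B) ℚ.* (ε ℚ.* ½)) (ℚ.*-zeroʳ (ℚ.1/ B)) (ℚ.*-monoʳ-<-pos (ℚ.1/ B) (0<½ε 0<ε))
      , ≡.trans (≡.sym (ℚ.*-assoc B (ℚ.1/ B) (ε ℚ.* ½)))
          (≡.trans (cong (ℚ._* (ε ℚ.* ½)) (ℚ.*-inverseʳ B)) (ℚ.*-identityˡ (ε ℚ.* ½)))
      where instance
        _ = B>0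
        _ = ℚ.pos⇒nonZero B
        _ = ℚ.1/pos⇒pos B

    ∣p*q∣<B*δ : ∀ p q {B δ} → ℚ.Positive B → ℚ.∣ p ∣ ℚ.< B → ℚ.∣ q ∣ ℚ.< δ → ℚ.∣ p ℚ.* q ∣ ℚ.< B ℚ.* δ
    ∣p*q∣<B*δ p q {B} {δ} B>0 ∣p∣<B ∣q∣<δ = begin-strict
      ℚ.∣ p ℚ.* q ∣        ≡⟨ ℚ.∣p*q∣≡∣p∣*∣q∣ p q ⟩
      ℚ.∣ p ∣ ℚ.* ℚ.∣ q ∣  ≤⟨ ℚ.*-monoʳ-≤-nonNeg ℚ.∣ q ∣ (ℚ.<⇒≤ ∣p∣<B) ⟩
      B ℚ.* ℚ.∣ q ∣        <⟨ ℚ.*-monoʳ-<-pos B ∣q∣<δ ⟩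
      B ℚ.* δ              ∎
      where instance
        _ = B>0
        _ = ℚ.∣-∣-nonNeg q

    ∣*-*∣<ε : ∀ {ε} p q p′ q′ {A B δ δ′} → ℚ.Positive A → ℚ.Positive B →
              A ℚ.* δ ≡ ε ℚ.* ½ → B ℚ.* δ′ ≡ ε ℚ.* ½ →
              ℚ.∣ p ∣ ℚ.< A → ℚ.∣ q ℚ.- q′ ∣ ℚ.< δ → ℚ.∣ q′ ∣ ℚ.< B → ℚ.∣ p ℚ.- p′ ∣ ℚ.< δ′ →
              ℚ.∣ (p ℚ.* q) ℚ.- (p′ ℚ.* q′) ∣ ℚ.< ε
    ∣*-*∣<ε p q p′ q′ A>0 B>0 Aδ≡ Bδ′≡ p<A q-q′<δ q′<B p-p′<δ′ =
      ∣sum∣<ε (p ℚ.* (q ℚ.- q′)) (q′ ℚ.* (p ℚ.- p′))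
        (*-‿* p q p′ q′)
        (subst (ℚ.∣ p ℚ.* (q ℚ.- q′) ∣ ℚ.<_) Aδ≡ (∣p*q∣<B*δ p (q ℚ.- q′) A>0 p<A q-q′<δ))
        (subst (ℚ.∣ q′ ℚ.* (p ℚ.- p′) ∣ ℚ.<_) Bδ′≡ (∣p*q∣<B*δ q′ (p ℚ.- p′) B>0 q′<B p-p′<δ′))

    ⊔ˡ : ∀ {k} m n → m ℕ.⊔ n ℕ.≤ k → m ℕ.≤ k
    ⊔ˡ m n = ℕ.m⊔n≤o⇒m≤o m n

    ⊔ʳ : ∀ {k} m n → m ℕ.⊔ n ℕ.≤ k → n ℕ.≤ k
    ⊔ʳ m n = ℕ.m⊔n≤o⇒n≤o m n

  fromℚ : ℚ → ℝ
  fromℚ q = mkℝ (λ _ → q) λ ε 0<ε → 0 , λ _ _ _ _ → ∣p-p∣<ε q 0<ε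

  fromℕ : ℕ → ℝ
  fromℕ m = fromℚ (+ m ℚ./ 1)

  0# 1# : ℝ
  0# = fromℚ 0ℚ
  1# = fromℚ 1ℚ

  infixl 6 _+_
  infixl 7 _*_
  infix  8 -_

  _+_ : ℝ → ℝ → ℝ
  seq (x + y) n = seq x n ℚ.+ seq y n
  isCauchy (x + y) ε 0<ε
    with isCauchy x (ε ℚ.* ½) (0<½ε 0<ε) | isCauchy y (ε ℚ.* ½) (0<½ε 0<ε)
  ... | M , f | N , g = M ℕ.⊔ N , λ m n ≤m ≤n →
    ∣+-+∣<ε (seq x m) (seq y m) (seq x n) (seq y n)
      (f m n (⊔ˡ M N ≤m) (⊔ˡ M N ≤n)) (g m n (⊔ʳ M N ≤m) (⊔ʳ M N ≤n))

  -_ : ℝ → ℝ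
  seq (- x) n = ℚ.- seq x n
  isCauchy (- x) ε 0<ε with isCauchy x ε 0<ε
  ... | N , f = N , λ m n ≤m ≤n → subst (ℚ._< ε)
    (cong ℚ.∣_∣ (neg-neg (seq x m) (seq x n))) (f n m ≤n ≤m)

  _*_ : ℝ → ℝ → ℝ
  seq (x * y) n = seq x n ℚ.* seq y n
  isCauchy (x * y) ε 0<ε =
    let A , A>0 , K , x<A = bounded x
        B , B>0 , L , y<B = bounded y
        δ , 0<δ , Aδ≡ = scale A A>0 0<ε
        δ′ , 0<δ′ , Bδ′≡ = scale B B>0 0<ε
        M , f = isCauchy x δ′ 0<δ′
        N , g = isCauchy y δ 0<δ
    in (K ℕ.⊔ L) ℕ.⊔ (M ℕ.⊔ N) , λ m n ≤m ≤n →
    let KL≤m = ⊔ˡ (K ℕ.⊔ L) (M ℕ.⊔ N) ≤m ; KL≤n = ⊔ˡ (K ℕ.⊔ L) (M ℕ.⊔ N) ≤n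
        MN≤m = ⊔ʳ (K ℕ.⊔ L) (M ℕ.⊔ N) ≤m ; MN≤n = ⊔ʳ (K ℕ.⊔ L) (M ℕ.⊔ N) ≤n
    in ∣*-*∣<ε (seq x m) (seq y m) (seq x n) (seq y n) A>0 B>0 Aδ≡ Bδ′≡
      (x<A m (⊔ˡ K L KL≤m)) (g m n (⊔ʳ M N MN≤m) (⊔ʳ M N MN≤n))
      (y<B n (⊔ʳ K L KL≤n)) (f m n (⊔ˡ M N MN≤m) (⊔ˡ M N MN≤n))

  pointwise : ∀ {x y} → (∀ n → seq x n ≡ seq y n) → x ≈ y
  pointwise {x} {y} x≗y = mk≈ λ ε 0<ε → 0 , λ n _ →
    subst (λ q → ℚ.∣ seq x n ℚ.- q ∣ ℚ.< ε) (x≗y n) (∣p-p∣<ε (seq x n) 0<ε)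

  private
    ≈-trans : ∀ {x y z} → x ≈ y → y ≈ z → x ≈ z
    ≈-trans {x} {y} {z} x≈y y≈z = mk≈ close
      where
      close : ∀ ε → 0ℚ ℚ.< ε → ∃ λ N → ∀ n → N ℕ.≤ n → ℚ.∣ seq x n ℚ.- seq z n ∣ ℚ.< ε
      close ε 0<ε with converge x≈y (ε ℚ.* ½) (0<½ε 0<ε) | converge y≈z (ε ℚ.* ½) (0<½ε 0<ε)
      ... | M , f | N , g = M ℕ.⊔ N , λ n ≤n →
        ∣sum∣<ε (seq x n ℚ.- seq y n) (seq y n ℚ.- seq z n)
          (-‿via (seq x n) (seq y n) (seq z n))
          (f n (⊔ˡ M N ≤n)) (g n (⊔ʳ M N ≤n))

    ≈-sym : ∀ {x y} → x ≈ y → y ≈ x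
    ≈-sym {x} {y} x≈y = mk≈ λ ε 0<ε → let N , f = converge x≈y ε 0<ε in
      N , λ n ≤n → subst (ℚ._< ε) (∣-∣-comm (seq x n) (seq y n)) (f n ≤n)

    +-cong : ∀ {x x′ y y′} → x ≈ x′ → y ≈ y′ → x + y ≈ x′ + y′
    +-cong {x} {x′} {y} {y′} x≈x′ y≈y′ = mk≈ close
      where
      close : ∀ ε → 0ℚ ℚ.< ε → ∃ λ N → ∀ n → N ℕ.≤ n → ℚ.∣ seq (x + y) n ℚ.- seq (x′ + y′) n ∣ ℚ.< ε
      close ε 0<ε with converge x≈x′ (ε ℚ.* ½) (0<½ε 0<ε) | converge y≈y′ (ε ℚ.* ½) (0<½ε 0<ε)
      ... | M , f | N , g = M ℕ.⊔ N , λ n ≤n →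
        ∣+-+∣<ε (seq x n) (seq y n) (seq x′ n) (seq y′ n) (f n (⊔ˡ M N ≤n)) (g n (⊔ʳ M N ≤n))

    -‿cong : ∀ {x y} → x ≈ y → - x ≈ - y
    -‿cong {x} {y} x≈y = mk≈ λ ε 0<ε → let N , f = converge (≈-sym x≈y) ε 0<ε in
      N , λ n ≤n → subst (ℚ._< ε)
        (cong ℚ.∣_∣ (neg-neg (seq x n) (seq y n))) (f n ≤n)

    *-cong : ∀ {x x′ y y′} → x ≈ x′ → y ≈ y′ → x * y ≈ x′ * y′
    *-cong {x} {x′} {y} {y′} x≈x′ y≈y′ = mk≈ close
      where
      close : ∀ ε → 0ℚ ℚ.< ε → ∃ λ N → ∀ n → N ℕ.≤ n → ℚ.∣ seq (x * y) n ℚ.- seq (x′ * y′) n ∣ ℚ.< ε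
      close ε 0<ε =
        let A , A>0 , K , x<A = bounded x
            B , B>0 , L , y′<B = bounded y′
            δ , 0<δ , Aδ≡ = scale A A>0 0<ε
            δ′ , 0<δ′ , Bδ′≡ = scale B B>0 0<ε
            M , f = converge x≈x′ δ′ 0<δ′
            N , g = converge y≈y′ δ 0<δ
        in (K ℕ.⊔ L) ℕ.⊔ (M ℕ.⊔ N) , λ n ≤n →
        let KL≤n = ⊔ˡ (K ℕ.⊔ L) (M ℕ.⊔ N) ≤n
            MN≤n = ⊔ʳ (K ℕ.⊔ L) (M ℕ.⊔ N) ≤n
        in ∣*-*∣<ε (seq x n) (seq y n) (seq x′ n) (seq y′ n) A>0 B>0 Aδ≡ Bδ′≡
          (x<A n (⊔ˡ K L KL≤n)) (g n (⊔ʳ M N MN≤n))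
          (y′<B n (⊔ʳ K L KL≤n)) (f n (⊔ˡ M N MN≤n))

  ℝ-commutativeRing : CommutativeRing 0ℓ 0ℓ
  ℝ-commutativeRing = record
    { Carrier = ℝ ; _≈_ = _≈_ ; _+_ = _+_ ; _*_ = _*_ ; -_ = -_ ; 0# = 0# ; 1# = 1#
    ; isCommutativeRing = record
      { isRing = record
        { +-isAbelianGroup = record
          { isGroup = record
            { isMonoid = record
              { isSemigroup = record
                { isMagma = record
                  { isEquivalence = record
                    { refl = pointwise λ _ → ≡.refl ; sym = ≈-sym ; trans = ≈-trans }
                  ; ∙-cong = +-cong }
                ; assoc = λ x y z → pointwise λ n → ℚ.+-assoc (seq x n) (seq y n) (seq z n) }
              ; identity = (λ x → pointwise λ n → ℚ.+-identityˡ (seq x n))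
                         , (λ x → pointwise λ n → ℚ.+-identityʳ (seq x n)) }
            ; inverse = (λ x → pointwise λ n → ℚ.+-inverseˡ (seq x n))
                      , (λ x → pointwise λ n → ℚ.+-inverseʳ (seq x n))
            ; ⁻¹-cong = -‿cong }
          ; comm = λ x y → pointwise λ n → ℚ.+-comm (seq x n) (seq y n) }
        ; *-cong = *-cong
        ; *-assoc = λ x y z → pointwise λ n → ℚ.*-assoc (seq x n) (seq y n) (seq z n)
        ; *-identity = (λ x → pointwise λ n → ℚ.*-identityˡ (seq x n))
                     , (λ x → pointwise λ n → ℚ.*-identityʳ (seq x n))
        ; distrib = (λ x y z → pointwise λ n → ℚ.*-distribˡ-+ (seq x n) (seq y n) (seq z n))
                  , (λ x y z → pointwise λ n → ℚ.*-distribʳ-+ (seq x n) (seq y n) (seq z n)) }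
      ; *-comm = λ x y → pointwise λ n → ℚ.*-comm (seq x n) (seq y n) } }

module LinearAlgebra (X : Set) where

  open Reals
  open Algebra.Properties.CommutativeMonoid.Sum
    (CommutativeRing.+-commutativeMonoid ℝ-commutativeRing) using (sum)

  infix 4 _≐_
  _≐_ : (f g : X → ℝ) → Set
  f ≐ g = ∀ I → f I ≈ g I

  combination : ∀ {m} → (Fin m → ℝ) → (Fin m → X → ℝ) → X → ℝ
  combination c v I = sum (λ i → c i * v i I)

  Span : ∀ {m} → (Fin m → X → ℝ) → Pred (X → ℝ) 0ℓ
  Span v f = ∃[ c ] f ≐ combination c v

  LinearlyIndependent : ∀ {m} → (Fin m → X → ℝ) → Set
  LinearlyIndependent v = ∀ c → combination c v ≐ (λ _ → 0#) → ∀ i → c i ≈ 0#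

  -- A finite basis is given as a list; linear independence of the family of
  -- its entries rules out repetitions.
  IsBasis : Pred (X → ℝ) 0ℓ → List (X → ℝ) → Set
  IsBasis V bs =
    All V bs ×
    LinearlyIndependent (List.lookup bs) ×
    (∀ f → V f → Span (List.lookup bs) f)

  HasDimension : Pred (X → ℝ) 0ℓ → ℕ → Set
  HasDimension V d = ∃[ bs ] IsBasis V bs × List.length bs ≡ d

module OrderIdeals {n} {_≤_ : Rel (Fin n) 0ℓ}
  (isDecPartialOrder : IsDecPartialOrder _≡_ _≤_) where

  open Reals
  open IsDecPartialOrder isDecPartialOrder using (_≤?_; _≟_)

  IsOrderIdeal : Subset n → Set
  IsOrderIdeal I = ∀ x y → y ≤ x → x ∈ I → y ∈ I

  𝒥 : Set
  𝒥 = Σ (Subset n) IsOrderIdeal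

  open LinearAlgebra 𝒥
  open Algebra.Properties.CommutativeMonoid.Sum
    (CommutativeRing.+-commutativeMonoid ℝ-commutativeRing) using (sum)

  IsMax : Subset n → Fin n → Set
  IsMax I q = q ∈ I × (∀ y → y ∈ I → q ≤ y → y ≡ q)

  IsMinOfComplement : Subset n → Fin n → Set
  IsMinOfComplement I q = q ∉ I × (∀ y → y ∉ I → y ≤ q → y ≡ q)

  isMax? : ∀ I q → Dec (IsMax I q)
  isMax? I q = q ∈? I ×-dec Fin.all? λ y → y ∈? I →-dec (q ≤? y →-dec y ≟ q)

  isMinOfComplement? : ∀ I q → Dec (IsMinOfComplement I q)
  isMinOfComplement? I q = ¬? (q ∈? I) ×-dec Fin.all? λ y → ¬? (y ∈? I) →-dec (y ≤? q →-dec y ≟ q)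

  χ : Fin n → 𝒥 → ℝ
  χ q (I , _) = if does (isMax? I q) then 1# else 0#

  T : Fin n → 𝒥 → ℝ
  T q (I , _) =
    if does (isMinOfComplement? I q) then 1# else
    if does (isMax? I q) then - 1# else 0#

  _≡const : Pred (𝒥 → ℝ) 0ℓ
  f ≡const = Σ ℝ λ c → Σ (Fin n → ℝ) λ c′ → ∀ I → f I ≈ c + sum (λ q → c′ q * T q I)

  A-T : Pred (𝒥 → ℝ) 0ℓ
  A-T f = Span χ f × f ≡const

-- The order generated by a graded relation on a finite set, which is then its
-- cover relation.
module GradedOrder {n} {_⋖_ : Rel (Fin n) 0ℓ} (_⋖?_ : Decidable _⋖_)
  (rank : Fin n → ℤ) (rank-⋖ : ∀ {x y} → x ⋖ y → rank y ≡ + 1 ℤ.+ rank x) where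

  _≤_ : Rel (Fin n) 0ℓ
  _≤_ = Star _⋖_

  private
    module ℤ-Group = Algebra.Properties.AbelianGroup ℤ.+-0-abelianGroup

    Walk : ℕ → Rel (Fin n) 0ℓ
    Walk zero    x y = x ≡ y
    Walk (suc m) x y = ∃[ z ] x ⋖ z × Walk m z y

    walk? : ∀ m → Decidable (Walk m)
    walk? zero    x y = x Fin.≟ y
    walk? (suc m) x y = Fin.any? λ z → (x ⋖? z) ×-dec walk? m z y

    fromWalk : ∀ m {x y} → Walk m x y → x ≤ y
    fromWalk zero    ≡.refl        = nil
    fromWalk (suc m) (_ , x⋖z , w) = x⋖z ◅ fromWalk m w

    toWalk : ∀ {x y} → x ≤ y → ∃[ m ] rank y ≡ + m ℤ.+ rank x × Walk m x y
    toWalk {x} nil = 0 , ≡.sym (ℤ.+-identityˡ (rank x)) , ≡.refl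
    toWalk {x} {y} (_◅_ {j = z} x⋖z z≤y) with toWalk z≤y
    ... | m , eq , w = suc m , eq′ , z , x⋖z , w
      where
      open ≡.≡-Reasoning
      eq′ : rank y ≡ + suc m ℤ.+ rank x
      eq′ = begin
        rank y                       ≡⟨ eq ⟩
        + m ℤ.+ rank z               ≡⟨ cong (λ r → + m ℤ.+ r) (rank-⋖ x⋖z) ⟩
        + m ℤ.+ (+ 1 ℤ.+ rank x)     ≡⟨ ℤ.+-assoc (+ m) (+ 1) (rank x) ⟨
        + (m ℕ.+ 1) ℤ.+ rank x       ≡⟨ cong (λ k → + k ℤ.+ rank x) (ℕ.+-comm m 1) ⟩
        + suc m ℤ.+ rank x           ∎

    walkOfRankDifference : ∀ {x y} → x ≤ y → Walk ℤ.∣ rank y ℤ.- rank x ∣ x y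
    walkOfRankDifference {x} {y} x≤y with toWalk x≤y
    ... | m , eq , w = subst (λ k → Walk k x y) (≡.sym length≡) w
      where
      length≡ : ℤ.∣ rank y ℤ.- rank x ∣ ≡ m
      length≡ = cong ℤ.∣_∣ (≡.trans (cong (ℤ._- rank x) eq) (ℤ-Group.//-rightDividesʳ (rank x) (+ m)))

  rank-mono : ∀ {x y} → x ≤ y → rank x ℤ.≤ rank y
  rank-mono {x} x≤y with toWalk x≤y
  ... | m , eq , _ = subst (rank x ℤ.≤_) (≡.sym eq) (ℤ.i≤j+i (rank x) (+ m))

  rank-injective : ∀ {x y} → x ≤ y → rank y ℤ.≤ rank x → x ≡ y
  rank-injective {x} {y} x≤y ry≤rx =
    subst (λ k → Walk k x y) (cong ℤ.∣_∣ (ℤ.i≡j⇒i-j≡0 (ℤ.≤-antisym ry≤rx (rank-mono x≤y))))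
      (walkOfRankDifference x≤y)

  isDecPartialOrder : IsDecPartialOrder _≡_ _≤_
  isDecPartialOrder = record
    { isPartialOrder = record
      { isPreorder = record
        { isEquivalence = ≡.isEquivalence
        ; reflexive     = λ { ≡.refl → nil }
        ; trans         = _◅◅_
        }
      ; antisym = λ x≤y y≤x → rank-injective x≤y (rank-mono y≤x)
      }
    ; _≟_  = Fin._≟_
    ; _≤?_ = λ x y → map′ (fromWalk _) walkOfRankDifference (walk? ℤ.∣ rank y ℤ.- rank x ∣ x y)
    }

  IsCovering : Rel (Fin n) 0ℓ
  IsCovering x y = x ≤ y × x ≢ y × (∀ z → x ≤ z → z ≤ y → z ≡ x ⊎ z ≡ y)

  private
    ⋖⇒rank< : ∀ {x y} → x ⋖ y → rank x ℤ.< rank y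
    ⋖⇒rank< {x} x⋖y = subst (rank x ℤ.<_) (≡.sym (rank-⋖ x⋖y)) (ℤ.suc[i]≤j⇒i<j ℤ.≤-refl)

  ⋖⇒covering : ∀ {x y} → x ⋖ y → IsCovering x y
  ⋖⇒covering {x} {y} x⋖y = x⋖y ◅ nil , (λ { ≡.refl → ℤ.<-irrefl ≡.refl (⋖⇒rank< x⋖y) }) , between
    where
    between : ∀ z → x ≤ z → z ≤ y → z ≡ x ⊎ z ≡ y
    between z nil             z≤y = inj₁ ≡.refl
    between z (x⋖w ◅ w≤z) z≤y = inj₂ (rank-injective z≤y
      (subst (ℤ._≤ rank z) (≡.trans (rank-⋖ x⋖w) (≡.sym (rank-⋖ x⋖y))) (rank-mono w≤z)))

  covering⇒⋖ : ∀ {x y} → IsCovering x y → x ⋖ y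
  covering⇒⋖ (nil , x≢x , _) = contradiction ≡.refl x≢x
  covering⇒⋖ {x} (_◅_ {j = w} x⋖w w≤y , _ , between) with between w (x⋖w ◅ nil) w≤y
  ... | inj₁ ≡.refl = ⊥-elim (ℤ.<-irrefl ≡.refl (⋖⇒rank< x⋖w))
  ... | inj₂ ≡.refl = x⋖w

partialSum : ∀ {m} → Vec ℕ m → ℕ → ℕ
partialSum _        zero    = 0
partialSum []       (suc j) = 0
partialSum (x ∷ xs) (suc j) = x ℕ.+ partialSum xs j

partialSum-mono : ∀ {m} (xs : Vec ℕ m) {i j} → i ℕ.≤ j → partialSum xs i ℕ.≤ partialSum xs j
partialSum-mono xs       z≤n       = z≤n
partialSum-mono []       (s≤s i≤j) = z≤n
partialSum-mono (x ∷ xs) (s≤s i≤j) = ℕ.+-monoʳ-≤ x (partialSum-mono xs i≤j)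

partialSum-mono-< : ∀ {m} (xs : Vec ℕ m) → (∀ i → 1 ℕ.≤ lookup xs i) →
                    ∀ {i j} → i ℕ.< j → j ℕ.≤ m → partialSum xs i ℕ.< partialSum xs j
partialSum-mono-< (x ∷ xs) xs≥1 {zero}  (s≤s _)   _         = ℕ.≤-trans (xs≥1 Fin.zero) (ℕ.m≤m+n x _)
partialSum-mono-< (x ∷ xs) xs≥1 {suc i} (s≤s i<j) (s≤s j≤m) =
  ℕ.+-monoʳ-< x (partialSum-mono-< xs (λ i → xs≥1 (Fin.suc i)) i<j j≤m)

partialSum-total : ∀ {m} (xs : Vec ℕ m) → partialSum xs m ≡ Vec.sum xs
partialSum-total []       = ≡.refl
partialSum-total (x ∷ xs) = cong (x ℕ.+_) (partialSum-total xs)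

-- The fence of α = (α₁, …, α_t), where t = 2 + k.  A segment number i ∈ [t] is
-- represented by the element of Fin t with value i - 1, and a shared element
-- number i ∈ [t - 1] by the element of Fin (t - 1) with value i - 1.
module Fence {k} (α : Vec ℕ (2 ℕ.+ k)) (α≥1 : ∀ i → 1 ℕ.≤ lookup α i) where

  open Reals

  t : ℕ
  t = 2 ℕ.+ k

  a : ℕ → ℕ
  a = partialSum α

  n : ℕ
  n = Vec.sum α ℕ.∸ 1

  -- The element x_j is the element of Fin n with value j - 1.
  pos : Fin n → ℕ
  pos x = suc (toℕ x)

  number : Fin t → ℕ
  number i = suc (toℕ i)

  Ascending Descending : ℕ → Set
  Ascending  j = ∃[ i ] (¬ 2 ∣ number i) × a (number i ℕ.∸ 1) ℕ.≤ j × j ℕ.< a (number i)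
  Descending j = ∃[ i ] (2 ∣ number i)   × a (number i ℕ.∸ 1) ℕ.≤ j × j ℕ.< a (number i)

  infix 4 _⋖_
  _⋖_ : Rel (Fin n) 0ℓ
  x ⋖ y = (pos y ≡ suc (pos x) × Ascending (pos x))
        ⊎ (pos x ≡ suc (pos y) × Descending (pos y))

  ascending? : ∀ j → Dec (Ascending j)
  ascending? j = Fin.any? λ i →
    ¬? (2 ∣? number i) ×-dec a (number i ℕ.∸ 1) ℕ.≤? j ×-dec j ℕ.<? a (number i)

  descending? : ∀ j → Dec (Descending j)
  descending? j = Fin.any? λ i →
    (2 ∣? number i) ×-dec a (number i ℕ.∸ 1) ℕ.≤? j ×-dec j ℕ.<? a (number i)

  _⋖?_ : Decidable _⋖_
  x ⋖? y = (pos y ℕ.≟ suc (pos x) ×-dec ascending? (pos x))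
    ⊎-dec (pos x ℕ.≟ suc (pos y) ×-dec descending? (pos y))

  descending⇒¬ascending : ∀ {j} → Descending j → ¬ Ascending j
  descending⇒¬ascending (i , even , aᵢ₋₁≤j , j<aᵢ) (i′ , odd , aᵢ′₋₁≤j , j<aᵢ′)
    with ℕ.<-cmp (toℕ i) (toℕ i′)
  ... | tri< i<i′ _ _ = ℕ.<⇒≱ j<aᵢ (ℕ.≤-trans (partialSum-mono α i<i′) aᵢ′₋₁≤j)
  ... | tri≈ _ i≡i′ _ = odd (subst (λ m → 2 ∣ suc m) i≡i′ even)
  ... | tri> _ _ i′<i = ℕ.<⇒≱ j<aᵢ′ (ℕ.≤-trans (partialSum-mono α i′<i) aᵢ₋₁≤j)

  height : ℕ → ℤ
  height zero    = + 0
  height (suc j) = if does (ascending? j) then + 1 ℤ.+ height j else ℤ.-1ℤ ℤ.+ height j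

  rank : Fin n → ℤ
  rank x = height (pos x)

  rank-⋖ : ∀ {x y} → x ⋖ y → rank y ≡ + 1 ℤ.+ rank x
  rank-⋖ {x} {y} (inj₁ (y≡1+x , asc)) rewrite ℕ.suc-injective y≡1+x | dec-true (ascending? (pos x)) asc = ≡.refl
  rank-⋖ {x} {y} (inj₂ (x≡1+y , desc))
    rewrite ℕ.suc-injective x≡1+y | dec-false (ascending? (pos y)) (descending⇒¬ascending desc) =
    ≡.sym (≡.trans (≡.sym (ℤ.+-assoc (+ 1) ℤ.-1ℤ (rank y))) (ℤ.+-identityˡ (rank y)))

  open GradedOrder _⋖?_ rank (λ {x} {y} → rank-⋖ {x} {y}) public
  open OrderIdeals isDecPartialOrder public
  open LinearAlgebra 𝒥 public

  shared : Fin (suc k) → Fin n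
  shared i = fromℕ< {a (suc (toℕ i)) ℕ.∸ 1} (ℕ.∸-monoˡ-< aᵢ<aₜ 1≤aᵢ)
    where
    1≤aᵢ : 1 ℕ.≤ a (suc (toℕ i))
    1≤aᵢ = partialSum-mono-< α α≥1 (s≤s z≤n) (ℕ.m≤n⇒m≤1+n (Fin.toℕ<n i))
    aᵢ<aₜ : a (suc (toℕ i)) ℕ.< Vec.sum α
    aᵢ<aₜ = subst (a (suc (toℕ i)) ℕ.<_) (partialSum-total α)
      (partialSum-mono-< α α≥1 (s≤s (Fin.toℕ<n i)) ℕ.≤-refl)

  IsShared : Fin n → Set
  IsShared x = ∃[ i ] x ≡ shared i

  -- χ_{s_i} for 0 ≤ i ≤ t, where χ_{s_0} and χ_{s_t} are zero by convention.
  χ-shared : ℕ → 𝒥 → ℝ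
  χ-shared zero    I = 0#
  χ-shared (suc i) I with i ℕ.<? suc k
  ... | yes i<t-1 = χ (shared (fromℕ< i<t-1)) I
  ... | no  _     = 0#

  -- Since a₀ = 0 < j ≤ n < a_t for every x_j, the same bounds also describe
  -- the first and the last segment.
  Segment : Fin t → Fin n → Set
  Segment i x = a (number i ℕ.∸ 1) ℕ.≤ pos x × pos x ℕ.≤ a (number i)

  UnsharedSegment : Fin t → Fin n → Set
  UnsharedSegment i x = Segment i x × ¬ IsShared x

  unsharedSegment? : ∀ i x → Dec (UnsharedSegment i x)
  unsharedSegment? i x =
    (a (number i ℕ.∸ 1) ℕ.≤? pos x ×-dec pos x ℕ.≤? a (number i))
    ×-dec ¬? (Fin.any? λ j → x Fin.≟ shared j)

  basisElement : Fin t → Fin n → 𝒥 → ℝ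
  basisElement i x I =
    fromℕ (lookup α i) * χ x I + χ-shared (number i ℕ.∸ 1) I + χ-shared (number i) I

  ℬ-A : List (𝒥 → ℝ)
  ℬ-A = concatMap (λ i → List.map (basisElement i) (filter (unsharedSegment? i) (allFin n))) (allFin t)

{-# OPTIONS --safe #-}

-- Label the positions of the fence by 0/1-sequences y, an ideal being a sequence that decreases
-- upwards along every edge.  Write T_q = τ_q - χ_q, where τ_q is the indicator of q ∈ min(F ∖ I).
--
-- Membership.  On a segment, T_q is the second difference of y at every unshared q, so modulo the
-- T_q the sequence y is an arithmetic progression there; χ_q is one of its (equal) steps, and at the
-- two ends y is χ_s at a peak s and 1 - χ_s at a valley s.  Hence α_i χ_x ≡ 1 - χ_{s_{i-1}} - χ_{s_i}.
--
-- Independence and spanning.  Evaluating at the principal ideal of an unshared x picks out the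
-- coefficient of the basis element of x, so it remains to see that h ∈ A_T is zero if it vanishes at
-- these ideals.  Write h = Σ e_q χ_q = κ + Σ c_q T_q; then e_q = 0 for unshared q, and
-- Σ (A_q χ_q + B_q τ_q) is constant for A = e + c and B = - c.  Evaluating at sequences that are
-- constant on both sides of one position gives B = 0 at peaks and A = 0 at valleys (a mixed second
-- difference), and then that c extended by 0 to the ends of each segment is harmonic on it, hence 0.
-- What is left of the sum only depends on y at the shared elements, so toggling one of them gives e = 0.

module Submission where

open import Defs
open import Level using (0ℓ)
open import Algebra.Bundles using (AbelianGroup; CommutativeRing)
open import Algebra.Core using (Op₁; Op₂)
import Algebra.Properties.AbelianGroup
import Algebra.Properties.CommutativeMonoid.Sum
import Algebra.Properties.Monoid.Mult
import Algebra.Properties.Semiring.Sum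
import Algebra.Solver.Ring
open import Algebra.Solver.Ring.AlmostCommutativeRing using (fromCommutativeRing; _-Raw-AlmostCommutative⟶_)
open import Algebra.Structures using (IsCommutativeRing)
open import Data.Bool.Base using (Bool; true; false; not; _∧_; if_then_else_)
open import Data.Bool.Properties using (not-involutive; ∧-zeroʳ; ∧-identityʳ; ∧-comm)
open import Data.Empty using (⊥; ⊥-elim)
open import Data.Fin.Base as Fin using (Fin; zero; suc; toℕ; inject₁; fromℕ<)
import Data.Fin.Properties as Fin
open import Data.Fin.Subset using (Subset; _∈_; _∉_)
open import Data.Integer.Base as ℤ using (+_)
import Data.Integer.Properties as ℤ
open import Data.List.Base as List
  using (List; []; _∷_; _++_; length; concatMap; filter; tabulate; allFin; cartesianProduct)
open import Data.List.Membership.Propositional using () renaming (_∈_ to _∈ₗ_)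
open import Data.List.Membership.Propositional.Properties
  using (∈-allFin; ∈-cartesianProduct⁺; ∈-filter⁺; ∈-filter⁻)
open import Data.List.Properties using (filter-++; length-++; length-map; map-++; map-cong; map-tabulate)
open import Data.List.Relation.Unary.All as All using (All; []; _∷_)
import Data.List.Relation.Unary.All.Properties as All
open import Data.List.Relation.Unary.AllPairs using ([]; _∷_)
open import Data.List.Relation.Unary.Any using (here; there)
open import Data.List.Relation.Unary.Unique.Propositional using (Unique)
import Data.List.Relation.Unary.Unique.Propositional.Properties as Unique
open import Data.Maybe.Base as Maybe using (Maybe)
open import Data.Nat.Base as ℕ using (ℕ; zero; suc; z≤n; s≤s; pred)
open import Data.Nat.Divisibility using (_∣_; _∣?_; _∣0; ∣1⇒≡1; ∣m+n∣m⇒∣n; ∣m∣n⇒∣m+n; ∣-refl)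
import Data.Nat.ListAction as ℕ-List
import Data.Nat.Properties as ℕ
open import Data.Product.Base using (Σ; ∃-syntax; _×_; _,_; proj₁; proj₂; uncurry)
open import Data.Rational.Base as ℚ using (ℚ; 0ℚ; 1ℚ)
import Data.Rational.Properties as ℚ
import Data.Rational.Unnormalised.Base as ℚᵘ
import Data.Rational.Unnormalised.Properties as ℚᵘ
open import Data.Sum.Base as Sum using (_⊎_; inj₁; inj₂)
open import Data.Vec.Base as Vec using (Vec; []; _∷_; lookup; head; last)
open import Data.Vec.Properties using ([]=⇒lookup; lookup⇒[]=; lookup∘tabulate)
open import Function.Base using (_∘_; case_of_)
open import Relation.Binary.Construct.Closure.ReflexiveTransitive using (_◅_; _◅◅_) renaming (ε to nil)
open import Relation.Binary.Core using (Rel)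
open import Relation.Binary.Definitions using (tri<; tri≈; tri>)
open import Relation.Binary.PropositionalEquality as ≡ using (_≡_; _≢_; cong; subst)
import Relation.Binary.Reasoning.Setoid
open import Relation.Binary.Structures using (IsDecPartialOrder)
open import Relation.Nullary using (¬_; Dec; yes; no; does; contradiction)
open import Relation.Nullary.Decidable using (_×-dec_; dec-true; dec-false; dec⇒maybe)
open import Relation.Unary using (Pred; Decidable; _∩_)

-- Reversing the order exchanges ideals with complements, χ with τ and peaks with valleys, so the
-- vanishing of coefficients is worked out only at peaks and along ascending segments. The order of
-- the vanishing steps is forced. Toggling one element inside a segment changes its own term and
-- those of its two neighbours; with A = c = -B at unshared elements, the resulting relation says
-- that c is the mean of its neighbours. Next to an end of the segment, however, an outer term
-- belongs to a shared element, whose χ or τ also depends on the adjacent segment. The relation is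
-- usable there only if the coefficient concerned is already known to be zero: A at the lower end, B
-- at the upper end of an ascending segment. The mixed second difference at peaks and valleys
-- supplies exactly these zeros and asks for no knowledge of the other coefficients. They also serve
-- as the boundary values that force c = 0, because α_i is invertible.

-- Ideals of a path as 0/1-sequences

-- Position j is maximal in the ideal y when up j and dn j say that j + 1 covers j, resp. j covers j + 1;
-- with up and dn exchanged and y complemented it is minimal in the complement.
peakBit : (up dn y : ℕ → Bool) → ℕ → Bool
peakBit up dn y j = y j ∧ not (dn (pred j) ∧ y (pred j)) ∧ not (up j ∧ y (suc j))

peakBit-local : ∀ up dn y y′ j → y (pred j) ≡ y′ (pred j) → y j ≡ y′ j → y (suc j) ≡ y′ (suc j) →
                peakBit up dn y j ≡ peakBit up dn y′ j
peakBit-local up dn y y′ j eq₁ eq₂ eq₃ rewrite eq₁ | eq₂ | eq₃ = ≡.refl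

Valid : (up dn y : ℕ → Bool) → Set
Valid up dn y = (∀ j → up j ≡ true → y (suc j) ≡ true → y j ≡ true)
              × (∀ j → dn j ≡ true → y j ≡ true → y (suc j) ≡ true)

-- The complement of an ideal is an ideal of the opposite order; this is the combinatorial half of
-- the duality between peaks and valleys.
complement-valid : ∀ {up dn y} → Valid up dn y → Valid dn up (not ∘ y)
complement-valid {y = y} (f , g) =
  (λ j e h → contraposition (g j e) h) , (λ j e h → contraposition (f j e) h)
  where
  contraposition : ∀ {a b} → (a ≡ true → b ≡ true) → not b ≡ true → not a ≡ true
  contraposition {false}         h _ = ≡.refl
  contraposition {true}  {false} h _ = h ≡.refl

-- Besides the principal ideals, sequences of this shape are the only ones at which the independence
-- argument evaluates.
split : ℕ → Bool → Bool → Bool → ℕ → Bool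
split zero    l b r zero    = b
split zero    l b r (suc j) = r
split (suc p) l b r zero    = l
split (suc p) l b r (suc j) = split p l b r j

split-≡ : ∀ p {l b r} → split p l b r p ≡ b
split-≡ zero    = ≡.refl
split-≡ (suc p) = split-≡ p

split-< : ∀ p {l b r j} → j ℕ.< p → split p l b r j ≡ l
split-< (suc p) {j = zero}  _         = ≡.refl
split-< (suc p) {j = suc j} (s≤s j<p) = split-< p j<p

split-> : ∀ p {l b r j} → p ℕ.< j → split p l b r j ≡ r
split-> zero    {j = suc j} _         = ≡.refl
split-> (suc p) {j = suc j} (s≤s p<j) = split-> p p<j

-- Every edge that avoids position p + 1 joins two equal values, so only the two edges at that
-- position impose conditions.
split-valid : ∀ {up dn} p {l b r} →
  (up p ≡ true → b ≡ true → l ≡ true) → (dn p ≡ true → l ≡ true → b ≡ true) →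
  (up (suc p) ≡ true → r ≡ true → b ≡ true) → (dn (suc p) ≡ true → b ≡ true → r ≡ true) →
  Valid up dn (split (suc p) l b r)
split-valid {up} {dn} p {l} {b} {r} up₁ dn₁ up₂ dn₂ = (λ j → proj₁ (edge j)) , (λ j → proj₂ (edge j))
  where
  y = split (suc p) l b r
  edge : ∀ j → (up j ≡ true → y (suc j) ≡ true → y j ≡ true) × (dn j ≡ true → y j ≡ true → y (suc j) ≡ true)
  edge j with ℕ.<-cmp j p
  ... | tri< j<p _ _ rewrite split-< (suc p) {l} {b} {r} {j} (ℕ.m<n⇒m<1+n j<p) | split-< p {l} {b} {r} {j} j<p =
        (λ _ h → h) , (λ _ h → h)
  ... | tri≈ _ ≡.refl _ rewrite split-< (suc p) {l} {b} {r} {p} ℕ.≤-refl | split-≡ p {l} {b} {r} = up₁ , dn₁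
  ... | tri> _ _ p<j with ℕ.m≤n⇒m<n∨m≡n p<j
  ...   | inj₂ ≡.refl rewrite split-≡ p {l} {b} {r} | split-> p {l} {b} {r} {suc p} ℕ.≤-refl = up₂ , dn₂
  ...   | inj₁ 1+p<j rewrite split-> (suc p) {l} {b} {r} {j} 1+p<j | split-> p {l} {b} {r} {j} p<j =
        (λ _ h → h) , (λ _ h → h)

-- Partial sums, parity, bits and lengths of lists

partialSum-suc : ∀ {m} (xs : Vec ℕ m) i → partialSum xs (suc (toℕ i)) ≡ partialSum xs (toℕ i) ℕ.+ lookup xs i
partialSum-suc (x ∷ xs) zero    = ℕ.+-comm x 0
partialSum-suc (x ∷ xs) (suc i) = ≡.trans (cong (x ℕ.+_) (partialSum-suc xs i)) (≡.sym (ℕ.+-assoc x _ _))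

partialSum-last : ∀ {m} (xs : Vec ℕ (suc m)) → partialSum xs m ℕ.+ last xs ≡ partialSum xs (suc m)
partialSum-last (x ∷ [])         = ℕ.+-comm 0 x
partialSum-last (x ∷ xs@(_ ∷ _)) = ≡.trans (ℕ.+-assoc x _ _) (cong (x ℕ.+_) (partialSum-last xs))

even⇒odd-suc : ∀ {m} → 2 ∣ m → ¬ 2 ∣ suc m
even⇒odd-suc {m} 2∣m 2∣1+m with ∣1⇒≡1 (∣m+n∣m⇒∣n (subst (2 ∣_) (ℕ.+-comm 1 m) 2∣1+m) 2∣m)
... | ()

odd⇒even-suc : ∀ {m} → ¬ 2 ∣ m → 2 ∣ suc m
odd⇒even-suc {zero}        odd = contradiction (2 ∣0) odd
odd⇒even-suc {suc zero}    odd = ∣-refl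
odd⇒even-suc {suc (suc m)} odd = ∣m∣n⇒∣m+n ∣-refl (odd⇒even-suc {m} (odd ∘ ∣m∣n⇒∣m+n ∣-refl))

even-pred : ∀ {m} → ¬ 2 ∣ suc m → 2 ∣ m
even-pred {m} odd with 2 ∣? m
... | yes even = even
... | no  odd′ = contradiction (odd⇒even-suc odd′) odd

does-⇔ : ∀ {P : Set} (P? : Dec P) {b} → (P → b ≡ true) → (b ≡ true → P) → does P? ≡ b
does-⇔ (yes p) {b}     f g = ≡.sym (f p)
does-⇔ (no ¬p) {false} f g = ≡.refl
does-⇔ (no ¬p) {true}  f g = contradiction (g ≡.refl) ¬p

does⇒ : ∀ {P : Set} (P? : Dec P) → does P? ≡ true → P
does⇒ (yes p) _ = p

not-true : ∀ {b} → ¬ b ≡ true → not b ≡ true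
not-true {false} _ = ≡.refl
not-true {true}  h = contradiction ≡.refl h

not-true⁻ : ∀ {b} → not b ≡ true → ¬ b ≡ true
not-true⁻ {false} _ ()

∧-true : ∀ {b c} → b ∧ c ≡ true → b ≡ true × c ≡ true
∧-true {true} {true} _ = ≡.refl , ≡.refl

peakBit⁺ : ∀ {up dn y j} → y j ≡ true → (dn (pred j) ≡ true → y (pred j) ≡ true → ⊥) →
           (up j ≡ true → y (suc j) ≡ true → ⊥) → peakBit up dn y j ≡ true
peakBit⁺ {up} {dn} {y} {j} h f g rewrite h
  | not-true (λ e → f (proj₁ (∧-true e)) (proj₂ (∧-true {dn (pred j)} {y (pred j)} e)))
  | not-true (λ e → g (proj₁ (∧-true e)) (proj₂ (∧-true {up j} {y (suc j)} e))) = ≡.refl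

peakBit⁻ : ∀ {up dn y j} → peakBit up dn y j ≡ true → y j ≡ true ×
           (dn (pred j) ≡ true → y (pred j) ≡ true → ⊥) × (up j ≡ true → y (suc j) ≡ true → ⊥)
peakBit⁻ {up} {dn} {y} {j} e with y j | dn (pred j) | y (pred j) | up j | y (suc j)
peakBit⁻ () | true  | true  | true  | _     | _
peakBit⁻ () | true  | true  | false | true  | true
peakBit⁻ () | true  | false | _     | true  | true
peakBit⁻ _  | true  | false | _     | false | _     = ≡.refl , (λ ()) , (λ ())
peakBit⁻ _  | true  | false | _     | true  | false = ≡.refl , (λ ()) , (λ _ ())
peakBit⁻ _  | true  | true  | false | false | _     = ≡.refl , (λ _ ()) , (λ ())
peakBit⁻ _  | true  | true  | false | true  | false = ≡.refl , (λ _ ()) , (λ _ ())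

length-concatMap : ∀ {A B : Set} (f : A → List B) xs → length (concatMap f xs) ≡ ℕ-List.sum (List.map (length ∘ f) xs)
length-concatMap f []       = ≡.refl
length-concatMap f (x ∷ xs) = ≡.trans (length-++ (f x)) (cong (length (f x) ℕ.+_) (length-concatMap f xs))

sum-tabulate : ∀ (f : ℕ → ℕ) {m} (xs : Vec ℕ m) → ℕ-List.sum (tabulate (f ∘ lookup xs)) ≡ Vec.sum (Vec.map f xs)
sum-tabulate f []       = ≡.refl
sum-tabulate f (x ∷ xs) = cong (f x ℕ.+_) (sum-tabulate f xs)

-- Generality in `f` lets the induction drop the first index, which lowers both bounds by one until
-- `lo` reaches 0.
length-filter-interval : ∀ {A : Set} {P : Pred A 0ℓ} (P? : Decidable P) {n} (f : Fin n → A) lo hi → hi ℕ.≤ n →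
  (∀ x → P (f x) → lo ℕ.≤ toℕ x × toℕ x ℕ.< hi) → (∀ x → lo ℕ.≤ toℕ x → toℕ x ℕ.< hi → P (f x)) →
  length (filter P? (tabulate f)) ≡ hi ℕ.∸ lo
length-filter-interval P? {zero}  f lo .0 z≤n _ _ = ≡.sym (ℕ.0∸n≡0 lo)
length-filter-interval P? {suc n} f lo hi hi≤ P⇒ ⇒P with P? (f zero)
length-filter-interval P? {suc n} f lo hi hi≤ P⇒ ⇒P | yes p with P⇒ zero p
length-filter-interval P? {suc n} f lo (suc hi) (s≤s hi≤) P⇒ ⇒P | yes p | z≤n , _ =
  cong suc (length-filter-interval P? (f ∘ suc) 0 hi hi≤ (λ x q → z≤n , ℕ.s<s⁻¹ (proj₂ (P⇒ (suc x) q)))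
    (λ x _ x<hi → ⇒P (suc x) z≤n (s≤s x<hi)))
length-filter-interval P? {suc n} f zero (suc hi) hi≤ P⇒ ⇒P | no ¬p = contradiction (⇒P zero z≤n (s≤s z≤n)) ¬p
length-filter-interval P? {suc n} f lo zero hi≤ P⇒ ⇒P | no ¬p = ≡.trans
  (length-filter-interval P? (f ∘ suc) lo 0 z≤n (λ x q → contradiction (proj₂ (P⇒ (suc x) q)) λ ()) (λ _ _ ()))
  ≡.refl
length-filter-interval P? {suc n} f (suc lo) (suc hi) (s≤s hi≤) P⇒ ⇒P | no ¬p =
  length-filter-interval P? (f ∘ suc) lo hi hi≤
    (λ x q → ℕ.s≤s⁻¹ (proj₁ (P⇒ (suc x) q)) , ℕ.s<s⁻¹ (proj₂ (P⇒ (suc x) q)))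
    (λ x lo≤ x<hi → ⇒P (suc x) (s≤s lo≤) (s≤s x<hi))

-- Rewrites the nested list `ℬ-A` as the image of one duplicate-free list of pairs, the form that
-- `biorthogonal⇒basis` expects.
map-filter-cartesianProduct : ∀ {A B C : Set} {P : A → Pred B 0ℓ} (P? : ∀ x → Decidable (P x)) (g : A → B → C) xs ys →
  List.map (uncurry g) (filter (uncurry P?) (cartesianProduct xs ys)) ≡ concatMap (λ x → List.map (g x) (filter (P? x) ys)) xs
map-filter-cartesianProduct P? g []       ys = ≡.refl
map-filter-cartesianProduct P? g (x ∷ xs) ys = begin
  List.map (uncurry g) (filter (uncurry P?) (List.map (x ,_) ys ++ cartesianProduct xs ys))
    ≡⟨ cong (List.map (uncurry g)) (filter-++ (uncurry P?) (List.map (x ,_) ys) _) ⟩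
  List.map (uncurry g) (filter (uncurry P?) (List.map (x ,_) ys) ++ filter (uncurry P?) (cartesianProduct xs ys))
    ≡⟨ map-++ (uncurry g) (filter (uncurry P?) (List.map (x ,_) ys)) _ ⟩
  List.map (uncurry g) (filter (uncurry P?) (List.map (x ,_) ys)) ++ List.map (uncurry g) (filter (uncurry P?) (cartesianProduct xs ys))
    ≡⟨ ≡.cong₂ _++_ (row ys) (map-filter-cartesianProduct P? g xs ys) ⟩
  List.map (g x) (filter (P? x) ys) ++ concatMap (λ x → List.map (g x) (filter (P? x) ys)) xs ∎
  where
  open ≡.≡-Reasoning
  row : ∀ ys → List.map (uncurry g) (filter (uncurry P?) (List.map (x ,_) ys)) ≡ List.map (g x) (filter (P? x) ys)
  row []       = ≡.refl
  row (y ∷ ys) with P? x y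
  ... | yes _ = cong (g x y ∷_) (row ys)
  ... | no  _ = row ys

-- Positions, edges and segments of a fence

module FencePositions {k} (α : Vec ℕ (2 ℕ.+ k)) (α≥1 : ∀ i → 1 ℕ.≤ lookup α i)
  (α₁≥2 : 2 ℕ.≤ head α) (αₜ≥2 : 2 ℕ.≤ last α) where

  open Fence α α≥1 using
    ( t; a; n; pos; number; Ascending; Descending; _⋖_; ascending?; descending?; descending⇒¬ascending; _≤_
    ; isDecPartialOrder; IsOrderIdeal; 𝒥; IsMax; IsMinOfComplement; isMax?; isMinOfComplement?
    ; shared; UnsharedSegment )
  open IsDecPartialOrder isDecPartialOrder using (_≤?_; antisym)

  aₜ≡1+n : a t ≡ suc n
  aₜ≡1+n = ≡.trans (partialSum-total α) (≡.sym (ℕ.m+[n∸m]≡n {1} {Vec.sum α} (subst (1 ℕ.≤_) (partialSum-total α)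
    (partialSum-mono-< α α≥1 (s≤s z≤n) ℕ.≤-refl))))

  a-suc : ∀ i → a (number i) ≡ a (toℕ i) ℕ.+ lookup α i
  a-suc = partialSum-suc α

  segment-end≤ : ∀ (i : Fin t) → a (number i) ℕ.≤ suc n
  segment-end≤ i = subst (a (number i) ℕ.≤_) aₜ≡1+n (partialSum-mono α (Fin.toℕ<n i))

  -- Here α₁ ≥ 2 enters: every shared element has a left neighbour in the fence.
  2≤a : ∀ i → 2 ℕ.≤ a (suc i)
  2≤a i = ℕ.≤-trans (head≤ α α₁≥2) (partialSum-mono α {1} {suc i} (s≤s z≤n))
    where
    head≤ : (xs : Vec ℕ (2 ℕ.+ k)) → 2 ℕ.≤ head xs → 2 ℕ.≤ partialSum xs 1
    head≤ (x ∷ _) h = ℕ.≤-trans h (ℕ.m≤m+n x 0)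

  -- Here α_t ≥ 2 enters: every shared element has a right neighbour in the fence.
  a<n : ∀ (i : Fin (suc k)) → a (suc (toℕ i)) ℕ.< n
  a<n i = ℕ.≤-trans (s≤s (partialSum-mono α (Fin.toℕ<n i))) (ℕ.s≤s⁻¹ (begin
    2 ℕ.+ a (suc k)         ≡⟨ ℕ.+-comm 2 (a (suc k)) ⟩
    a (suc k) ℕ.+ 2         ≤⟨ ℕ.+-monoʳ-≤ (a (suc k)) αₜ≥2 ⟩
    a (suc k) ℕ.+ last α    ≡⟨ partialSum-last α ⟩
    a t                     ≡⟨ aₜ≡1+n ⟩
    suc n                   ∎))
    where open ℕ.≤-Reasoning

  element : ∀ j → 1 ℕ.≤ j → j ℕ.≤ n → ∃[ x ] pos x ≡ j
  element (suc j) _ j<n = fromℕ< j<n , cong suc (Fin.toℕ-fromℕ< j<n)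

  pos-injective : ∀ {x y} → pos x ≡ pos y → x ≡ y
  pos-injective eq = Fin.toℕ-injective (ℕ.suc-injective eq)

  pos≤n : ∀ x → pos x ℕ.≤ n
  pos≤n = Fin.toℕ<n

  pos-shared : ∀ i → pos (shared i) ≡ a (suc (toℕ i))
  pos-shared i = ≡.trans (cong suc (Fin.toℕ-fromℕ< _)) (ℕ.m+[n∸m]≡n (ℕ.≤-trans (s≤s z≤n) (2≤a (toℕ i))))

  Inner : ℕ → Set
  Inner j = 1 ℕ.≤ j × j ℕ.< n

  inner? : ∀ j → Dec (Inner j)
  inner? j = 1 ℕ.≤? j ×-dec j ℕ.<? n

  -- false outside 1 ≤ j < n, unlike Ascending and Descending, which also cover j = 0 and j = n.
  up dn : ℕ → Bool
  up j = does (inner? j ×-dec ascending? j)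
  dn j = does (inner? j ×-dec descending? j)

  up⁺ : ∀ {j} → Inner j → Ascending j → up j ≡ true
  up⁺ {j} p q = dec-true (inner? j ×-dec ascending? j) (p , q)

  dn⁺ : ∀ {j} → Inner j → Descending j → dn j ≡ true
  dn⁺ {j} p q = dec-true (inner? j ×-dec descending? j) (p , q)

  up⁻ : ∀ {j} → up j ≡ true → Inner j × Ascending j
  up⁻ {j} = does⇒ (inner? j ×-dec ascending? j)

  dn⁻ : ∀ {j} → dn j ≡ true → Inner j × Descending j
  dn⁻ {j} = does⇒ (inner? j ×-dec descending? j)

  exclusive : ∀ j → up j ≡ true → dn j ≡ true → ⊥
  exclusive j u d = descending⇒¬ascending (proj₂ (dn⁻ {j} d)) (proj₂ (up⁻ {j} u))

  ascending⇒¬dn : ∀ {j} → Ascending j → dn j ≡ false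
  ascending⇒¬dn {j} asc = dec-false (inner? j ×-dec descending? j) λ (_ , desc) → descending⇒¬ascending desc asc

  descending⇒¬up : ∀ {j} → Descending j → up j ≡ false
  descending⇒¬up {j} desc = dec-false (inner? j ×-dec ascending? j) λ (_ , asc) → descending⇒¬ascending desc asc

  ⋖⇒edge : ∀ {x y} → x ⋖ y →
    (pos y ≡ suc (pos x) × up (pos x) ≡ true) ⊎ (pos x ≡ suc (pos y) × dn (pos y) ≡ true)
  ⋖⇒edge {x} {y} (inj₁ (eq , asc))  = inj₁ (eq , up⁺ (s≤s z≤n , subst (ℕ._≤ n) eq (pos≤n y)) asc)
  ⋖⇒edge {x} {y} (inj₂ (eq , desc)) = inj₂ (eq , dn⁺ (s≤s z≤n , subst (ℕ._≤ n) eq (pos≤n x)) desc)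

  up⇒⋖ : ∀ {j} → up j ≡ true → ∃[ x ] ∃[ y ] pos x ≡ j × pos y ≡ suc j × x ⋖ y
  up⇒⋖ {j} u =
    let (1≤j , j<n) , asc = up⁻ {j} u
        x , x≡j = element j 1≤j (ℕ.<⇒≤ j<n)
        y , y≡1+j = element (suc j) (s≤s z≤n) j<n
    in x , y , x≡j , y≡1+j , inj₁ (≡.trans y≡1+j (cong suc (≡.sym x≡j)) , subst Ascending (≡.sym x≡j) asc)

  dn⇒⋖ : ∀ {j} → dn j ≡ true → ∃[ x ] ∃[ y ] pos x ≡ j × pos y ≡ suc j × y ⋖ x
  dn⇒⋖ {j} d =
    let (1≤j , j<n) , desc = dn⁻ {j} d
        x , x≡j = element j 1≤j (ℕ.<⇒≤ j<n)
        y , y≡1+j = element (suc j) (s≤s z≤n) j<n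
    in x , y , x≡j , y≡1+j , inj₂ (≡.trans y≡1+j (cong suc (≡.sym x≡j)) , subst Descending (≡.sym x≡j) desc)

  ⋖⇒≢ : ∀ {x y} → x ⋖ y → x ≢ y
  ⋖⇒≢ {x} (inj₁ (eq , _)) ≡.refl = ℕ.1+n≢n (≡.sym eq)
  ⋖⇒≢ {x} (inj₂ (eq , _)) ≡.refl = ℕ.1+n≢n (≡.sym eq)

  ∈⇒lookup : ∀ {I : Subset n} {x} → x ∈ I → lookup I x ≡ true
  ∈⇒lookup = []=⇒lookup

  lookup⇒∈ : ∀ {I : Subset n} {x} → lookup I x ≡ true → x ∈ I
  lookup⇒∈ {I} {x} = lookup⇒[]= x I

  suc-pred-a : ∀ i → suc (pred (a (suc i))) ≡ a (suc i)
  suc-pred-a i = ℕ.suc-pred (a (suc i)) {{ℕ.>-nonZero (ℕ.<⇒≤ (2≤a i))}}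

  -- Only the values of `y` at the positions 1 to n are tied to the ideal, so this applies both to a
  -- sequence turned into an ideal and to `bits`, which has extra values at 0 and n + 1.
  module Represented {I : Subset n} (ideal : IsOrderIdeal I) {y : ℕ → Bool} (rep : ∀ x → lookup I x ≡ y (pos x)) where

    ∈⇒y : ∀ {x j} → pos x ≡ j → x ∈ I → y j ≡ true
    ∈⇒y {x} ≡.refl x∈I = ≡.trans (≡.sym (rep x)) (∈⇒lookup x∈I)

    y⇒∈ : ∀ {x j} → pos x ≡ j → y j ≡ true → x ∈ I
    y⇒∈ {x} ≡.refl yj = lookup⇒∈ (≡.trans (rep x) yj)

    valid : Valid up dn y
    valid =
      (λ j u yj → let x , z , x≡ , z≡ , x⋖z = up⇒⋖ {j} u in ∈⇒y x≡ (ideal z x (x⋖z ◅ nil) (y⇒∈ z≡ yj))) ,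
      (λ j d yj → let x , z , x≡ , z≡ , z⋖x = dn⇒⋖ {j} d in ∈⇒y z≡ (ideal x z (z⋖x ◅ nil) (y⇒∈ x≡ yj)))

    -- Testing the neighbours suffices: if q lies below another x in the ideal, the first step of a
    -- chain from q to x already leads to an upper neighbour of q in the ideal.
    isMax-bit : ∀ q → does (isMax? I q) ≡ peakBit up dn y (pos q)
    isMax-bit q = does-⇔ (isMax? I q) to from
      where
      to : IsMax I q → peakBit up dn y (pos q) ≡ true
      to (q∈I , maximal) = peakBit⁺ {up} {dn} {y} (∈⇒y ≡.refl q∈I)
        (λ d yj → let x , z , x≡ , z≡ , z⋖x = dn⇒⋖ {toℕ q} d in
          ⋖⇒≢ z⋖x (≡.trans (pos-injective z≡) (≡.sym (maximal x (y⇒∈ x≡ yj)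
            (subst (_≤ x) (pos-injective z≡) (z⋖x ◅ nil))))))
        (λ u yj → let x , z , x≡ , z≡ , x⋖z = up⇒⋖ {pos q} u in
          ⋖⇒≢ x⋖z (≡.trans (pos-injective x≡) (≡.sym (maximal z (y⇒∈ z≡ yj)
            (subst (_≤ z) (pos-injective x≡) (x⋖z ◅ nil))))))
      from : peakBit up dn y (pos q) ≡ true → IsMax I q
      from e = let yq , below , above = peakBit⁻ {up} {dn} {y} {pos q} e in y⇒∈ ≡.refl yq , λ
        { x x∈I nil → ≡.refl
        ; x x∈I (_◅_ {j = z} q⋖z z≤x) → contradiction (ideal x z z≤x x∈I) λ z∈I → case ⋖⇒edge q⋖z of λ
            { (inj₁ (eq , u)) → above u (∈⇒y eq z∈I)
            ; (inj₂ (eq , d)) → below (subst (λ j → dn j ≡ true) (≡.sym (ℕ.suc-injective eq)) d)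
                (∈⇒y (≡.sym (ℕ.suc-injective eq)) z∈I) } }

    isMin-bit : ∀ q → does (isMinOfComplement? I q) ≡ peakBit dn up (not ∘ y) (pos q)
    isMin-bit q = does-⇔ (isMinOfComplement? I q) to from
      where
      ∉⇒¬y : ∀ {x j} → pos x ≡ j → x ∉ I → not (y j) ≡ true
      ∉⇒¬y x≡ x∉I = not-true (x∉I ∘ y⇒∈ x≡)
      ¬y⇒∉ : ∀ {x j} → pos x ≡ j → not (y j) ≡ true → x ∉ I
      ¬y⇒∉ x≡ ¬yj x∈I = not-true⁻ ¬yj (∈⇒y x≡ x∈I)
      -- A chain exposes its first step, whereas minimality at q concerns the element just below q.
      last-step : ∀ {x z} → x ≤ z → x ≡ z ⊎ ∃[ w ] x ≤ w × w ⋖ z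
      last-step nil = inj₁ ≡.refl
      last-step {x} (x⋖v ◅ v≤z) with last-step v≤z
      ... | inj₁ ≡.refl            = inj₂ (x , nil , x⋖v)
      ... | inj₂ (w , v≤w , w⋖z) = inj₂ (w , x⋖v ◅ v≤w , w⋖z)
      to : IsMinOfComplement I q → peakBit dn up (not ∘ y) (pos q) ≡ true
      to (q∉I , minimal) = peakBit⁺ {dn} {up} {not ∘ y} (∉⇒¬y ≡.refl q∉I)
        (λ u yj → let x , z , x≡ , z≡ , x⋖z = up⇒⋖ {toℕ q} u in
          ⋖⇒≢ x⋖z (≡.trans (minimal x (¬y⇒∉ x≡ yj) (subst (x ≤_) (pos-injective z≡) (x⋖z ◅ nil)))
            (≡.sym (pos-injective z≡))))
        (λ d yj → let x , z , x≡ , z≡ , z⋖x = dn⇒⋖ {pos q} d in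
          ⋖⇒≢ z⋖x (≡.trans (minimal z (¬y⇒∉ z≡ yj) (subst (z ≤_) (pos-injective x≡) (z⋖x ◅ nil)))
            (≡.sym (pos-injective x≡))))
      from : peakBit dn up (not ∘ y) (pos q) ≡ true → IsMinOfComplement I q
      from e = let ¬yq , below , above = peakBit⁻ {dn} {up} {not ∘ y} {pos q} e in ¬y⇒∉ ≡.refl ¬yq , λ x x∉I x≤q →
        case last-step x≤q of λ
          { (inj₁ x≡q) → x≡q
          ; (inj₂ (z , x≤z , z⋖q)) → contradiction (λ z∈I → x∉I (ideal z x x≤z z∈I)) λ z∉I → case ⋖⇒edge z⋖q of λ
            { (inj₁ (eq , u)) → below (subst (λ j → up j ≡ true) (≡.sym (ℕ.suc-injective eq)) u)
                (∉⇒¬y (≡.sym (ℕ.suc-injective eq)) z∉I)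
            ; (inj₂ (eq , d)) → above d (∉⇒¬y eq z∉I) } }

  toIdeal : ∀ y → Valid up dn y → 𝒥
  toIdeal y (up-closed , dn-closed) = I , λ x z z≤x x∈I → lookup⇒∈ (≡.trans (rep z) (closed z≤x (≡.trans (≡.sym (rep x)) (∈⇒lookup x∈I))))
    where
    I = Vec.tabulate (λ x → y (pos x))
    rep : ∀ x → lookup I x ≡ y (pos x)
    rep = lookup∘tabulate (λ x → y (pos x))
    closed : ∀ {z x} → z ≤ x → y (pos x) ≡ true → y (pos z) ≡ true
    closed nil h = h
    closed {z} (z⋖w ◅ w≤x) h with closed w≤x h | ⋖⇒edge z⋖w
    ... | yw | inj₁ (eq , u) = up-closed (pos z) u (subst (λ j → y j ≡ true) eq yw)
    ... | yw | inj₂ (eq , d) = subst (λ j → y j ≡ true) (≡.sym eq) (dn-closed _ d yw)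

  toIdeal-rep : ∀ y valid x → lookup (proj₁ (toIdeal y valid)) x ≡ y (pos x)
  toIdeal-rep y valid = lookup∘tabulate (λ x → y (pos x))

  ↓ : Fin n → 𝒥
  ↓ x = I , λ z w w≤z z∈I → lookup⇒∈ (≡.trans (lookup∘tabulate _ w)
      (dec-true (w ≤? x) (w≤z ◅◅ ∈⇒≤ z∈I)))
    where
    I = Vec.tabulate (λ z → does (z ≤? x))
    ∈⇒≤ : ∀ {z} → z ∈ I → z ≤ x
    ∈⇒≤ {z} z∈I = does⇒ (z ≤? x) (≡.trans (≡.sym (lookup∘tabulate _ z)) (∈⇒lookup z∈I))

  -- The generator is the largest element of its principal ideal. Hence evaluating a combination of
  -- the χ at `↓ x` reads off the coefficient of χ_x.
  isMax-↓ : ∀ x q → does (isMax? (proj₁ (↓ x)) q) ≡ does (q Fin.≟ x)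
  isMax-↓ x q = does-⇔ (isMax? (proj₁ (↓ x)) q)
    (λ (q∈ , maximal) → dec-true (q Fin.≟ x) (≡.sym (maximal x (≤⇒∈ nil) (∈⇒≤ q∈))))
    (λ e → subst (IsMax (proj₁ (↓ x))) (≡.sym (does⇒ (q Fin.≟ x) e))
      (≤⇒∈ nil , λ z z∈ x≤z → antisym (∈⇒≤ z∈) x≤z))
    where
    ∈⇒≤ : ∀ {z} → z ∈ proj₁ (↓ x) → z ≤ x
    ∈⇒≤ {z} z∈I = does⇒ (z ≤? x) (≡.trans (≡.sym (lookup∘tabulate _ z)) (∈⇒lookup z∈I))
    ≤⇒∈ : ∀ {z} → z ≤ x → z ∈ proj₁ (↓ x)
    ≤⇒∈ {z} z≤x = lookup⇒∈ (≡.trans (lookup∘tabulate _ z) (dec-true (z ≤? x) z≤x))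

  -- Locating positions in segments and at shared elements

  segment-of : ∀ m → m ℕ.≤ t → ∀ j → j ℕ.< a m → ∃[ i ] a (toℕ {t} i) ℕ.≤ j × j ℕ.< a (number i)
  segment-of (suc m) m<t j j<a with a m ℕ.≤? j
  ... | yes aₘ≤j = fromℕ< m<t , subst (λ i → a i ℕ.≤ j) (≡.sym eq) aₘ≤j , subst (λ i → j ℕ.< a (suc i)) (≡.sym eq) j<a
    where eq = Fin.toℕ-fromℕ< m<t
  ... | no  aₘ≰j = segment-of m (ℕ.<⇒≤ m<t) j (ℕ.≰⇒> aₘ≰j)

  -- For a boundary number j + 1, this separates the shared elements from the outer end t, to which
  -- the convention for χ applies.
  shared-or-last : ∀ j → j ℕ.≤ suc k → (∃[ i ] toℕ {suc k} i ≡ j) ⊎ j ≡ suc k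
  shared-or-last j j≤ with j ℕ.<? suc k
  ... | yes j< = inj₁ (fromℕ< j< , Fin.toℕ-fromℕ< j<)
  ... | no  j≮ = inj₂ (ℕ.≤-antisym j≤ (ℕ.≮⇒≥ j≮))

  data Location (j : ℕ) : Set where
    within : ∀ i → a (toℕ {t} i) ℕ.< j → j ℕ.< a (number i) → Location j
    at     : ∀ (i : Fin (suc k)) → j ≡ a (suc (toℕ i)) → Location j

  locate : ∀ j → 1 ℕ.≤ j → j ℕ.≤ n → Location j
  locate j 1≤j j≤n with segment-of t ℕ.≤-refl j (subst (j ℕ.<_) (≡.sym aₜ≡1+n) (s≤s j≤n))
  ... | i , aᵢ≤j , j<a with ℕ.m≤n⇒m<n∨m≡n aᵢ≤j
  ...   | inj₁ aᵢ<j = within i aᵢ<j j<a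
  ...   | inj₂ aᵢ≡j with i
  ...     | zero   = contradiction (subst (1 ℕ.≤_) (≡.sym aᵢ≡j) 1≤j) λ ()
  ...     | suc i′ = at i′ (≡.sym aᵢ≡j)

  within⇒unshared : ∀ {x} i → a (toℕ {t} i) ℕ.< pos x → pos x ℕ.< a (number i) → UnsharedSegment i x
  within⇒unshared {x} i lo hi = (ℕ.<⇒≤ lo , ℕ.<⇒≤ hi) , λ (s , x≡s) →
    let x≡a = ≡.trans (cong pos x≡s) (pos-shared s) in case ℕ.<-cmp (toℕ i) (suc (toℕ s)) of λ
      { (tri< i<s _ _) → ℕ.<⇒≱ hi (subst (a (number i) ℕ.≤_) (≡.sym x≡a) (partialSum-mono α i<s))
      ; (tri≈ _ i≡s _) → ℕ.<⇒≢ lo (≡.trans (cong a i≡s) (≡.sym x≡a))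
      ; (tri> _ _ s<i) → ℕ.<⇒≱ lo (subst (ℕ._≤ a (toℕ i)) (≡.sym x≡a) (partialSum-mono α (ℕ.<⇒≤ s<i))) }

  -- An end of a segment is either shared or one of a₀ = 0 and a_t = n + 1, and no element has
  -- position 0 or n + 1.
  unshared⇒within : ∀ {x} i → UnsharedSegment i x → a (toℕ {t} i) ℕ.< pos x × pos x ℕ.< a (number i)
  unshared⇒within {x} i ((lo , hi) , unshared) = ℕ.≤∧≢⇒< lo (start i) , ℕ.≤∧≢⇒< hi end
    where
    start : ∀ i → a (toℕ {t} i) ≢ pos x
    start zero    ()
    start (suc i) eq = unshared (i , pos-injective (≡.trans (≡.sym eq) (≡.sym (pos-shared i))))
    end : pos x ≢ a (number i)
    end eq with number i ℕ.<? t
    ... | yes i<t = start (fromℕ< i<t) (≡.trans (cong a (Fin.toℕ-fromℕ< i<t)) (≡.sym eq))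
    ... | no  i≮t = ℕ.<⇒≱ (s≤s (pos≤n x)) (subst (ℕ._≤ pos x) aₜ≡1+n
                      (subst (a t ℕ.≤_) (≡.sym eq) (partialSum-mono α (ℕ.≮⇒≥ i≮t))))

  within-unique : ∀ {j} i i′ → a (toℕ {t} i) ℕ.< j → j ℕ.< a (number i) → a (toℕ {t} i′) ℕ.< j → j ℕ.< a (number i′) → i ≡ i′
  within-unique i i′ lo hi lo′ hi′ with ℕ.<-cmp (toℕ i) (toℕ i′)
  ... | tri< i<i′ _ _ = contradiction (ℕ.≤-trans (partialSum-mono α i<i′) (ℕ.<⇒≤ lo′)) (ℕ.<⇒≱ hi)
  ... | tri≈ _ i≡i′ _ = Fin.toℕ-injective i≡i′
  ... | tri> _ _ i′<i = contradiction (ℕ.≤-trans (partialSum-mono α i′<i) (ℕ.<⇒≤ lo)) (ℕ.<⇒≱ hi′)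

  -- Positions are written `m + s` rather than `s + m`, so that a step in `m` computes to a
  -- successor.
  module Segment (i : Fin t) where

    N s : ℕ
    N = lookup α i
    s = a (toℕ i)

    N+s≡ : N ℕ.+ s ≡ a (number i)
    N+s≡ = ≡.trans (ℕ.+-comm N s) (≡.sym (a-suc i))

    N+s≤ : N ℕ.+ s ℕ.≤ suc n
    N+s≤ = subst (ℕ._≤ suc n) (≡.sym N+s≡) (segment-end≤ i)

    m+s< : ∀ {m} → m ℕ.< N → m ℕ.+ s ℕ.< a (number i)
    m+s< {m} m<N = subst (m ℕ.+ s ℕ.<_) N+s≡ (ℕ.+-monoˡ-< s m<N)

    ∸s<N : ∀ {j} → s ℕ.< j → j ℕ.< a (number i) → j ℕ.∸ s ℕ.< N
    ∸s<N {j} s<j j<a = ℕ.+-cancelʳ-< s (j ℕ.∸ s) N (subst (ℕ._< N ℕ.+ s) (≡.sym (ℕ.m∸n+n≡m (ℕ.<⇒≤ s<j)))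
      (subst (j ℕ.<_) (≡.sym N+s≡) j<a))

    -- Both bounds leave out the outermost steps of the segment: in the first segment m = 0 starts
    -- at position 0, and in the last one m = N - 1 leads to position n + 1.
    inner : ∀ {m} → 0 ℕ.< m → suc m ℕ.< N → Inner (m ℕ.+ s)
    inner {m} 0<m 1+m<N = ℕ.≤-trans 0<m (ℕ.m≤m+n m s) , ℕ.s<s⁻¹ (ℕ.≤-trans (ℕ.+-monoˡ-≤ s 1+m<N) N+s≤)

    interior : ∀ m → 0 ℕ.< m → m ℕ.< N → ∃[ x ] pos x ≡ m ℕ.+ s × UnsharedSegment i x
    interior m 0<m m<N with element (m ℕ.+ s) (ℕ.≤-trans 0<m (ℕ.m≤m+n m s)) (ℕ.s≤s⁻¹ (ℕ.≤-trans (m+s< m<N) (segment-end≤ i)))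
    ... | x , x≡ = x , x≡ , within⇒unshared i (subst (s ℕ.<_) (≡.sym x≡) (ℕ.+-monoˡ-≤ s 0<m))
                              (subst (ℕ._< a (number i)) (≡.sym x≡) (m+s< m<N))

    ascending : ¬ 2 ∣ number i → ∀ {m} → m ℕ.< N → Ascending (m ℕ.+ s)
    ascending odd {m} m<N = i , odd , ℕ.m≤n+m s m , m+s< m<N

    descending : 2 ∣ number i → ∀ {m} → m ℕ.< N → Descending (m ℕ.+ s)
    descending even {m} m<N = i , even , ℕ.m≤n+m s m , m+s< m<N

  OnSegment : Fin t → ℕ → Set
  OnSegment i j = a (toℕ i) ℕ.≤ j × j ℕ.< a (number i)

  before-shared : ∀ (i : Fin (suc k)) → Inner (pred (a (suc (toℕ i)))) × OnSegment (inject₁ i) (pred (a (suc (toℕ i))))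
  before-shared i = (ℕ.pred-mono-≤ (2≤a (toℕ i)) , ℕ.≤-<-trans ℕ.pred[n]≤n (a<n i)) ,
    subst (λ m → a m ℕ.≤ pred (a (suc (toℕ i))) × pred (a (suc (toℕ i))) ℕ.< a (suc m)) (≡.sym (Fin.toℕ-inject₁ i))
      ( ℕ.<⇒≤pred (partialSum-mono-< α α≥1 ℕ.≤-refl (ℕ.m≤n⇒m≤1+n (Fin.toℕ<n i)))
      , ℕ.≤-reflexive (ℕ.suc-pred (a (suc (toℕ i))) {{ℕ.>-nonZero (ℕ.<⇒≤ (2≤a (toℕ i)))}}))

  after-shared : ∀ (i : Fin (suc k)) → Inner (a (suc (toℕ i))) × OnSegment (suc i) (a (suc (toℕ i)))
  after-shared i = (ℕ.<⇒≤ (2≤a (toℕ i)) , a<n i) ,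
    ℕ.≤-refl , partialSum-mono-< α α≥1 ℕ.≤-refl (s≤s (Fin.toℕ<n i))

  -- A shared element ends the segment of the same number, so its parity decides between peak and
  -- valley.
  peak-at : ∀ (i : Fin (suc k)) → ¬ 2 ∣ suc (toℕ i) →
            up (pred (a (suc (toℕ i)))) ≡ true × dn (a (suc (toℕ i))) ≡ true
  peak-at i odd =
    let inner , on = before-shared i ; inner′ , on′ = after-shared i in
    up⁺ inner (inject₁ i , subst (λ m → ¬ 2 ∣ suc m) (≡.sym (Fin.toℕ-inject₁ i)) odd , on) ,
    dn⁺ inner′ (suc i , odd⇒even-suc odd , on′)

  valley-at : ∀ (i : Fin (suc k)) → 2 ∣ suc (toℕ i) →
              dn (pred (a (suc (toℕ i)))) ≡ true × up (a (suc (toℕ i))) ≡ true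
  valley-at i even =
    let inner , on = before-shared i ; inner′ , on′ = after-shared i in
    dn⁺ inner (inject₁ i , subst (λ m → 2 ∣ suc m) (≡.sym (Fin.toℕ-inject₁ i)) even , on) ,
    up⁺ inner′ (suc i , even⇒odd-suc even , on′)

  -- Sequences extended by virtual end positions

  -- The values at the virtual positions 0 and n + 1 make T a second difference and χ a difference of
  -- bits also at the two ends of the fence.
  bits : Subset n → ℕ → Bool
  bits I zero = true
  bits I (suc j) with j ℕ.<? n
  ... | yes j<n = lookup I (fromℕ< j<n)
  ... | no  _   = does (2 ∣? t)

  bits-rep : ∀ I x → lookup I x ≡ bits I (pos x)
  bits-rep I x with toℕ x ℕ.<? n
  ... | yes x<n = cong (lookup I) (≡.sym (Fin.fromℕ<-toℕ x x<n))
  ... | no  x≮n = contradiction (Fin.toℕ<n x) x≮n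

  bits-end : ∀ I → bits I (suc n) ≡ does (2 ∣? t)
  bits-end I with n ℕ.<? n
  ... | yes n<n = contradiction ≡.refl (ℕ.<⇒≢ n<n)
  ... | no  _   = ≡.refl

  last-segment : ∀ i → n ℕ.< a (number i) → number i ≡ t
  last-segment i n<a with shared-or-last (toℕ i) (ℕ.s≤s⁻¹ (Fin.toℕ<n i))
  ... | inj₁ (s , s≡i) = contradiction (subst (λ j → a (suc j) ℕ.< n) s≡i (a<n s)) (ℕ.<⇒≯ n<a)
  ... | inj₂ i≡        = cong suc i≡

  -- A step to a virtual position is not an edge of the fence, but the bit there makes closure
  -- automatic: position 0 counts as an element below x_1 and carries true, and for odd t position n
  -- + 1 counts as one above x_n and carries false.
  ascending-edge : ∀ I {j} → Ascending j → j ℕ.≤ n →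
                   up j ≡ true ⊎ j ≡ 0 ⊎ j ≡ n × bits I (suc j) ≡ false
  ascending-edge I {j} asc@(i , odd , _ , j<a) j≤n with j ℕ.≟ 0 | ℕ.m≤n⇒m<n∨m≡n j≤n
  ... | yes j≡0 | _        = inj₂ (inj₁ j≡0)
  ... | no  j≢0 | inj₁ j<n = inj₁ (up⁺ (ℕ.n≢0⇒n>0 j≢0 , j<n) asc)
  ... | no  _   | inj₂ ≡.refl = inj₂ (inj₂ (≡.refl , ≡.trans (bits-end I)
        (dec-false (2 ∣? t) (subst (λ m → ¬ 2 ∣ m) (last-segment i j<a) odd))))

  -- Only n + 1 can be exceptional, since the first segment ascends; for even t it counts as lying
  -- below x_n and carries true.
  descending-edge : ∀ I {j} → Descending j → j ℕ.≤ n → dn j ≡ true ⊎ j ≡ n × bits I (suc j) ≡ true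
  descending-edge I {j} desc@(i , even , a≤j , j<a) j≤n with ℕ.m≤n⇒m<n∨m≡n j≤n
  ... | inj₁ j<n    = inj₁ (dn⁺ (ℕ.≤-trans (positive i even) a≤j , j<n) desc)
    where
    positive : ∀ i → 2 ∣ number i → 1 ℕ.≤ a (toℕ {t} i)
    positive zero    2∣1 = contradiction 2∣1 (even⇒odd-suc (2 ∣0))
    positive (suc i) _   = ℕ.<⇒≤ (2≤a (toℕ i))
  ... | inj₂ ≡.refl = inj₂ (≡.refl , ≡.trans (bits-end I)
        (dec-true (2 ∣? t) (subst (2 ∣_) (last-segment i j<a) even)))

  module _ {I : Subset n} (ideal : IsOrderIdeal I) (x : Fin n) where

    private
      p = pos x
      y = bits I
      open Represented ideal {y} (bits-rep I) using (valid; isMax-bit; isMin-bit)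

      one-sidedˡ : ∀ {b u c d e} → d ≡ false → u ∧ c ≡ c → b ∧ not (d ∧ e) ∧ not (u ∧ c) ≡ b ∧ not c
      one-sidedˡ ≡.refl eq rewrite eq = ≡.refl

      one-sidedʳ : ∀ {b u c d e} → d ≡ false → u ∧ c ≡ c → b ∧ not (u ∧ c) ∧ not (d ∧ e) ≡ b ∧ not c
      one-sidedʳ {b} {c = c} ≡.refl eq rewrite eq = cong (b ∧_) (∧-identityʳ (not c))

      no-constraint : ∀ {b c d e f} → c ≡ false → d ≡ false → b ∧ not (c ∧ e) ∧ not (d ∧ f) ≡ b
      no-constraint {b} ≡.refl ≡.refl = ∧-identityʳ b

      not-swap : ∀ b c → not b ∧ not (not c) ≡ c ∧ not b
      not-swap b c = ≡.trans (cong (not b ∧_) (not-involutive c)) (∧-comm (not b) c)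

      -- Either b is an edge of the fence, or c is the bit seen at a virtual position, which is
      -- false by the choice of `bits`. In both cases the edge may be treated as present.
      absorb : ∀ {b c} → b ≡ true ⊎ c ≡ false → b ∧ c ≡ c
      absorb     (inj₁ ≡.refl) = ≡.refl
      absorb {b} (inj₂ ≡.refl) = ∧-zeroʳ b

    module _ (asc⁻ : Ascending (pred p)) (asc : Ascending p) where

      private
        edge : up p ≡ true ⊎ y (suc p) ≡ false
        edge with ascending-edge I asc (pos≤n x)
        ... | inj₁ u                = inj₁ u
        ... | inj₂ (inj₂ (_ , end)) = inj₂ end

        edge⁻ : up (pred p) ≡ true ⊎ y (pred p) ≡ true
        edge⁻ with ascending-edge I asc⁻ (ℕ.<⇒≤ (Fin.toℕ<n x))
        ... | inj₁ u                = inj₁ u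
        ... | inj₂ (inj₁ p≡0)       = inj₂ (cong y p≡0)
        ... | inj₂ (inj₂ (p≡n , _)) = contradiction p≡n (ℕ.<⇒≢ (Fin.toℕ<n x))

      isMax-ascending : does (isMax? I x) ≡ y p ∧ not (y (suc p))
      isMax-ascending = ≡.trans (isMax-bit x) (one-sidedˡ {e = y (pred p)} (ascending⇒¬dn asc⁻) (absorb edge))

      isMin-ascending : does (isMinOfComplement? I x) ≡ y (pred p) ∧ not (y p)
      isMin-ascending = ≡.trans (isMin-bit x) (≡.trans
        (one-sidedʳ {e = not (y (suc p))} (ascending⇒¬dn asc) (absorb (Sum.map₂ (cong not) edge⁻)))
        (not-swap (y p) (y (pred p))))

      bits-ascending : y (suc p) ≡ true → y p ≡ true
      bits-ascending h with edge
      ... | inj₁ u = proj₁ valid p u h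
      ... | inj₂ e = contradiction (≡.trans (≡.sym h) e) λ ()

      bits-ascending⁻ : y p ≡ true → y (pred p) ≡ true
      bits-ascending⁻ h with edge⁻
      ... | inj₁ u = proj₁ valid (pred p) u h
      ... | inj₂ e = e

    module _ (desc⁻ : Descending (pred p)) (desc : Descending p) where

      private
        edge : dn p ≡ true ⊎ y (suc p) ≡ true
        edge with descending-edge I desc (pos≤n x)
        ... | inj₁ d         = inj₁ d
        ... | inj₂ (_ , end) = inj₂ end

        edge⁻ : dn (pred p) ≡ true
        edge⁻ with descending-edge I desc⁻ (ℕ.<⇒≤ (Fin.toℕ<n x))
        ... | inj₁ d         = d
        ... | inj₂ (p≡n , _) = contradiction p≡n (ℕ.<⇒≢ (Fin.toℕ<n x))

      isMax-descending : does (isMax? I x) ≡ y p ∧ not (y (pred p))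
      isMax-descending = ≡.trans (isMax-bit x)
        (one-sidedʳ {e = y (suc p)} (descending⇒¬up desc) (absorb {c = y (pred p)} (inj₁ edge⁻)))

      isMin-descending : does (isMinOfComplement? I x) ≡ y (suc p) ∧ not (y p)
      isMin-descending = ≡.trans (isMin-bit x) (≡.trans
        (one-sidedˡ {e = not (y (pred p))} (descending⇒¬up desc⁻) (absorb (Sum.map₂ (cong not) edge)))
        (not-swap (y p) (y (suc p))))

      bits-descending : y p ≡ true → y (suc p) ≡ true
      bits-descending h with edge
      ... | inj₁ d = proj₂ valid p d h
      ... | inj₂ e = e

      bits-descending⁻ : y (pred p) ≡ true → y p ≡ true
      bits-descending⁻ h = proj₂ valid (pred p) edge⁻ h

    -- Nothing lies above a peak, so membership alone makes it maximal.
    isMax-peak : up (pred p) ≡ true → dn p ≡ true → does (isMax? I x) ≡ y p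
    isMax-peak u d = ≡.trans (isMax-bit x) (no-constraint
      (ascending⇒¬dn (proj₂ (up⁻ {pred p} u))) (descending⇒¬up (proj₂ (dn⁻ {p} d))))

    isMin-valley : dn (pred p) ≡ true → up p ≡ true → does (isMinOfComplement? I x) ≡ not (y p)
    isMin-valley d u = ≡.trans (isMin-bit x) (no-constraint
      (descending⇒¬up (proj₂ (dn⁻ {pred p} d))) (ascending⇒¬dn (proj₂ (up⁻ {p} u))))

  -- Listing and counting the unshared elements

  unsharedElements : List (Fin t × Fin n)
  unsharedElements = filter (uncurry (Fence.unsharedSegment? α α≥1)) (cartesianProduct (allFin t) (allFin n))

  unsharedElements-unique : Unique unsharedElements
  unsharedElements-unique = Unique.filter⁺ (uncurry (Fence.unsharedSegment? α α≥1)) (Unique.cartesianProduct⁺ (Unique.allFin⁺ t) (Unique.allFin⁺ n))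

  ∈-unsharedElements⁺ : ∀ {i x} → UnsharedSegment i x → (i , x) ∈ₗ unsharedElements
  ∈-unsharedElements⁺ {i} {x} = ∈-filter⁺ (uncurry (Fence.unsharedSegment? α α≥1)) (∈-cartesianProduct⁺ (∈-allFin i) (∈-allFin x))

  ∈-unsharedElements⁻ : ∀ {i x} → (i , x) ∈ₗ unsharedElements → UnsharedSegment i x
  ∈-unsharedElements⁻ {i} {x} ix∈ = proj₂ (∈-filter⁻ (uncurry (Fence.unsharedSegment? α α≥1)) {xs = cartesianProduct (allFin t) (allFin n)} ix∈)

  length-segment : ∀ i → length (filter (Fence.unsharedSegment? α α≥1 i) (allFin n)) ≡ lookup α i ℕ.∸ 1
  length-segment i = ≡.trans
    -- `toℕ` is one less than the position, so the open interval of positions becomes a half-open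
    -- interval of indices with upper bound `pred (a (number i))`.
    (length-filter-interval (Fence.unsharedSegment? α α≥1 i) (λ x → x) (a (toℕ i)) (pred (a (number i)))
      (ℕ.pred-mono-≤ (segment-end≤ i))
      (λ x unshared → let lo , hi = unshared⇒within i unshared in ℕ.s≤s⁻¹ lo , ℕ.<⇒≤pred hi)
      (λ x lo hi → within⇒unshared i (s≤s lo) (ℕ.pred-cancel-< hi)))
    (begin
      pred (a (number i)) ℕ.∸ a (toℕ i)                 ≡⟨ ℕ.∸-+-assoc (a (number i)) 1 (a (toℕ i)) ⟩
      a (number i) ℕ.∸ (1 ℕ.+ a (toℕ i))                ≡⟨ cong (a (number i) ℕ.∸_) (ℕ.+-comm 1 (a (toℕ i))) ⟩
      a (number i) ℕ.∸ (a (toℕ i) ℕ.+ 1)                ≡⟨ ℕ.∸-+-assoc (a (number i)) (a (toℕ i)) 1 ⟨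
      a (number i) ℕ.∸ a (toℕ i) ℕ.∸ 1                  ≡⟨ cong (λ m → m ℕ.∸ a (toℕ i) ℕ.∸ 1) (a-suc i) ⟩
      a (toℕ i) ℕ.+ lookup α i ℕ.∸ a (toℕ i) ℕ.∸ 1      ≡⟨ cong (ℕ._∸ 1) (ℕ.m+n∸m≡n (a (toℕ i)) (lookup α i)) ⟩
      lookup α i ℕ.∸ 1                                  ∎)
    where open ≡.≡-Reasoning

  length-segments : ∀ {C : Set} (g : Fin t → Fin n → C) →
    length (concatMap (λ i → List.map (g i) (filter (Fence.unsharedSegment? α α≥1 i) (allFin n))) (allFin t)) ≡
    Vec.sum (Vec.map (ℕ._∸ 1) α)
  length-segments g = begin
    length (concatMap segment (allFin t))             ≡⟨ length-concatMap segment (allFin t) ⟩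
    ℕ-List.sum (List.map (length ∘ segment) (allFin t)) ≡⟨ cong ℕ-List.sum (map-cong
      (λ i → ≡.trans (length-map (g i) (filter (Fence.unsharedSegment? α α≥1 i) (allFin n))) (length-segment i)) (allFin t)) ⟩
    ℕ-List.sum (List.map (λ i → lookup α i ℕ.∸ 1) (allFin t)) ≡⟨ cong ℕ-List.sum
      (map-tabulate (λ i → i) (λ i → lookup α i ℕ.∸ 1)) ⟩
    ℕ-List.sum (tabulate (λ i → lookup α i ℕ.∸ 1))      ≡⟨ sum-tabulate (ℕ._∸ 1) α ⟩
    Vec.sum (Vec.map (ℕ._∸ 1) α)                      ∎
    where
    open ≡.≡-Reasoning
    segment = λ i → List.map (g i) (filter (Fence.unsharedSegment? α α≥1 i) (allFin n))

-- Algebra over a commutative ring with a map from ℚ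

-- The operations of Reals are defined by copatterns on a record with η, so that deciding whether two
-- real expressions are convertible unfolds the Cauchy moduli; over an abstract ring nothing unfolds.
module RationalAlgebra
  (ℝ : Set) (_≈′_ : Rel ℝ 0ℓ) (_+′_ _*′_ : Op₂ ℝ) (-′_ : Op₁ ℝ) (fromℚ : ℚ → ℝ)
  (isCommutativeRing : IsCommutativeRing _≈′_ _+′_ _*′_ -′_ (fromℚ 0ℚ) (fromℚ 1ℚ))
  (+-homo : ∀ p q → fromℚ (p ℚ.+ q) ≈′ (fromℚ p +′ fromℚ q))
  (*-homo : ∀ p q → fromℚ (p ℚ.* q) ≈′ (fromℚ p *′ fromℚ q))
  (-‿homo : ∀ p → fromℚ (ℚ.- p) ≈′ (-′ fromℚ p))
  where

  infix  4 _≈_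
  infixl 6 _+_
  infixl 7 _*_
  infix  8 -_

  _≈_ : Rel ℝ 0ℓ
  _≈_ = _≈′_

  _+_ _*_ : Op₂ ℝ
  _+_ = _+′_
  _*_ = _*′_

  -_ : Op₁ ℝ
  -_ = -′_

  0# 1# : ℝ
  0# = fromℚ 0ℚ
  1# = fromℚ 1ℚ

  fromℕ : ℕ → ℝ
  fromℕ m = fromℚ (+ m ℚ./ 1)

  commutativeRing : CommutativeRing 0ℓ 0ℓ
  commutativeRing = record { _≈_ = _≈_ ; _+_ = _+_ ; _*_ = _*_ ; -_ = -_ ; isCommutativeRing = isCommutativeRing }

  module R = CommutativeRing commutativeRing
  open R using (_-_; refl; sym; trans; reflexive; +-cong; *-cong; -‿cong)
  module ≈-Reasoning = Relation.Binary.Reasoning.Setoid R.setoid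
  open ≈-Reasoning using (begin_; step-≈-⟩; step-≈-⟨; _∎)
  open Algebra.Properties.Semiring.Sum R.semiring
    using (sum; sum-cong-≋; sum-replicate-zero; ∑-distrib-+; *-distribˡ-sum; sum-init-last)
  open Algebra.Properties.Monoid.Mult R.+-monoid using () renaming (_×_ to _·_; ×-congʳ to ·-congʳ)

  -- The solver has to compare coefficients, and equality in the abstract ring offers no decision
  -- procedure; rational coefficients do.
  fromℚ-homomorphism : CommutativeRing.rawRing ℚ.+-*-commutativeRing
                       -Raw-AlmostCommutative⟶ fromCommutativeRing commutativeRing
  fromℚ-homomorphism = record
    { ⟦_⟧    = fromℚ
    ; +-homo = +-homo
    ; *-homo = *-homo
    ; -‿homo = -‿homo
    ; 0-homo = refl
    ; 1-homo = refl
    }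

  coefficient≟ : ∀ p q → Maybe (fromℚ p ≈ fromℚ q)
  coefficient≟ p q = Maybe.map (reflexive ∘ cong fromℚ) (dec⇒maybe (p ℚ.≟ q))

  open Algebra.Solver.Ring (CommutativeRing.rawRing ℚ.+-*-commutativeRing)
    (fromCommutativeRing commutativeRing) fromℚ-homomorphism
    coefficient≟
    using (solve; con; _:=_; _:+_; _:*_; _:-_; :-_)

  -- `+ m / 1` is normalised through a gcd and does not compute for variable `m`, so the equation is
  -- checked on unnormalised fractions.
  fromℕ-suc : ∀ m → fromℕ (suc m) ≈ 1# + fromℕ m
  fromℕ-suc m = trans (reflexive (cong fromℚ (ℚ.toℚᵘ-injective
    (ℚᵘ.≃-trans (ℚ.toℚᵘ-fromℚᵘ (ℚᵘ.mkℚᵘ (+ suc m) 0))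
    (ℚᵘ.≃-sym (ℚᵘ.≃-trans (ℚ.toℚᵘ-homo-+ 1ℚ (+ m ℚ./ 1))
      (ℚᵘ.≃-trans (ℚᵘ.+-congʳ (ℚᵘ.mkℚᵘ (+ 1) 0) (ℚ.toℚᵘ-fromℚᵘ (ℚᵘ.mkℚᵘ (+ m) 0)))
        (ℚᵘ.*≡* (cong (λ x → (+ 1 ℤ.+ x) ℤ.* + 1) (ℤ.*-identityʳ (+ m)))))))))))
    (+-homo 1ℚ (+ m ℚ./ 1))

  fromℕ-* : ∀ m x → fromℕ m * x ≈ m · x
  fromℕ-* zero    x = R.zeroˡ x
  fromℕ-* (suc m) x = begin
    fromℕ (suc m) * x   ≈⟨ R.*-congʳ (fromℕ-suc m) ⟩
    (1# + fromℕ m) * x  ≈⟨ solve 2 (λ m x → (con 1ℚ :+ m) :* x := x :+ m :* x) refl (fromℕ m) x ⟩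
    x + fromℕ m * x     ≈⟨ R.+-congˡ (fromℕ-* m x) ⟩
    x + m · x           ∎

  fromℕ-inverse : ∀ m → 1 ℕ.≤ m → ∃[ v ] fromℕ m * v ≈ 1#
  fromℕ-inverse (suc m) _ = fromℚ (ℚ.1/ q) , trans (sym (*-homo q (ℚ.1/ q))) (reflexive (cong fromℚ (ℚ.*-inverseʳ q)))
    where
    q = + suc m ℚ./ 1
    instance
      _ = ℚ.normalize-pos (suc m) 1
      _ = ℚ.pos⇒nonZero q

  ·-torsionfree : ∀ m {x} → 1 ℕ.≤ m → m · x ≈ 0# → x ≈ 0#
  ·-torsionfree m {x} 1≤m mx≈0 with fromℕ-inverse m 1≤m
  ... | v , mv≈1 = begin
    x                 ≈⟨ R.*-identityˡ x ⟨
    1# * x            ≈⟨ R.*-congʳ mv≈1 ⟨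
    fromℕ m * v * x   ≈⟨ solve 3 (λ m v x → m :* v :* x := v :* (m :* x)) refl (fromℕ m) v x ⟩
    v * (fromℕ m * x) ≈⟨ R.*-congˡ (trans (fromℕ-* m x) mx≈0) ⟩
    v * 0#            ≈⟨ R.zeroʳ v ⟩
    0#                ∎

  sum-zero : ∀ {n} {f : Fin n → ℝ} → (∀ i → f i ≈ 0#) → sum f ≈ 0#
  sum-zero {n} f≈0 = trans (sum-cong-≋ f≈0) (sum-replicate-zero n)

  sum-single : ∀ {n} {f : Fin n → ℝ} i → (∀ j → j ≢ i → f j ≈ 0#) → sum f ≈ f i
  sum-single {f = f} zero    f≈0 = trans (R.+-congˡ (sum-zero λ j → f≈0 (suc j) λ ())) (R.+-identityʳ (f zero))
  sum-single {f = f} (suc i) f≈0 = trans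
    (+-cong (f≈0 zero λ ()) (sum-single i λ j j≢i → f≈0 (suc j) λ { ≡.refl → j≢i ≡.refl }))
    (R.+-identityˡ (f (suc i)))

  sum-+-scaled : ∀ {n} a b (f g : Fin n → ℝ) → sum (λ i → a * f i + b * g i) ≈ a * sum f + b * sum g
  sum-+-scaled a b f g = trans (∑-distrib-+ (λ i → a * f i) (λ i → b * g i))
    (+-cong (sym (*-distribˡ-sum a f)) (sym (*-distribˡ-sum b g)))

  -- Stated for an arbitrary abelian group because it is used in two: the ring itself, for the
  -- coefficients c, and functions modulo the affine span of the T_q, for the sequence y.
  module ArithmeticProgression {c ℓ} (G : AbelianGroup c ℓ) where

    open AbelianGroup G renaming (Carrier to A; _≈_ to _~_; _-_ to _//_)
    open Algebra.Properties.AbelianGroup G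
    open Algebra.Properties.Monoid.Mult monoid using () renaming (_×_ to _⋆_)
    module S = Relation.Binary.Reasoning.Setoid setoid

    module _ (u : ℕ → A) (N : ℕ)
      (harmonic : ∀ j → suc j ℕ.< N → u j ∙ u (suc (suc j)) ~ u (suc j) ∙ u (suc j)) where

      difference : ∀ j → j ℕ.< N → u (suc j) ~ (u 1 // u 0) ∙ u j
      difference zero    _     = AbelianGroup.sym G (//-rightDividesˡ (u 0) (u 1))
      difference (suc j) 1+j<N = ∙-cancelˡ (u j) _ _ (S.begin
        u j ∙ u (suc (suc j))       S.≈⟨ harmonic j 1+j<N ⟩
        u (suc j) ∙ u (suc j)       S.≈⟨ ∙-congʳ (difference j (ℕ.<-trans (ℕ.n<1+n j) 1+j<N)) ⟩
        δ ∙ u j ∙ u (suc j)         S.≈⟨ ∙-congʳ (comm δ (u j)) ⟩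
        u j ∙ δ ∙ u (suc j)         S.≈⟨ assoc (u j) δ (u (suc j)) ⟩
        u j ∙ (δ ∙ u (suc j))       S.∎)
        where δ = u 1 // u 0

      progression : ∀ j → j ℕ.≤ N → u j ~ (j ⋆ (u 1 // u 0)) ∙ u 0
      progression zero    _   = AbelianGroup.sym G (identityˡ (u 0))
      progression (suc j) j<N = S.begin
        u (suc j)               S.≈⟨ difference j j<N ⟩
        δ ∙ u j                 S.≈⟨ ∙-congˡ (progression j (ℕ.<⇒≤ j<N)) ⟩
        δ ∙ (j ⋆ δ ∙ u 0)       S.≈⟨ assoc δ (j ⋆ δ) (u 0) ⟨
        δ ∙ (j ⋆ δ) ∙ u 0       S.∎
        where δ = u 1 // u 0

  -- A progression that is zero at both ends has N times its step equal to zero, hence step zero.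
  harmonic-vanish : (u : ℕ → ℝ) (N : ℕ) → u 0 ≈ 0# → u N ≈ 0# →
    (∀ j → suc j ℕ.< N → u j + u (suc (suc j)) ≈ u (suc j) + u (suc j)) → ∀ j → j ℕ.≤ N → u j ≈ 0#
  harmonic-vanish u zero    u0 uN h .0 z≤n = u0
  harmonic-vanish u N@(suc _) u0 uN h j j≤N = begin
    u j             ≈⟨ progression u N h j j≤N ⟩
    j · δ + u 0     ≈⟨ +-cong (·-congʳ j δ≈0) u0 ⟩
    j · 0# + 0#     ≈⟨ +-cong (trans (sym (fromℕ-* j 0#)) (R.zeroʳ _)) refl ⟩
    0# + 0#         ≈⟨ R.+-identityˡ 0# ⟩
    0#              ∎
    where
    open ArithmeticProgression R.+-abelianGroup
    δ = u 1 - u 0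
    δ≈0 : δ ≈ 0#
    δ≈0 = ·-torsionfree N (s≤s z≤n) (begin
      N · δ         ≈⟨ R.+-identityʳ _ ⟨
      N · δ + 0#    ≈⟨ R.+-congˡ u0 ⟨
      N · δ + u 0   ≈⟨ progression u N h N ℕ.≤-refl ⟨
      u N           ≈⟨ uN ⟩
      0#            ∎)

  -- Subspaces of functions and a criterion for bases

  module FunctionSpace (X : Set) where

    infix 4 _≐_
    _≐_ : (f g : X → ℝ) → Set
    f ≐ g = ∀ I → f I ≈ g I

    combination : ∀ {m} → (Fin m → ℝ) → (Fin m → X → ℝ) → X → ℝ
    combination c v I = sum (λ i → c i * v i I)

    Span : ∀ {m} → (Fin m → X → ℝ) → Pred (X → ℝ) 0ℓ
    Span v f = ∃[ c ] f ≐ combination c v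

    LinearlyIndependent : ∀ {m} → (Fin m → X → ℝ) → Set
    LinearlyIndependent v = ∀ c → combination c v ≐ (λ _ → 0#) → ∀ i → c i ≈ 0#

    AffineSpan : ∀ {m} → (Fin m → X → ℝ) → Pred (X → ℝ) 0ℓ
    AffineSpan v f = Σ ℝ λ c → Σ (Fin _ → ℝ) λ c′ → ∀ I → f I ≈ c + combination c′ v I

    IsBasis : Pred (X → ℝ) 0ℓ → List (X → ℝ) → Set
    IsBasis V bs =
      All V bs ×
      LinearlyIndependent (List.lookup bs) ×
      (∀ f → V f → Span (List.lookup bs) f)

    record IsSubspace (V : Pred (X → ℝ) 0ℓ) : Set where
      field
        resp : ∀ {f g} → f ≐ g → V f → V g
        lin  : ∀ a b {f g} → V f → V g → V (λ I → a * f I + b * g I)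
        null : V (λ _ → 0#)

      add : ∀ {f g} → V f → V g → V (λ I → f I + g I)
      add {f} {g} Vf Vg = resp (λ I → +-cong (R.*-identityˡ (f I)) (R.*-identityˡ (g I))) (lin 1# 1# Vf Vg)

      scale : ∀ a {f} → V f → V (λ I → a * f I)
      scale a {f} Vf = resp (λ I → solve 2 (λ a f → a :* f :+ con 0ℚ :* f := a :* f) refl a (f I)) (lin a 0# Vf Vf)

      subtract : ∀ {f g} → V f → V g → V (λ I → f I - g I)
      subtract {f} {g} Vf Vg = resp
        (λ I → solve 2 (λ f g → con 1ℚ :* f :+ :- con 1ℚ :* g := f :- g) refl (f I) (g I)) (lin 1# (- 1#) Vf Vg)

      combination-closed : ∀ {m} (c : Fin m → ℝ) (v : Fin m → X → ℝ) → (∀ i → V (v i)) → V (combination c v)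
      combination-closed {zero}  c v Vv = null
      combination-closed {suc m} c v Vv = add (scale (c zero) (Vv zero))
        (combination-closed (c ∘ suc) (v ∘ suc) (Vv ∘ suc))

      -- Functions modulo V: a congruence modulo the T_q becomes an equality in a group, to which
      -- `ArithmeticProgression` applies.
      quotient : AbelianGroup 0ℓ 0ℓ
      quotient = record
        { Carrier = X → ℝ
        ; _≈_ = λ f g → V (λ I → f I - g I)
        ; _∙_ = λ f g I → f I + g I
        ; ε = λ _ → 0#
        ; _⁻¹ = λ f I → - f I
        ; isAbelianGroup = record
          { isGroup = record
            { isMonoid = record
              { isSemigroup = record
                { isMagma = record
                  { isEquivalence = record
                    { refl  = ≐⇒V (λ I → refl)
                    ; sym   = λ {f} {g} p → resp
                        (λ I → solve 2 (λ f g → :- con 1ℚ :* (f :- g) := g :- f) refl (f I) (g I)) (scale (- 1#) p)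
                    ; trans = λ {f} {g} {h} p q → resp
                        (λ I → solve 3 (λ f g h → (f :- g) :+ (g :- h) := f :- h) refl (f I) (g I) (h I)) (add p q)
                    }
                  ; ∙-cong = λ {f} {f′} {g} {g′} p q → resp
                      (λ I → solve 4 (λ f f′ g g′ → (f :- f′) :+ (g :- g′) := (f :+ g) :- (f′ :+ g′)) refl
                        (f I) (f′ I) (g I) (g′ I)) (add p q)
                  }
                ; assoc = λ f g h → ≐⇒V (λ I → R.+-assoc (f I) (g I) (h I))
                }
              ; identity = (λ f → ≐⇒V (λ I → R.+-identityˡ (f I))) , (λ f → ≐⇒V (λ I → R.+-identityʳ (f I)))
              }
            ; inverse = (λ f → ≐⇒V (λ I → R.-‿inverseˡ (f I))) , (λ f → ≐⇒V (λ I → R.-‿inverseʳ (f I)))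
            ; ⁻¹-cong = λ {f} {g} p → resp
                (λ I → solve 2 (λ f g → :- con 1ℚ :* (f :- g) := :- f :- :- g) refl (f I) (g I)) (scale (- 1#) p)
            }
          ; comm = λ f g → ≐⇒V (λ I → R.+-comm (f I) (g I))
          }
        }
        where
        ≐⇒V : ∀ {f g} → f ≐ g → V (λ I → f I - g I)
        ≐⇒V {f} {g} f≐g = resp (λ I → sym (trans (R.+-congʳ (f≐g I)) (R.-‿inverseʳ (g I)))) null

    Span-isSubspace : ∀ {m} (v : Fin m → X → ℝ) → IsSubspace (Span v)
    Span-isSubspace v = record
      { resp = λ f≐g (c , f≐) → c , λ I → trans (sym (f≐g I)) (f≐ I)
      ; lin  = λ a b {f} {g} (c , f≐) (d , g≐) → (λ i → a * c i + b * d i) , λ I → begin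
          a * f I + b * g I                                 ≈⟨ +-cong (R.*-congˡ (f≐ I)) (R.*-congˡ (g≐ I)) ⟩
          a * combination c v I + b * combination d v I     ≈⟨ sum-+-scaled a b (λ i → c i * v i I) (λ i → d i * v i I) ⟨
          sum (λ i → a * (c i * v i I) + b * (d i * v i I)) ≈⟨ sum-cong-≋ (λ i →
            solve 5 (λ a b c d v → a :* (c :* v) :+ b :* (d :* v) := (a :* c :+ b :* d) :* v) refl
              a b (c i) (d i) (v i I)) ⟩
          combination (λ i → a * c i + b * d i) v I         ∎
      ; null = (λ _ → 0#) , λ I → sym (sum-zero λ i → R.zeroˡ (v i I))
      }

    δ : ∀ {m} → Fin m → Fin m → ℝ
    δ zero    zero    = 1#
    δ zero    (suc j) = 0#
    δ (suc i) zero    = 0#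
    δ (suc i) (suc j) = δ i j

    δ-diagonal : ∀ {m} (i : Fin m) → δ i i ≈ 1#
    δ-diagonal zero    = refl
    δ-diagonal (suc i) = δ-diagonal i

    δ-off-diagonal : ∀ {m} (i j : Fin m) → j ≢ i → δ i j ≈ 0#
    δ-off-diagonal zero    zero    j≢i = contradiction ≡.refl j≢i
    δ-off-diagonal zero    (suc j) _   = refl
    δ-off-diagonal (suc i) zero    _   = refl
    δ-off-diagonal (suc i) (suc j) j≢i = δ-off-diagonal i j (j≢i ∘ cong suc)

    combination-δ : ∀ {m} (v : Fin m → X → ℝ) i → v i ≐ combination (δ i) v
    combination-δ v i I = sym (begin
      combination (δ i) v I ≈⟨ sum-single i (λ j j≢i → trans (R.*-congʳ (δ-off-diagonal i j j≢i)) (R.zeroˡ (v j I))) ⟩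
      δ i i * v i I         ≈⟨ R.*-congʳ (δ-diagonal i) ⟩
      1# * v i I            ≈⟨ R.*-identityˡ (v i I) ⟩
      v i I                 ∎)

    member-Span : ∀ {m} (v : Fin m → X → ℝ) i → Span v (v i)
    member-Span v i = δ i , combination-δ v i

    AffineSpan-isSubspace : ∀ {m} (v : Fin m → X → ℝ) → IsSubspace (AffineSpan v)
    AffineSpan-isSubspace {m} v = record
      { resp = λ f≐g (c , c′ , f≈) → c , c′ , λ I → trans (sym (f≐g I)) (f≈ I)
      ; lin  = λ a b {f} {g} (c , c′ , f≈) (d , d′ , g≈) →
          a * c + b * d , (λ q → a * c′ q + b * d′ q) , λ I → begin
          a * f I + b * g I
            ≈⟨ +-cong (R.*-congˡ (f≈ I)) (R.*-congˡ (g≈ I)) ⟩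
          a * (c + combination c′ v I) + b * (d + combination d′ v I)
            ≈⟨ solve 6 (λ a b c d s s′ → a :* (c :+ s) :+ b :* (d :+ s′) := a :* c :+ b :* d :+ (a :* s :+ b :* s′)) refl
                 a b c d (combination c′ v I) (combination d′ v I) ⟩
          a * c + b * d + (a * combination c′ v I + b * combination d′ v I)
            ≈⟨ R.+-congˡ (sum-+-scaled a b (λ q → c′ q * v q I) (λ q → d′ q * v q I)) ⟨
          a * c + b * d + sum (λ q → a * (c′ q * v q I) + b * (d′ q * v q I))
            ≈⟨ R.+-congˡ (sum-cong-≋ {m} (λ q → solve 5 (λ a b c d v →
                 a :* (c :* v) :+ b :* (d :* v) := (a :* c :+ b :* d) :* v) refl a b (c′ q) (d′ q) (v q I))) ⟩
          a * c + b * d + combination (λ q → a * c′ q + b * d′ q) v I ∎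
      ; null = 0# , (λ _ → 0#) , λ I → sym (trans (R.+-congˡ (sum-zero {m} (λ q → R.zeroˡ (v q I)))) (R.+-identityˡ 0#))
      }

    constant-AffineSpan : ∀ {m} (v : Fin m → X → ℝ) c → AffineSpan v (λ _ → c)
    constant-AffineSpan {m} v c = c , (λ _ → 0#) , λ I →
      sym (trans (R.+-congˡ (sum-zero {m} (λ q → R.zeroˡ (v q I)))) (R.+-identityʳ c))

    member-AffineSpan : ∀ {m} (v : Fin m → X → ℝ) i → AffineSpan v (v i)
    member-AffineSpan v i = 0# , δ i , λ I → trans (combination-δ v i I) (sym (R.+-identityˡ _))

    ∩-isSubspace : ∀ {V W} → IsSubspace V → IsSubspace W → IsSubspace (V ∩ W)
    ∩-isSubspace SV SW = record
      { resp = λ f≐g (Vf , Wf) → V.resp f≐g Vf , W.resp f≐g Wf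
      ; lin  = λ a b (Vf , Wf) (Vg , Wg) → V.lin a b Vf Vg , W.lin a b Wf Wg
      ; null = V.null , W.null
      }
      where
      module V = IsSubspace SV
      module W = IsSubspace SW

    module _ {K : Set} (g : K → X → ℝ) (point : K → X) (u v : K → ℝ) (uv≈1 : ∀ k → u k * v k ≈ 1#) where

      private
        index : (ks : List K) → Fin (List.length (List.map g ks)) → K
        index (k ∷ ks) zero    = k
        index (k ∷ ks) (suc i) = index ks i

        index∈ : ∀ ks i → index ks i ∈ₗ ks
        index∈ (k ∷ ks) zero    = here ≡.refl
        index∈ (k ∷ ks) (suc i) = there (index∈ ks i)

        index-surjective : ∀ {k ks} → k ∈ₗ ks → ∃[ i ] index ks i ≡ k
        index-surjective (here ≡.refl) = zero , ≡.refl
        index-surjective (there k∈ks)  = let i , eq = index-surjective k∈ks in suc i , eq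

        lookup-index : ∀ ks i → List.lookup (List.map g ks) i ≡ g (index ks i)
        lookup-index (k ∷ ks) zero    = ≡.refl
        lookup-index (k ∷ ks) (suc i) = lookup-index ks i

        index-injective : ∀ {ks} → Unique ks → ∀ i j → index ks i ≡ index ks j → i ≡ j
        index-injective                (_ ∷ _)       zero    zero    _  = ≡.refl
        index-injective {k ∷ ks} (k∉ ∷ _)      zero    (suc j) eq = contradiction eq (All.lookup k∉ (index∈ ks j))
        index-injective {k ∷ ks} (k∉ ∷ _)      (suc i) zero    eq = contradiction (≡.sym eq) (All.lookup k∉ (index∈ ks i))
        index-injective                (_ ∷ unique)  (suc i) (suc j) eq = cong suc (index-injective unique i j eq)

      -- The matrix of values of the `g k` at the points is diagonal with invertible entries. This
      -- gives independence. For spanning, f minus its interpolating combination lies in V and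
      -- vanishes at all points, so it is zero by `determined`.
      biorthogonal⇒basis : ∀ {V} → IsSubspace V → ∀ ks → Unique ks →
        (∀ k → k ∈ₗ ks → V (g k)) →
        (∀ k → k ∈ₗ ks → g k (point k) ≈ u k) →
        (∀ k k′ → k ∈ₗ ks → k′ ∈ₗ ks → k′ ≢ k → g k′ (point k) ≈ 0#) →
        (∀ h → V h → (∀ k → k ∈ₗ ks → h (point k) ≈ 0#) → h ≐ λ _ → 0#) →
        IsBasis V (List.map g ks)
      biorthogonal⇒basis {V} SV ks unique Vg diagonal off-diagonal determined =
        All.map⁺ (All.tabulate λ {k} → Vg k) , independent , spanning
        where
        open IsSubspace SV
        basis = List.lookup (List.map g ks)
        pt : Fin (List.length (List.map g ks)) → X
        pt i = point (index ks i)

        evaluate : ∀ c i → combination c basis (pt i) ≈ c i * u (index ks i)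
        evaluate c i = begin
          combination c basis (pt i)      ≈⟨ sum-single i (λ j j≢i → trans (R.*-congˡ
            (trans (reflexive (cong (λ f → f (pt i)) (lookup-index ks j)))
              (off-diagonal _ _ (index∈ ks i) (index∈ ks j) (j≢i ∘ index-injective unique j i))))
            (R.zeroʳ (c j))) ⟩
          c i * basis i (pt i)            ≈⟨ R.*-congˡ (trans (reflexive (cong (λ f → f (pt i)) (lookup-index ks i)))
                                               (diagonal _ (index∈ ks i))) ⟩
          c i * u (index ks i)            ∎

        independent : LinearlyIndependent basis
        independent c c≐0 i = begin
          c i                ≈⟨ R.*-identityʳ (c i) ⟨
          c i * 1#           ≈⟨ R.*-congˡ (uv≈1 _) ⟨
          c i * (u _ * v _)  ≈⟨ R.*-assoc (c i) _ _ ⟨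
          c i * u _ * v _    ≈⟨ R.*-congʳ (trans (sym (evaluate c i)) (c≐0 (pt i))) ⟩
          0# * v _           ≈⟨ R.zeroˡ _ ⟩
          0#                 ∎

        spanning : ∀ f → V f → Span basis f
        spanning f Vf = c , λ I → begin
          f I                                  ≈⟨ solve 2 (λ x y → x := (x :- y) :+ y) refl (f I) (combination c basis I) ⟩
          (f I - combination c basis I) + combination c basis I  ≈⟨ R.+-congʳ (f-g≐0 I) ⟩
          0# + combination c basis I           ≈⟨ R.+-identityˡ _ ⟩
          combination c basis I                ∎
          where
          c : Fin (List.length (List.map g ks)) → ℝ
          -- The interpolation coefficient: the value of f at the point, divided by the diagonal
          -- entry.
          c i = v (index ks i) * f (pt i)

          Vbasis : ∀ i → V (basis i)
          Vbasis i = subst V (≡.sym (lookup-index ks i)) (Vg _ (index∈ ks i))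

          vanish : ∀ i → f (pt i) - combination c basis (pt i) ≈ 0#
          vanish i = begin
            f (pt i) - combination c basis (pt i)     ≈⟨ R.+-congˡ (-‿cong (evaluate c i)) ⟩
            f (pt i) - v _ * f (pt i) * u _           ≈⟨ solve 3 (λ f u v → f :- v :* f :* u := f :- (u :* v) :* f) refl _ _ _ ⟩
            f (pt i) - (u _ * v _) * f (pt i)         ≈⟨ R.+-congˡ (-‿cong (R.*-congʳ (uv≈1 (index ks i)))) ⟩
            f (pt i) - 1# * f (pt i)                  ≈⟨ solve 1 (λ f → f :- con 1ℚ :* f := con 0ℚ) refl _ ⟩
            0#                                        ∎

          f-g≐0 : (λ I → f I - combination c basis I) ≐ λ _ → 0#
          f-g≐0 = determined _ (subtract Vf (combination-closed c basis Vbasis)) λ k k∈ks →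
            let i , eq = index-surjective k∈ks in
            subst (λ k → f (point k) - combination c basis (point k) ≈ 0#) eq (vanish i)

  -- Combinations of χ and τ that are constant on all ideals

  ⟦_⟧ : Bool → ℝ
  ⟦ b ⟧ = if b then 1# else 0#

  term : (up dn : ℕ → Bool) (A B : ℕ → ℝ) (y : ℕ → Bool) → ℕ → ℝ
  term up dn A B y j = A j * ⟦ peakBit up dn y j ⟧ + B j * ⟦ peakBit dn up (not ∘ y) j ⟧

  term-local : ∀ up dn A B y y′ j → y (pred j) ≡ y′ (pred j) → y j ≡ y′ j → y (suc j) ≡ y′ (suc j) →
               term up dn A B y j ≡ term up dn A B y′ j
  term-local up dn A B y y′ j eq₁ eq₂ eq₃ rewrite eq₁ | eq₂ | eq₃ = ≡.refl

  sum-window₀ : ∀ p m (F : ℕ → ℝ) → 2 ℕ.+ p ℕ.< m → (∀ j → j ℕ.< p → F j ≈ 0#) → (∀ j → 2 ℕ.+ p ℕ.< j → F j ≈ 0#) →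
    sum {m} (λ x → F (toℕ x)) ≈ F p + F (1 ℕ.+ p) + F (2 ℕ.+ p)
  sum-window₀ zero (suc (suc (suc m))) F _ _ F≈0 = begin
    F 0 + (F 1 + (F 2 + sum {m} (λ x → F (3 ℕ.+ toℕ x))))  ≈⟨ R.+-congˡ (R.+-congˡ (R.+-congˡ
        (sum-zero {m} λ x → F≈0 _ (s≤s (s≤s (s≤s z≤n)))))) ⟩
    F 0 + (F 1 + (F 2 + 0#))
      ≈⟨ solve 3 (λ a b c → a :+ (b :+ (c :+ con 0ℚ)) := a :+ b :+ c) refl (F 0) (F 1) (F 2) ⟩
    F 0 + F 1 + F 2                                        ∎
  sum-window₀ zero (suc zero) F (s≤s ()) _ _
  sum-window₀ zero (suc (suc zero)) F (s≤s (s≤s ())) _ _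
  sum-window₀ (suc p) (suc m) F (s≤s p<m) F<≈0 F>≈0 = begin
    F 0 + sum {m} (λ x → F (suc (toℕ x)))    ≈⟨ +-cong (F<≈0 0 (s≤s z≤n)) (sum-window₀ p m (F ∘ suc) p<m
                                                (λ j j<p → F<≈0 (suc j) (s≤s j<p)) (λ j p<j → F>≈0 (suc j) (s≤s p<j))) ⟩
    0# + (F (1 ℕ.+ p) + F (2 ℕ.+ p) + F (3 ℕ.+ p))   ≈⟨ R.+-identityˡ _ ⟩
    F (1 ℕ.+ p) + F (2 ℕ.+ p) + F (3 ℕ.+ p)  ∎

  -- The zeros at 0 and n + 1 let the window of three positions reach beyond either end of the
  -- fence, so toggling x_1 or x_n is no special case.
  sum-window : ∀ n p (F : ℕ → ℝ) → p ℕ.< n → F 0 ≈ 0# → F (suc n) ≈ 0# →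
    (∀ j → j ℕ.< p → F j ≈ 0#) → (∀ j → 2 ℕ.+ p ℕ.< j → F j ≈ 0#) →
    sum {n} (λ x → F (suc (toℕ x))) ≈ F p + F (1 ℕ.+ p) + F (2 ℕ.+ p)
  sum-window n p F p<n F0≈0 Fn≈0 F<≈0 F>≈0 = begin
    sum {n} (λ x → F (suc (toℕ x)))                     ≈⟨ sum-cong-≋ {n} (λ x →
        reflexive (cong (F ∘ suc) (≡.sym (Fin.toℕ-inject₁ x)))) ⟩
    sum {n} (λ x → F (suc (toℕ (inject₁ x))))           ≈⟨ R.+-identityʳ _ ⟨
    sum {n} (λ x → F (suc (toℕ (inject₁ x)))) + 0#      ≈⟨ R.+-congˡ (trans
        (reflexive (cong (F ∘ suc) (Fin.toℕ-fromℕ n))) Fn≈0) ⟨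
    sum {n} (λ x → F (suc (toℕ (inject₁ x)))) + F (suc (toℕ (Fin.fromℕ n)))
                                                        ≈⟨ sum-init-last {n} (λ x → F (suc (toℕ x))) ⟨
    sum {suc n} (λ x → F (suc (toℕ x)))                 ≈⟨ R.+-identityˡ _ ⟨
    0# + sum {suc n} (λ x → F (suc (toℕ x)))            ≈⟨ R.+-congʳ F0≈0 ⟨
    sum {2 ℕ.+ n} (λ x → F (toℕ x))                     ≈⟨ sum-window₀ p (2 ℕ.+ n) F (s≤s (s≤s p<n)) F<≈0 F>≈0 ⟩
    F p + F (1 ℕ.+ p) + F (2 ℕ.+ p)                     ∎

  -- Only the edges of the fence are retained, which makes the notion invariant under reversing the
  -- order.
  record Balanced (n : ℕ) (up dn : ℕ → Bool) (A B : ℕ → ℝ) : Set where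
    field
      exclusive : ∀ j → up j ≡ true → dn j ≡ true → ⊥
      A₀≈0      : A 0 ≈ 0#
      B₀≈0      : B 0 ≈ 0#
      Aₙ≈0      : A (suc n) ≈ 0#
      Bₙ≈0      : B (suc n) ≈ 0#
      value     : ℝ
      balance   : ∀ y → Valid up dn y → sum {n} (λ x → term up dn A B y (suc (toℕ x))) ≈ value

    up⇒¬dn : ∀ {j} → up j ≡ true → dn j ≡ false
    up⇒¬dn {j} u with dn j in eq
    ... | false = ≡.refl
    ... | true  = ⊥-elim (exclusive j u eq)

    dn⇒¬up : ∀ {j} → dn j ≡ true → up j ≡ false
    dn⇒¬up {j} d with up j in eq
    ... | false = ≡.refl
    ... | true  = ⊥-elim (exclusive j eq d)

    term-outside : ∀ y j → A j ≈ 0# → B j ≈ 0# → term up dn A B y j ≈ 0#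
    term-outside y j A≈0 B≈0 = begin
      A j * _ + B j * _   ≈⟨ +-cong (R.*-congʳ A≈0) (R.*-congʳ B≈0) ⟩
      0# * _ + 0# * _     ≈⟨ solve 2 (λ x y → con 0ℚ :* x :+ con 0ℚ :* y := con 0ℚ) refl _ _ ⟩
      0#                  ∎

    difference-vanish : ∀ y y′ → Valid up dn y → Valid up dn y′ →
      sum {n} (λ x → term up dn A B y (suc (toℕ x)) - term up dn A B y′ (suc (toℕ x))) ≈ 0#
    difference-vanish y y′ valid valid′ = begin
      sum {n} (λ x → f x - g x)              ≈⟨ sum-cong-≋ {n} (λ x →
        solve 2 (λ f g → f :- g := con 1ℚ :* f :+ :- con 1ℚ :* g) refl (f x) (g x)) ⟩
      sum {n} (λ x → 1# * f x + - 1# * g x)  ≈⟨ sum-+-scaled 1# (- 1#) f g ⟩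
      1# * sum f + - 1# * sum g              ≈⟨ +-cong (R.*-congˡ (balance y valid)) (R.*-congˡ (balance y′ valid′)) ⟩
      1# * value + - 1# * value              ≈⟨ solve 1 (λ v → con 1ℚ :* v :+ :- con 1ℚ :* v := con 0ℚ) refl value ⟩
      0#                                     ∎
      where
      f g : Fin n → ℝ
      f x = term up dn A B y (suc (toℕ x))
      g x = term up dn A B y′ (suc (toℕ x))

  -- The τ of an order is the χ of its opposite evaluated at the complement, so the two coefficient
  -- families exchange places.
  dual : ∀ {n up dn A B} → Balanced n up dn A B → Balanced n dn up B A
  dual {n} {up} {dn} {A} {B} bal = record
    { exclusive = λ j d u → exclusive j u d
    ; A₀≈0 = B₀≈0 ; B₀≈0 = A₀≈0 ; Aₙ≈0 = Bₙ≈0 ; Bₙ≈0 = Aₙ≈0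
    ; value = value
    ; balance = λ y valid → trans (sum-cong-≋ {n} (λ x → dual-term y (suc (toℕ x)))) (balance (not ∘ y) (complement-valid valid))
    }
    where
    open Balanced bal
    dual-term : ∀ y j → term dn up B A y j ≈ term up dn A B (not ∘ y) j
    dual-term y j = trans (R.+-comm _ _) (R.+-congˡ (reflexive (cong (λ b → B j * ⟦ b ⟧)
      (peakBit-local dn up y (not ∘ not ∘ y) j (≡.sym (not-involutive _)) (≡.sym (not-involutive _)) (≡.sym (not-involutive _))))))

  module _ {n up dn A B} (bal : Balanced n up dn A B) where

    open Balanced bal

    private
      tm = term up dn A B

      -- Only the positions p, p + 1 and p + 2 see the difference between two sequences that agree off p + 1.
      toggle : ∀ p {l r} → p ℕ.< n →
        Valid up dn (split (suc p) l true r) → Valid up dn (split (suc p) l false r) →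
        let G = λ j → tm (split (suc p) l true r) j - tm (split (suc p) l false r) j in
        G p + G (1 ℕ.+ p) + G (2 ℕ.+ p) ≈ 0#
      toggle p {l} {r} p<n valid₁ valid₀ = trans
        (sym (sum-window n p (λ j → tm y₁ j - tm y₀ j) p<n
          (outside 0 A₀≈0 B₀≈0) (outside (suc n) Aₙ≈0 Bₙ≈0)
          (λ j j<p → same j (agree-< (ℕ.≤-<-trans (ℕ.pred[n]≤n {j}) (ℕ.m<n⇒m<1+n j<p)))
            (agree-< (ℕ.m<n⇒m<1+n j<p)) (agree-< (s≤s j<p)))
          (λ j p<j → same j (agree-> (ℕ.<⇒≤pred p<j)) (agree-> (ℕ.<⇒≤ p<j)) (agree-> (ℕ.m<n⇒m<1+n (ℕ.<⇒≤ p<j))))))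
        (difference-vanish y₁ y₀ valid₁ valid₀)
        where
        y₁ = split (suc p) l true r
        y₀ = split (suc p) l false r
        agree-< : ∀ {j} → j ℕ.< suc p → y₁ j ≡ y₀ j
        agree-< j< = ≡.trans (split-< (suc p) j<) (≡.sym (split-< (suc p) j<))
        agree-> : ∀ {j} → suc p ℕ.< j → y₁ j ≡ y₀ j
        agree-> j> = ≡.trans (split-> (suc p) j>) (≡.sym (split-> (suc p) j>))
        same : ∀ j → y₁ (pred j) ≡ y₀ (pred j) → y₁ j ≡ y₀ j → y₁ (suc j) ≡ y₀ (suc j) → tm y₁ j - tm y₀ j ≈ 0#
        same j e₁ e₂ e₃ = trans (R.+-congʳ (reflexive (term-local up dn A B y₁ y₀ j e₁ e₂ e₃))) (R.-‿inverseʳ _)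
        outside : ∀ j → A j ≈ 0# → B j ≈ 0# → tm y₁ j - tm y₀ j ≈ 0#
        outside j A≈0 B≈0 = trans (+-cong (term-outside y₁ j A≈0 B≈0) (-‿cong (term-outside y₀ j A≈0 B≈0)))
          (R.-‿inverseʳ 0#)

    -- While the peak is left out of the ideal, the constant values l and r on its two sides are
    -- free. Every other position sees at most one of them and is killed by the mixed difference; at
    -- the peak itself χ is zero and τ is the indicator of l ∧ r.
    peak-vanish : ∀ p → p ℕ.< n → up p ≡ true → dn (suc p) ≡ true → B (suc p) ≈ 0#
    peak-vanish p p<n up-p dn-p = begin
      B (suc p)                                  ≈⟨ solve 1 (λ b → b := con 0ℚ :+ b :+ con 0ℚ) refl _ ⟩
      0# + B (suc p) + 0#                        ≈⟨ +-cong (+-cong (left p ℕ.≤-refl) center) (right (2 ℕ.+ p) ℕ.≤-refl) ⟨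
      G p + G (1 ℕ.+ p) + G (2 ℕ.+ p)            ≈⟨ sum-window n p G p<n
                                                     (left 0 (s≤s z≤n)) (right (suc n) (s≤s p<n))
                                                     (λ j j<p → left j (ℕ.m<n⇒m<1+n j<p)) (λ j p<j → right j (ℕ.<⇒≤ p<j)) ⟨
      sum {n} (λ x → G (suc (toℕ x)))            ≈⟨ sum-cong-≋ {n} (λ x →
        solve 2 (λ f g → f :- g := con 1ℚ :* f :+ :- con 1ℚ :* g) refl
          (tm (y true true) (suc (toℕ x)) - tm (y true false) (suc (toℕ x)))
          (tm (y false true) (suc (toℕ x)) - tm (y false false) (suc (toℕ x)))) ⟩
      sum {n} (λ x → 1# * f x + - 1# * g x)      ≈⟨ sum-+-scaled 1# (- 1#) f g ⟩
      1# * sum f + - 1# * sum g                  ≈⟨ +-cong (R.*-congˡ (difference-vanish _ _ (valid true true) (valid true false)))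
                                                      (R.*-congˡ (difference-vanish _ _ (valid false true) (valid false false))) ⟩
      1# * 0# + - 1# * 0#                        ≈⟨ solve 0 (con 1ℚ :* con 0ℚ :+ :- con 1ℚ :* con 0ℚ := con 0ℚ) refl ⟩
      0#                                         ∎
      where
      y : Bool → Bool → ℕ → Bool
      y l r = split (suc p) l false r
      f g : Fin n → ℝ
      f x = tm (y true true) (suc (toℕ x)) - tm (y true false) (suc (toℕ x))
      g x = tm (y false true) (suc (toℕ x)) - tm (y false false) (suc (toℕ x))
      G : ℕ → ℝ
      G j = (tm (y true true) j - tm (y true false) j) - (tm (y false true) j - tm (y false false) j)

      valid : ∀ l r → Valid up dn (y l r)
      valid l r = split-valid p (λ _ ()) (λ d → ⊥-elim (exclusive p up-p d))
        (λ u → ⊥-elim (exclusive (suc p) u dn-p)) (λ _ ())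

      agree-≤ : ∀ l {r r′ j} → j ℕ.≤ suc p → y l r j ≡ y l r′ j
      agree-≤ l j≤ with ℕ.m≤n⇒m<n∨m≡n j≤
      ... | inj₁ j<     = ≡.trans (split-< (suc p) j<) (≡.sym (split-< (suc p) j<))
      ... | inj₂ ≡.refl = ≡.trans (split-≡ (suc p)) (≡.sym (split-≡ (suc p)))

      agree-≥ : ∀ r {l l′ j} → suc p ℕ.≤ j → y l r j ≡ y l′ r j
      agree-≥ r j≥ with ℕ.m≤n⇒m<n∨m≡n j≥
      ... | inj₁ j>     = ≡.trans (split-> (suc p) j>) (≡.sym (split-> (suc p) j>))
      ... | inj₂ ≡.refl = ≡.trans (split-≡ (suc p)) (≡.sym (split-≡ (suc p)))

      left : ∀ j → j ℕ.< suc p → G j ≈ 0#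
      left j j< = trans (+-cong (zero-at true) (-‿cong (zero-at false))) (R.-‿inverseʳ 0#)
        where
        zero-at : ∀ l → tm (y l true) j - tm (y l false) j ≈ 0#
        zero-at l = trans (R.+-congʳ (reflexive (term-local up dn A B (y l true) (y l false) j
          (agree-≤ l (ℕ.≤-trans (ℕ.pred[n]≤n {j}) (ℕ.<⇒≤ j<))) (agree-≤ l (ℕ.<⇒≤ j<)) (agree-≤ l j<)))) (R.-‿inverseʳ _)

      right : ∀ j → suc p ℕ.< j → G j ≈ 0#
      right j j> = trans (R.+-congʳ (+-cong (reflexive (move true)) (-‿cong (reflexive (move false))))) (R.-‿inverseʳ _)
        where
        move : ∀ r → tm (y true r) j ≡ tm (y false r) j
        move r = term-local up dn A B (y true r) (y false r) j
          (agree-≥ r (ℕ.<⇒≤pred j>)) (agree-≥ r (ℕ.<⇒≤ j>)) (agree-≥ r (ℕ.m≤n⇒m≤1+n (ℕ.<⇒≤ j>)))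

      at : ∀ l r → tm (y l r) (suc p) ≡ A (suc p) * 0# + B (suc p) * ⟦ l ∧ r ⟧
      at l r rewrite split-≡ p {l} {false} {r} | split-< (suc p) {l} {false} {r} {p} ℕ.≤-refl
                   | split-> p {l} {false} {r} {suc p} ℕ.≤-refl | up-p | dn-p | not-involutive l | not-involutive r = ≡.refl

      center : G (suc p) ≈ B (suc p)
      center rewrite at true true | at true false | at false true | at false false =
        solve 2 (λ a b → ((a :* con 0ℚ :+ b :* con 1ℚ) :- (a :* con 0ℚ :+ b :* con 0ℚ))
                      :- ((a :* con 0ℚ :+ b :* con 0ℚ) :- (a :* con 0ℚ :+ b :* con 0ℚ)) := b) refl (A (suc p)) (B (suc p))

    -- With everything before p + 1 inside and everything after it outside, removing p + 1 turns χ_p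
    -- and τ_{p+1} on and χ_{p+1} and τ_{p+2} off. The first alternative in each disjunction is for
    -- an end of the segment, where χ_p or τ_{p+2} need not change in this way but has coefficient
    -- zero.
    ascent-relation : ∀ p → p ℕ.< n → dn p ≡ false → dn (suc p) ≡ false →
      A p ≈ 0# ⊎ (dn (pred p) ≡ false × up p ≡ true) →
      B (2 ℕ.+ p) ≈ 0# ⊎ (dn (2 ℕ.+ p) ≡ false × up (suc p) ≡ true) →
      A p + B (suc p) ≈ A (suc p) + B (2 ℕ.+ p)
    ascent-relation p p<n dn-p dn-1+p below above = begin
      A p + B (suc p)
        ≈⟨ R.+-identityʳ _ ⟨
      A p + B (suc p) + 0#
        ≈⟨ R.+-congˡ (toggle p p<n valid₁ valid₀) ⟨
      A p + B (suc p) + (G p + G (1 ℕ.+ p) + G (2 ℕ.+ p))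
        ≈⟨ R.+-congˡ (+-cong (+-cong (left below) center) (right above)) ⟩
      A p + B (suc p) + (- A p + (A (suc p) - B (suc p)) + B (2 ℕ.+ p))
        ≈⟨ solve 4 (λ a b c d → a :+ b :+ (:- a :+ (c :- b) :+ d) := c :+ d) refl (A p) (B (suc p)) (A (suc p)) (B (2 ℕ.+ p)) ⟩
      A (suc p) + B (2 ℕ.+ p) ∎
      where
      y : Bool → ℕ → Bool
      y b = split (suc p) true b false
      G : ℕ → ℝ
      G j = tm (y true) j - tm (y false) j
      valid₁ : Valid up dn (y true)
      valid₁ = split-valid p (λ _ _ → ≡.refl) (λ _ _ → ≡.refl) (λ _ ()) (λ d → contradiction (≡.trans (≡.sym d) dn-1+p) λ ())
      valid₀ : Valid up dn (y false)
      valid₀ = split-valid p (λ _ ()) (λ d → contradiction (≡.trans (≡.sym d) dn-p) λ ()) (λ _ ()) (λ _ ())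

      at₁ : tm (y true) (suc p) ≡ A (suc p) * 1# + B (suc p) * 0#
      at₁ rewrite split-≡ p {true} {true} {false} | split-< (suc p) {true} {true} {false} {p} ℕ.≤-refl
                | split-> p {true} {true} {false} {suc p} ℕ.≤-refl | dn-p | ∧-zeroʳ (up (suc p)) = ≡.refl
      at₀ : tm (y false) (suc p) ≡ A (suc p) * 0# + B (suc p) * 1#
      at₀ rewrite split-≡ p {true} {false} {false} | split-< (suc p) {true} {false} {false} {p} ℕ.≤-refl
                | split-> p {true} {false} {false} {suc p} ℕ.≤-refl | dn-1+p | ∧-zeroʳ (up p) = ≡.refl
      center : G (suc p) ≈ A (suc p) - B (suc p)
      center rewrite at₁ | at₀ = solve 2 (λ a b → (a :* con 1ℚ :+ b :* con 0ℚ) :- (a :* con 0ℚ :+ b :* con 1ℚ) := a :- b)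
        refl (A (suc p)) (B (suc p))

      below-τ : ∀ b → peakBit dn up (not ∘ y b) p ≡ false
      below-τ b rewrite split-< (suc p) {true} {b} {false} {p} ℕ.≤-refl = ≡.refl
      left : A p ≈ 0# ⊎ (dn (pred p) ≡ false × up p ≡ true) → G p ≈ - A p
      left (inj₁ A≈0) rewrite below-τ true | below-τ false = begin
        _ ≈⟨ solve 4 (λ a b c d → (a :* c :+ b :* con 0ℚ) :- (a :* d :+ b :* con 0ℚ) := a :* (c :- d)) refl (A p) (B p) _ _ ⟩
        A p * _    ≈⟨ R.*-congʳ A≈0 ⟩
        0# * _     ≈⟨ solve 1 (λ x → con 0ℚ :* x := :- con 0ℚ) refl _ ⟩
        - 0#       ≈⟨ -‿cong A≈0 ⟨
        - A p      ∎
      left (inj₂ (dn≡ , up≡)) rewrite below-τ true | below-τ false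
          | split-< (suc p) {true} {true} {false} {p} ℕ.≤-refl
          | split-< (suc p) {true} {false} {false} {p} ℕ.≤-refl | split-≡ p {true} {true} {false}
          | split-≡ p {true} {false} {false} | dn≡ | up≡ =
        solve 2 (λ a b → (a :* con 0ℚ :+ b :* con 0ℚ) :- (a :* con 1ℚ :+ b :* con 0ℚ) := :- a) refl (A p) (B p)

      above-χ : ∀ b → peakBit up dn (y b) (2 ℕ.+ p) ≡ false
      above-χ b rewrite split-> p {true} {b} {false} {suc p} ℕ.≤-refl = ≡.refl
      right : B (2 ℕ.+ p) ≈ 0# ⊎ (dn (2 ℕ.+ p) ≡ false × up (suc p) ≡ true) → G (2 ℕ.+ p) ≈ B (2 ℕ.+ p)
      right (inj₁ B≈0) rewrite above-χ true | above-χ false = begin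
        _ ≈⟨ solve 4 (λ a b c d → (a :* con 0ℚ :+ b :* c) :- (a :* con 0ℚ :+ b :* d) := b :* (c :- d)) refl (A (2 ℕ.+ p)) (B (2 ℕ.+ p)) _ _ ⟩
        B (2 ℕ.+ p) * _   ≈⟨ R.*-congʳ B≈0 ⟩
        0# * _            ≈⟨ R.zeroˡ _ ⟩
        0#                ≈⟨ B≈0 ⟨
        B (2 ℕ.+ p)       ∎
      right (inj₂ (dn≡ , up≡)) rewrite above-χ true | above-χ false
          | split-> p {true} {true} {false} {suc p} ℕ.≤-refl
          | split-> p {true} {false} {false} {suc p} ℕ.≤-refl | split-≡ p {true} {true} {false}
          | split-≡ p {true} {false} {false} | dn≡ | up≡ =
        solve 2 (λ a b → (a :* con 0ℚ :+ b :* con 1ℚ) :- (a :* con 0ℚ :+ b :* con 0ℚ) := b) refl (A (2 ℕ.+ p)) (B (2 ℕ.+ p))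

    -- In each case the term at j depends on y j alone: χ at a peak and τ at a valley have no
    -- neighbour to consult, and the other coefficient is zero.
    data Flat (j : ℕ) : Set where
      both-0 : A j ≈ 0# → B j ≈ 0# → Flat j
      peak   : up (pred j) ≡ true → dn j ≡ true → B j ≈ 0# → Flat j
      valley : dn (pred j) ≡ true → up j ≡ true → A j ≈ 0# → Flat j

    -- Removing the peak from the full set leaves every other term unchanged, since flat terms
    -- ignore their neighbours. The balance thus reduces to A - B at the peak, where B is zero.
    flat-peak-vanish : (∀ j → Flat j) → ∀ p → p ℕ.< n → up p ≡ true → dn (suc p) ≡ true → A (suc p) ≈ 0#
    flat-peak-vanish flat p p<n up-p dn-p = begin
      A (suc p)                          ≈⟨ solve 1 (λ a → a := con 0ℚ :+ a :+ con 0ℚ) refl _ ⟩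
      0# + A (suc p) + 0#                ≈⟨ +-cong (+-cong (elsewhere p (ℕ.<⇒≢ ℕ.≤-refl)) center) (elsewhere (2 ℕ.+ p) (ℕ.>⇒≢ ℕ.≤-refl)) ⟨
      G p + G (1 ℕ.+ p) + G (2 ℕ.+ p)    ≈⟨ toggle p p<n valid₁ valid₀ ⟩
      0#                                 ∎
      where
      y : Bool → ℕ → Bool
      y b = split (suc p) true b true
      G : ℕ → ℝ
      G j = tm (y true) j - tm (y false) j
      valid₁ : Valid up dn (y true)
      valid₁ = split-valid p (λ _ _ → ≡.refl) (λ _ _ → ≡.refl) (λ _ _ → ≡.refl) (λ _ _ → ≡.refl)
      valid₀ : Valid up dn (y false)
      valid₀ = split-valid p (λ _ ()) (λ d → ⊥-elim (exclusive p up-p d)) (λ u → ⊥-elim (exclusive (suc p) u dn-p)) (λ _ ())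

      at : ∀ b → tm (y b) (suc p) ≡ A (suc p) * ⟦ b ⟧ + B (suc p) * ⟦ not b ⟧
      at true  rewrite split-≡ p {true} {true} {true} | up⇒¬dn up-p | dn⇒¬up dn-p = ≡.refl
      at false rewrite split-≡ p {true} {false} {true} | split-< (suc p) {true} {false} {true} {p} ℕ.≤-refl
                     | split-> p {true} {false} {true} {suc p} ℕ.≤-refl | up-p | dn-p = ≡.refl
      center : G (suc p) ≈ A (suc p)
      center rewrite at true | at false = begin
        _                       ≈⟨ solve 2 (λ a b → (a :* con 1ℚ :+ b :* con 0ℚ) :- (a :* con 0ℚ :+ b :* con 1ℚ) := a :- b) refl _ _ ⟩
        A (suc p) - B (suc p)   ≈⟨ R.+-congˡ (-‿cong (peak-vanish p p<n up-p dn-p)) ⟩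
        A (suc p) - 0#          ≈⟨ solve 1 (λ a → a :- con 0ℚ := a) refl _ ⟩
        A (suc p)               ∎

      agree : ∀ {j} → j ≢ suc p → y true j ≡ y false j
      agree {j} j≢ with ℕ.<-cmp j (suc p)
      ... | tri< j< _ _ = ≡.trans (split-< (suc p) j<) (≡.sym (split-< (suc p) j<))
      ... | tri≈ _ j≡ _ = contradiction j≡ j≢
      ... | tri> _ _ j> = ≡.trans (split-> (suc p) j>) (≡.sym (split-> (suc p) j>))

      elsewhere : ∀ j → j ≢ suc p → G j ≈ 0#
      elsewhere j j≢ with flat j
      ... | both-0 A≈0 B≈0 = trans (+-cong (term-outside (y true) j A≈0 B≈0) (-‿cong (term-outside (y false) j A≈0 B≈0))) (R.-‿inverseʳ 0#)
      ... | peak up≡ dn≡ B≈0 rewrite up⇒¬dn up≡ | dn⇒¬up dn≡ | agree j≢ = begin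
        _        ≈⟨ solve 4 (λ a b c d → (a :+ b :* c) :- (a :+ b :* d) := b :* (c :- d)) refl _ (B j) _ _ ⟩
        B j * _  ≈⟨ R.*-congʳ B≈0 ⟩
        0# * _   ≈⟨ R.zeroˡ _ ⟩
        0#       ∎
      ... | valley dn≡ up≡ A≈0 rewrite dn⇒¬up dn≡ | up⇒¬dn up≡ | agree j≢ = begin
        _        ≈⟨ solve 4 (λ a b c d → (a :* c :+ b) :- (a :* d :+ b) := a :* (c :- d)) refl (A j) _ _ _ ⟩
        A j * _  ≈⟨ R.*-congʳ A≈0 ⟩
        0# * _   ≈⟨ R.zeroˡ _ ⟩
        0#       ∎

    -- With B = -A in the interior, the ascent relations say that A is harmonic along the segment; A
    -- at the lower end and B at the upper end provide the zero boundary values.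
    segment-vanish : ∀ s N → N ℕ.+ s ℕ.≤ suc n →
      (∀ m → m ℕ.< N → dn (m ℕ.+ s) ≡ false) → (∀ m → 0 ℕ.< m → suc m ℕ.< N → up (m ℕ.+ s) ≡ true) →
      A s ≈ 0# → B (N ℕ.+ s) ≈ 0# → (∀ m → 0 ℕ.< m → m ℕ.< N → A (m ℕ.+ s) + B (m ℕ.+ s) ≈ 0#) →
      ∀ m → 0 ℕ.< m → m ℕ.< N → A (m ℕ.+ s) ≈ 0#
    segment-vanish s N N+s≤ ¬dn up≡ A≈0 B≈0 A+B≈0 m 0<m m<N = trans (sym (reflexive (u-inside m<N)))
      (harmonic-vanish u N (trans (reflexive (u-inside (ℕ.<-trans 0<m m<N))) A≈0) (reflexive u-end) harmonic m (ℕ.<⇒≤ m<N))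
      where
      u : ℕ → ℝ
      -- The last value is set to 0 instead of A at the upper end: only B is known to vanish there,
      -- and the last relation involves only B at that end.
      u m = if does (m ℕ.<? N) then A (m ℕ.+ s) else 0#
      u-inside : ∀ {m} → m ℕ.< N → u m ≡ A (m ℕ.+ s)
      u-inside {m} m<N rewrite dec-true (m ℕ.<? N) m<N = ≡.refl
      u-end : u N ≡ 0#
      u-end rewrite dec-false (N ℕ.<? N) (ℕ.<-irrefl ≡.refl) = ≡.refl

      below : ∀ j → suc j ℕ.< N → A (j ℕ.+ s) ≈ 0# ⊎ (dn (pred (j ℕ.+ s)) ≡ false × up (j ℕ.+ s) ≡ true)
      below zero    _   = inj₁ A≈0
      below (suc j) j<N = inj₂ (¬dn j (ℕ.<⇒≤ (ℕ.<⇒≤ j<N)) , up≡ (suc j) (s≤s z≤n) j<N)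

      above : ∀ j → suc j ℕ.< N → B (2 ℕ.+ j ℕ.+ s) ≈ 0# ⊎ (dn (2 ℕ.+ j ℕ.+ s) ≡ false × up (suc j ℕ.+ s) ≡ true)
      above j j<N with ℕ.m≤n⇒m<n∨m≡n j<N
      ... | inj₁ 2+j<N   = inj₂ (¬dn (2 ℕ.+ j) 2+j<N , up≡ (suc j) (s≤s z≤n) 2+j<N)
      ... | inj₂ ≡.refl = inj₁ B≈0

      next : ∀ j → suc j ℕ.< N → u (2 ℕ.+ j) ≈ - B (2 ℕ.+ j ℕ.+ s)
      next j j<N with ℕ.m≤n⇒m<n∨m≡n j<N
      ... | inj₁ 2+j<N   = begin
        u (2 ℕ.+ j)               ≈⟨ reflexive (u-inside 2+j<N) ⟩
        A (2 ℕ.+ j ℕ.+ s)         ≈⟨ solve 2 (λ a b → a := (a :+ b) :- b) refl _ (B (2 ℕ.+ j ℕ.+ s)) ⟩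
        A (2 ℕ.+ j ℕ.+ s) + B (2 ℕ.+ j ℕ.+ s) - B (2 ℕ.+ j ℕ.+ s)  ≈⟨ R.+-congʳ (A+B≈0 (2 ℕ.+ j) (s≤s z≤n) 2+j<N) ⟩
        0# - B (2 ℕ.+ j ℕ.+ s)    ≈⟨ R.+-identityˡ _ ⟩
        - B (2 ℕ.+ j ℕ.+ s)       ∎
      ... | inj₂ ≡.refl = begin
        u N                       ≈⟨ reflexive u-end ⟩
        0#                        ≈⟨ solve 0 (con 0ℚ := :- con 0ℚ) refl ⟩
        - 0#                      ≈⟨ -‿cong B≈0 ⟨
        - B (N ℕ.+ s)             ∎

      harmonic : ∀ j → suc j ℕ.< N → u j + u (2 ℕ.+ j) ≈ u (suc j) + u (suc j)
      harmonic j j<N = begin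
        u j + u (2 ℕ.+ j)
          ≈⟨ +-cong (reflexive (u-inside (ℕ.<⇒≤ j<N))) (next j j<N) ⟩
        A₀ - B₂
          ≈⟨ solve 3 (λ a b c → a :- c := (a :+ b) :- b :- c) refl A₀ B₁ B₂ ⟩
        A₀ + B₁ - B₁ - B₂
          ≈⟨ R.+-congʳ (R.+-congʳ (ascent-relation (j ℕ.+ s) j+s<n (¬dn j (ℕ.<⇒≤ j<N)) (¬dn (suc j) j<N) (below j j<N) (above j j<N))) ⟩
        A₁ + B₂ - B₁ - B₂
          ≈⟨ solve 3 (λ a b c → a :+ c :- b :- c := a :+ a :- (a :+ b)) refl A₁ B₁ B₂ ⟩
        A₁ + A₁ - (A₁ + B₁)
          ≈⟨ R.+-congˡ (-‿cong (A+B≈0 (suc j) (s≤s z≤n) j<N)) ⟩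
        A₁ + A₁ - 0#
          ≈⟨ solve 1 (λ a → a :+ a :- con 0ℚ := a :+ a) refl A₁ ⟩
        A₁ + A₁
          ≈⟨ +-cong (reflexive (u-inside j<N)) (reflexive (u-inside j<N)) ⟨
        u (suc j) + u (suc j) ∎
        where
        A₀ = A (j ℕ.+ s)
        A₁ = A (suc j ℕ.+ s)
        B₁ = B (suc j ℕ.+ s)
        B₂ = B (2 ℕ.+ j ℕ.+ s)
        j+s<n : j ℕ.+ s ℕ.< n
        j+s<n = ℕ.s≤s⁻¹ (ℕ.≤-trans (ℕ.+-monoˡ-≤ s j<N) N+s≤)

  -- The statistics on a fence, with coefficients extended by zero

  extend : ∀ {n} → (Fin n → ℝ) → ℕ → ℝ
  extend     g zero    = 0#
  extend {n} g (suc j) with j ℕ.<? n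
  ... | yes j<n = g (fromℕ< j<n)
  ... | no  _   = 0#

  extend-inside : ∀ {n} (g : Fin n → ℝ) x → extend g (suc (toℕ x)) ≡ g x
  extend-inside {n} g x with toℕ x ℕ.<? n
  ... | yes x<n = cong g (Fin.fromℕ<-toℕ x x<n)
  ... | no  x≮n = contradiction (Fin.toℕ<n x) x≮n

  extend-outside : ∀ {n} (g : Fin n → ℝ) {j} → n ℕ.≤ j → extend g (suc j) ≡ 0#
  extend-outside {n} g {j} n≤j with j ℕ.<? n
  ... | yes j<n = contradiction n≤j (ℕ.<⇒≱ j<n)
  ... | no  _   = ≡.refl

  ⟦∧¬⟧ : ∀ a b → (b ≡ true → a ≡ true) → ⟦ a ∧ not b ⟧ ≈ ⟦ a ⟧ - ⟦ b ⟧
  ⟦∧¬⟧ true  true  _ = sym (R.-‿inverseʳ 1#)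
  ⟦∧¬⟧ true  false _ = solve 0 (con 1ℚ := con 1ℚ :- con 0ℚ) refl
  ⟦∧¬⟧ false true  h = contradiction (h ≡.refl) λ ()
  ⟦∧¬⟧ false false _ = sym (R.-‿inverseʳ 0#)

  ⟦not⟧ : ∀ a → ⟦ not a ⟧ ≈ 1# - ⟦ a ⟧
  ⟦not⟧ true  = sym (R.-‿inverseʳ 1#)
  ⟦not⟧ false = solve 0 (con 1ℚ := con 1ℚ :- con 0ℚ) refl

  if-if : ∀ {P Q : Set} (P? : Dec P) (Q? : Dec Q) → (P → ¬ Q) →
          (if does P? then 1# else if does Q? then - 1# else 0#) ≈ ⟦ does P? ⟧ - ⟦ does Q? ⟧
  if-if (yes p) (yes q) disjoint = contradiction q (disjoint p)
  if-if (yes _) (no _)  _        = solve 0 (con 1ℚ := con 1ℚ :- con 0ℚ) refl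
  if-if (no _)  (yes _) _        = sym (R.+-identityˡ _)
  if-if (no _)  (no _)  _        = sym (R.-‿inverseʳ 0#)

  module FenceStatistics {k} (α : Vec ℕ (2 ℕ.+ k)) (α≥1 : ∀ i → 1 ℕ.≤ lookup α i)
    (α₁≥2 : 2 ℕ.≤ head α) (αₜ≥2 : 2 ℕ.≤ last α) where

    open Fence α α≥1 using
      (t; a; n; pos; number; Ascending; Descending; 𝒥; isMax?; isMinOfComplement?; shared; IsShared; UnsharedSegment)
    open FencePositions α α≥1 α₁≥2 αₜ≥2
    open FunctionSpace (Fence.𝒥 α α≥1)

    -- The statistics enter through pointwise equations instead of their definitions, which are tied
    -- to the concrete reals.
    module _
      (χ T : Fin (Fence.n α α≥1) → Fence.𝒥 α α≥1 → ℝ)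
      (χ≡ : ∀ q I → χ q I ≡ (if does (Fence.isMax? α α≥1 (proj₁ I) q) then fromℚ 1ℚ else fromℚ 0ℚ))
      (T≡ : ∀ q I → T q I ≡
         (if does (Fence.isMinOfComplement? α α≥1 (proj₁ I) q) then fromℚ 1ℚ else
          if does (Fence.isMax? α α≥1 (proj₁ I) q) then -′ fromℚ 1ℚ else fromℚ 0ℚ))
      (χ-shared : ℕ → Fence.𝒥 α α≥1 → ℝ)
      (χ-shared₀ : ∀ I → χ-shared 0 I ≡ fromℚ 0ℚ)
      (χ-sharedᵢ : ∀ i I → χ-shared (suc (toℕ i)) I ≡ χ (Fence.shared α α≥1 i) I)
      (χ-sharedₜ : ∀ I → χ-shared (2 ℕ.+ k) I ≡ fromℚ 0ℚ)
      (basisElement : Fin (Fence.t α α≥1) → Fin (Fence.n α α≥1) → Fence.𝒥 α α≥1 → ℝ)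
      (scalar : ℕ → ℝ) (scalar≡ : ∀ m → scalar m ≡ fromℚ (+ m ℚ./ 1))
      (basisElement≡ : ∀ i x I → basisElement i x I ≡
         ((scalar (lookup α i) *′ χ x I) +′ χ-shared (Fence.number α α≥1 i ℕ.∸ 1) I) +′ χ-shared (Fence.number α α≥1 i) I)
      where

      basisElement≈ : ∀ i x I → basisElement i x I ≈ fromℕ (lookup α i) * χ x I + χ-shared (toℕ i) I + χ-shared (number i) I
      basisElement≈ i x I = trans (reflexive (basisElement≡ i x I))
        (R.+-congʳ (R.+-congʳ (R.*-congʳ (reflexive (scalar≡ (lookup α i))))))

      open IsSubspace (AffineSpan-isSubspace T) using (null) renaming
        (resp to T-resp; lin to T-lin; add to T-add; scale to T-scale; quotient to T-quotient)

      A-T-isSubspace : IsSubspace (Span χ ∩ AffineSpan T)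
      A-T-isSubspace = ∩-isSubspace (Span-isSubspace χ) (AffineSpan-isSubspace T)

      τ : Fin n → 𝒥 → ℝ
      τ q I = ⟦ does (isMinOfComplement? (proj₁ I) q) ⟧

      T≈τ-χ : ∀ q I → T q I ≈ τ q I - χ q I
      T≈τ-χ q I = trans (reflexive (T≡ q I)) (trans
        (if-if (isMinOfComplement? (proj₁ I) q) (isMax? (proj₁ I) q) λ (q∉I , _) (q∈I , _) → q∉I q∈I)
        (R.+-congˡ (-‿cong (reflexive (≡.sym (χ≡ q I))))))

      χ-↓ : ∀ q x → χ q (↓ x) ≈ ⟦ does (q Fin.≟ x) ⟧
      χ-↓ q x = reflexive (≡.trans (χ≡ q (↓ x)) (cong ⟦_⟧ (isMax-↓ x q)))

      χ-↓-≡ : ∀ x → χ x (↓ x) ≈ 1#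
      χ-↓-≡ x = trans (χ-↓ x x) (reflexive (cong ⟦_⟧ (dec-true (x Fin.≟ x) ≡.refl)))

      χ-↓-≢ : ∀ {q x} → q ≢ x → χ q (↓ x) ≈ 0#
      χ-↓-≢ {q} {x} q≢x = trans (χ-↓ q x) (reflexive (cong ⟦_⟧ (dec-false (q Fin.≟ x) q≢x)))

      -- Elements of A_T that vanish at the principal ideals of unshared elements

      module _ {h : 𝒥 → ℝ} (e : Fin n → ℝ) (h≐ : h ≐ combination e χ)
        (c : ℝ) (c′ : Fin n → ℝ) (h≈ : ∀ I → h I ≈ c + sum (λ q → c′ q * T q I))
        (h-↓ : ∀ i x → UnsharedSegment i x → h (↓ x) ≈ 0#) where

        e-unshared : ∀ i x → UnsharedSegment i x → e x ≈ 0#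
        e-unshared i x unshared = begin
          e x                    ≈⟨ R.*-identityʳ (e x) ⟨
          e x * 1#               ≈⟨ R.*-congˡ (χ-↓-≡ x) ⟨
          e x * χ x (↓ x)        ≈⟨ sum-single {f = λ q → e q * χ q (↓ x)} x (λ q q≢x → trans (R.*-congˡ (χ-↓-≢ q≢x)) (R.zeroʳ (e q))) ⟨
          combination e χ (↓ x)  ≈⟨ h≐ (↓ x) ⟨
          h (↓ x)                ≈⟨ h-↓ i x unshared ⟩
          0#                     ∎

        -- e χ - c′ T = (e + c′) χ - c′ τ
        A′ B′ : Fin n → ℝ
        A′ q = e q + c′ q
        B′ q = - c′ q

        A B : ℕ → ℝ
        A = extend A′
        B = extend B′

        A+B : ∀ x → A (pos x) + B (pos x) ≈ e x
        A+B x = begin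
          A (pos x) + B (pos x)  ≈⟨ +-cong (reflexive (extend-inside A′ x)) (reflexive (extend-inside B′ x)) ⟩
          e x + c′ x + - c′ x    ≈⟨ solve 2 (λ e c → e :+ c :+ :- c := e) refl (e x) (c′ x) ⟩
          e x                    ∎

        balanced : Balanced n up dn A B
        balanced = record
          { exclusive = exclusive
          ; A₀≈0 = refl ; B₀≈0 = refl
          ; Aₙ≈0 = reflexive (extend-outside A′ ℕ.≤-refl) ; Bₙ≈0 = reflexive (extend-outside B′ ℕ.≤-refl)
          ; value = c ; balance = balance }
          where
          balance : ∀ y → Valid up dn y → sum {n} (λ x → term up dn A B y (suc (toℕ x))) ≈ c
          balance y valid = begin
            sum {n} (λ x → term up dn A B y (pos x))
              ≈⟨ sum-cong-≋ {n} pointwise ⟩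
            sum {n} (λ x → 1# * (e x * χ x I) + - 1# * (c′ x * T x I))
              ≈⟨ sum-+-scaled {n} 1# (- 1#) (λ x → e x * χ x I) (λ x → c′ x * T x I) ⟩
            1# * combination e χ I + - 1# * sum (λ x → c′ x * T x I)
              ≈⟨ R.+-congʳ (R.*-congˡ (trans (sym (h≐ I)) (h≈ I))) ⟩
            1# * (c + sum (λ x → c′ x * T x I)) + - 1# * sum (λ x → c′ x * T x I)
              ≈⟨ solve 2 (λ c s → con 1ℚ :* (c :+ s) :+ :- con 1ℚ :* s := c) refl c _ ⟩
            c ∎
            where
            I = toIdeal y valid
            open Represented (proj₂ I) {y} (toIdeal-rep y valid) using (isMax-bit; isMin-bit)
            pointwise : ∀ x → term up dn A B y (pos x) ≈ 1# * (e x * χ x I) + - 1# * (c′ x * T x I)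
            pointwise x = begin
              A (pos x) * ⟦ peakBit up dn y (pos x) ⟧ + B (pos x) * ⟦ peakBit dn up (not ∘ y) (pos x) ⟧
                ≈⟨ +-cong
                  (*-cong (reflexive (extend-inside A′ x)) (trans (reflexive (cong ⟦_⟧ (≡.sym (isMax-bit x)))) (reflexive (≡.sym (χ≡ x I)))))
                  (*-cong (reflexive (extend-inside B′ x)) (reflexive (cong ⟦_⟧ (≡.sym (isMin-bit x))))) ⟩
              (e x + c′ x) * χ x I + - c′ x * τ x I
                ≈⟨ solve 4 (λ e c χ τ → (e :+ c) :* χ :+ :- c :* τ := con 1ℚ :* (e :* χ) :+ :- con 1ℚ :* (c :* (τ :- χ)))
                     refl (e x) (c′ x) (χ x I) (τ x I) ⟩
              1# * (e x * χ x I) + - 1# * (c′ x * (τ x I - χ x I))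
                ≈⟨ R.+-congˡ (R.*-congˡ (R.*-congˡ (T≈τ-χ x I))) ⟨
              1# * (e x * χ x I) + - 1# * (c′ x * T x I) ∎

        B-peak : ∀ i → ¬ 2 ∣ suc (toℕ i) → B (a (suc (toℕ i))) ≈ 0#
        B-peak i odd = subst (λ j → B j ≈ 0#) (suc-pred-a (toℕ i)) (peak-vanish balanced (pred (a (suc (toℕ i))))
          (subst (ℕ._≤ n) (≡.sym (suc-pred-a (toℕ i))) (ℕ.<⇒≤ (a<n i))) (proj₁ (peak-at i odd))
          (subst (λ j → dn j ≡ true) (≡.sym (suc-pred-a (toℕ i))) (proj₂ (peak-at i odd))))

        A-valley : ∀ i → 2 ∣ suc (toℕ i) → A (a (suc (toℕ i))) ≈ 0#
        A-valley i even = subst (λ j → A j ≈ 0#) (suc-pred-a (toℕ i)) (peak-vanish (dual balanced) (pred (a (suc (toℕ i))))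
          (subst (ℕ._≤ n) (≡.sym (suc-pred-a (toℕ i))) (ℕ.<⇒≤ (a<n i))) (proj₁ (valley-at i even))
          (subst (λ j → up j ≡ true) (≡.sym (suc-pred-a (toℕ i))) (proj₂ (valley-at i even))))

        -- The zero extension makes the outer boundaries 0 and t obey the same rule as valleys, so
        -- the first and last segments need no separate treatment.
        A-even : ∀ j → j ℕ.≤ t → 2 ∣ j → A (a j) ≈ 0#
        A-even zero    _        _    = refl
        A-even (suc j) (s≤s j≤) even = go (shared-or-last j j≤)
          where
          go : (∃[ i ] toℕ {suc k} i ≡ j) ⊎ j ≡ suc k → A (a (suc j)) ≈ 0#
          go (inj₁ (i , i≡j)) = subst (λ j → A (a (suc j)) ≈ 0#) i≡j (A-valley i (subst (λ j → 2 ∣ suc j) (≡.sym i≡j) even))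
          go (inj₂ j≡)        = subst (λ j → A j ≈ 0#) (≡.sym (≡.trans (cong (a ∘ suc) j≡) aₜ≡1+n)) (Balanced.Aₙ≈0 balanced)

        B-odd : ∀ j → j ℕ.≤ t → ¬ 2 ∣ j → B (a j) ≈ 0#
        B-odd zero    _        _   = refl
        B-odd (suc j) (s≤s j≤) odd = go (shared-or-last j j≤)
          where
          go : (∃[ i ] toℕ {suc k} i ≡ j) ⊎ j ≡ suc k → B (a (suc j)) ≈ 0#
          go (inj₁ (i , i≡j)) = subst (λ j → B (a (suc j)) ≈ 0#) i≡j (B-peak i (subst (λ j → ¬ 2 ∣ suc j) (≡.sym i≡j) odd))
          go (inj₂ j≡)        = subst (λ j → B j ≈ 0#) (≡.sym (≡.trans (cong (a ∘ suc) j≡) aₜ≡1+n)) (Balanced.Bₙ≈0 balanced)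

        module _ (i : Fin t) where

          open Segment i

          private
            interior-A+B : ∀ m → 0 ℕ.< m → m ℕ.< N → A (m ℕ.+ s) + B (m ℕ.+ s) ≈ 0#
            interior-A+B m 0<m m<N = let x , x≡ , unshared = interior m 0<m m<N in
              subst (λ j → A j + B j ≈ 0#) x≡ (trans (A+B x) (e-unshared i x unshared))

          -- An even-numbered segment ascends in the opposite order, where B plays the part of A; in
          -- either case the second coefficient follows from A + B = 0.
          inner-vanish : ∀ j → s ℕ.< j → j ℕ.< a (number i) → A j ≈ 0# × B j ≈ 0#
          inner-vanish j s<j j<a = subst (λ j → A j ≈ 0# × B j ≈ 0#) (ℕ.m∸n+n≡m (ℕ.<⇒≤ s<j))
            (both (j ℕ.∸ s) (ℕ.m<n⇒0<n∸m s<j) (∸s<N s<j j<a))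
            where
            finish : ∀ {x y} → x + y ≈ 0# → x ≈ 0# → y ≈ 0#
            finish {x} {y} x+y≈0 x≈0 = begin
              y            ≈⟨ solve 2 (λ x y → y := (x :+ y) :- x) refl x y ⟩
              x + y - x    ≈⟨ +-cong x+y≈0 (-‿cong x≈0) ⟩
              0# - 0#      ≈⟨ R.-‿inverseʳ 0# ⟩
              0#           ∎
            A-odd : ¬ 2 ∣ number i → ∀ m → 0 ℕ.< m → m ℕ.< N → A (m ℕ.+ s) ≈ 0#
            A-odd odd = segment-vanish balanced s N N+s≤ (λ m m<N → ascending⇒¬dn (ascending odd m<N))
                (λ m 0<m 1+m<N → up⁺ (inner 0<m 1+m<N) (ascending odd (ℕ.<⇒≤ 1+m<N)))
                (A-even (toℕ i) (ℕ.<⇒≤ (Fin.toℕ<n i)) (even-pred odd))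
                (subst (λ j → B j ≈ 0#) (≡.sym N+s≡) (B-odd (number i) (Fin.toℕ<n i) odd))
                interior-A+B
            B-even : 2 ∣ number i → ∀ m → 0 ℕ.< m → m ℕ.< N → B (m ℕ.+ s) ≈ 0#
            B-even even = segment-vanish (dual balanced) s N N+s≤ (λ m m<N → descending⇒¬up (descending even m<N))
                (λ m 0<m 1+m<N → dn⁺ (inner 0<m 1+m<N) (descending even (ℕ.<⇒≤ 1+m<N)))
                (B-odd (toℕ i) (ℕ.<⇒≤ (Fin.toℕ<n i)) (λ even′ → even⇒odd-suc even′ even))
                (subst (λ j → A j ≈ 0#) (≡.sym N+s≡) (A-even (number i) (Fin.toℕ<n i) even))
                (λ m 0<m m<N → trans (R.+-comm _ _) (interior-A+B m 0<m m<N))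
            both : ∀ m → 0 ℕ.< m → m ℕ.< N → A (m ℕ.+ s) ≈ 0# × B (m ℕ.+ s) ≈ 0#
            both m 0<m m<N = go (2 ∣? number i)
              where
              go : Dec (2 ∣ number i) → A (m ℕ.+ s) ≈ 0# × B (m ℕ.+ s) ≈ 0#
              go (no odd)   = A-odd odd m 0<m m<N , finish (interior-A+B m 0<m m<N) (A-odd odd m 0<m m<N)
              go (yes even) = finish (trans (R.+-comm _ _) (interior-A+B m 0<m m<N)) (B-even even m 0<m m<N) , B-even even m 0<m m<N

        flat : ∀ j → Flat balanced j
        flat zero = both-0 refl refl
        flat j@(suc j′) = go (j ℕ.≤? n)
          where
          at-shared : ∀ i → Dec (2 ∣ suc (toℕ i)) → Flat balanced (a (suc (toℕ i)))
          at-shared i (yes even) = valley (proj₁ (valley-at i even)) (proj₂ (valley-at i even)) (A-valley i even)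
          at-shared i (no odd)   = peak (proj₁ (peak-at i odd)) (proj₂ (peak-at i odd)) (B-peak i odd)
          located : Location j → Flat balanced j
          located (within i lo hi) = both-0 (proj₁ (inner-vanish i j lo hi)) (proj₂ (inner-vanish i j lo hi))
          located (at i j≡)        = subst (Flat balanced) (≡.sym j≡) (at-shared i (2 ∣? suc (toℕ i)))
          go : Dec (j ℕ.≤ n) → Flat balanced j
          go (yes j≤n) = located (locate j (s≤s z≤n) j≤n)
          go (no j≰n)  = both-0 (reflexive (extend-outside A′ (ℕ.s≤s⁻¹ (ℕ.≰⇒> j≰n))))
                                (reflexive (extend-outside B′ (ℕ.s≤s⁻¹ (ℕ.≰⇒> j≰n))))

        Flat-dual : ∀ {j} → Flat balanced j → Flat (dual balanced) j
        Flat-dual (both-0 A≈0 B≈0) = both-0 B≈0 A≈0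
        Flat-dual (peak u d B≈0)   = valley u d B≈0
        Flat-dual (valley d u A≈0) = peak d u A≈0

        A+B-shared : ∀ i → Dec (2 ∣ suc (toℕ i)) → A (a (suc (toℕ i))) + B (a (suc (toℕ i))) ≈ 0#
        A+B-shared i (no odd) = trans (+-cong (subst (λ j → A j ≈ 0#) (suc-pred-a (toℕ i))
            (flat-peak-vanish balanced flat (pred (a (suc (toℕ i))))
              (subst (ℕ._≤ n) (≡.sym (suc-pred-a (toℕ i))) (ℕ.<⇒≤ (a<n i))) (proj₁ (peak-at i odd))
              (subst (λ j → dn j ≡ true) (≡.sym (suc-pred-a (toℕ i))) (proj₂ (peak-at i odd)))))
          (B-peak i odd)) (R.+-identityˡ 0#)
        A+B-shared i (yes even) = trans (+-cong (A-valley i even) (subst (λ j → B j ≈ 0#) (suc-pred-a (toℕ i))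
            (flat-peak-vanish (dual balanced) (λ j → Flat-dual (flat j)) (pred (a (suc (toℕ i))))
              (subst (ℕ._≤ n) (≡.sym (suc-pred-a (toℕ i))) (ℕ.<⇒≤ (a<n i))) (proj₁ (valley-at i even))
              (subst (λ j → up j ≡ true) (≡.sym (suc-pred-a (toℕ i))) (proj₂ (valley-at i even))))))
          (R.+-identityˡ 0#)

        e≈0 : ∀ x → e x ≈ 0#
        e≈0 x = go (locate (pos x) (s≤s z≤n) (pos≤n x))
          where
          go : Location (pos x) → e x ≈ 0#
          go (within i lo hi) = e-unshared i x (within⇒unshared i lo hi)
          go (at i x≡)        = trans (sym (A+B x)) (subst (λ j → A j + B j ≈ 0#) (≡.sym x≡) (A+B-shared i (2 ∣? suc (toℕ i))))

        vanish : h ≐ λ _ → 0#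
        vanish I = trans (h≐ I) (sum-zero {n} λ x → trans (R.*-congʳ (e≈0 x)) (R.zeroˡ (χ x I)))

      A-T-determined : ∀ h → (Span χ ∩ AffineSpan T) h → (∀ i x → UnsharedSegment i x → h (↓ x) ≈ 0#) → h ≐ λ _ → 0#
      A-T-determined h ((e , h≐) , c , c′ , h≈) = vanish e h≐ c c′ h≈

      -- Membership of the basis elements in A_T

      private
        Y : ℕ → 𝒥 → ℝ
        Y j I = ⟦ bits (proj₁ I) j ⟧

      -- The position is a variable with an equation, so that the formulas can be used at `m + s`;
      -- each `go` then matches the equation.
      module _ (x : Fin n) {p} (x≡p : pos x ≡ suc p) where

        χ-ascending : Ascending p → Ascending (suc p) → ∀ I → χ x I ≈ Y (suc p) I - Y (2 ℕ.+ p) I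
        χ-ascending asc⁻ asc I = go x≡p asc⁻ asc
          where
          go : ∀ {p} → pos x ≡ suc p → Ascending p → Ascending (suc p) → χ x I ≈ Y (suc p) I - Y (2 ℕ.+ p) I
          go ≡.refl asc⁻ asc = trans
            (reflexive (≡.trans (χ≡ x I) (cong ⟦_⟧ (isMax-ascending (proj₂ I) x asc⁻ asc))))
            (⟦∧¬⟧ _ _ (bits-ascending (proj₂ I) x asc⁻ asc))

        χ-descending : Descending p → Descending (suc p) → ∀ I → χ x I ≈ Y (suc p) I - Y p I
        χ-descending desc⁻ desc I = go x≡p desc⁻ desc
          where
          go : ∀ {p} → pos x ≡ suc p → Descending p → Descending (suc p) → χ x I ≈ Y (suc p) I - Y p I
          go ≡.refl desc⁻ desc = trans
            (reflexive (≡.trans (χ≡ x I) (cong ⟦_⟧ (isMax-descending (proj₂ I) x desc⁻ desc))))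
            (⟦∧¬⟧ _ _ (bits-descending⁻ (proj₂ I) x desc⁻ desc))

        τ-ascending : Ascending p → Ascending (suc p) → ∀ I → τ x I ≈ Y p I - Y (suc p) I
        τ-ascending asc⁻ asc I = go x≡p asc⁻ asc
          where
          go : ∀ {p} → pos x ≡ suc p → Ascending p → Ascending (suc p) → τ x I ≈ Y p I - Y (suc p) I
          go ≡.refl asc⁻ asc = trans (reflexive (cong ⟦_⟧ (isMin-ascending (proj₂ I) x asc⁻ asc)))
            (⟦∧¬⟧ _ _ (bits-ascending⁻ (proj₂ I) x asc⁻ asc))

        τ-descending : Descending p → Descending (suc p) → ∀ I → τ x I ≈ Y (2 ℕ.+ p) I - Y (suc p) I
        τ-descending desc⁻ desc I = go x≡p desc⁻ desc
          where
          go : ∀ {p} → pos x ≡ suc p → Descending p → Descending (suc p) → τ x I ≈ Y (2 ℕ.+ p) I - Y (suc p) I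
          go ≡.refl desc⁻ desc = trans (reflexive (cong ⟦_⟧ (isMin-descending (proj₂ I) x desc⁻ desc)))
            (⟦∧¬⟧ _ _ (bits-descending (proj₂ I) x desc⁻ desc))

        -- At an unshared element τ is one adjacent step of y and χ the other, so T is the
        -- difference of two consecutive steps. Reversing the direction exchanges the two steps and
        -- also their signs, which gives the same formula.
        second-difference : (Ascending p × Ascending (suc p)) ⊎ (Descending p × Descending (suc p)) →
          ∀ I → T x I ≈ (Y p I + Y (2 ℕ.+ p) I) - (Y (suc p) I + Y (suc p) I)
        second-difference (inj₁ (asc⁻ , asc)) I = begin
          T x I                                                        ≈⟨ T≈τ-χ x I ⟩
          τ x I - χ x I                                                ≈⟨ +-cong (τ-ascending asc⁻ asc I) (-‿cong (χ-ascending asc⁻ asc I)) ⟩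
          (Y p I - Y (suc p) I) - (Y (suc p) I - Y (2 ℕ.+ p) I)        ≈⟨ solve 3 (λ a b c → (a :- b) :- (b :- c) := (a :+ c) :- (b :+ b)) refl
                                                                            (Y p I) (Y (suc p) I) (Y (2 ℕ.+ p) I) ⟩
          (Y p I + Y (2 ℕ.+ p) I) - (Y (suc p) I + Y (suc p) I)        ∎
        second-difference (inj₂ (desc⁻ , desc)) I = begin
          T x I                                                        ≈⟨ T≈τ-χ x I ⟩
          τ x I - χ x I                                                ≈⟨ +-cong (τ-descending desc⁻ desc I) (-‿cong (χ-descending desc⁻ desc I)) ⟩
          (Y (2 ℕ.+ p) I - Y (suc p) I) - (Y (suc p) I - Y p I)        ≈⟨ solve 3 (λ a b c → (c :- b) :- (b :- a) := (a :+ c) :- (b :+ b)) refl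
                                                                            (Y p I) (Y (suc p) I) (Y (2 ℕ.+ p) I) ⟩
          (Y p I + Y (2 ℕ.+ p) I) - (Y (suc p) I + Y (suc p) I)        ∎

      -- At a peak χ and y agree exactly. At an odd outer end t both are zero, by the convention and
      -- by the virtual bit false.
      χ-shared-odd : ∀ j → j ℕ.≤ t → ¬ 2 ∣ j → AffineSpan T (λ I → χ-shared j I - Y (a j) I)
      χ-shared-odd zero    _        odd = contradiction (2 ∣0) odd
      χ-shared-odd (suc j) (s≤s j≤) odd = go (shared-or-last j j≤)
        where
        go : (∃[ i ] toℕ {suc k} i ≡ j) ⊎ j ≡ suc k → AffineSpan T (λ I → χ-shared (suc j) I - Y (a (suc j)) I)
        go (inj₁ (i , ≡.refl)) = T-resp (λ I → sym (begin
          χ-shared (suc j) I - Y (a (suc j)) I     ≈⟨ R.+-congʳ (reflexive (χ-sharedᵢ i I)) ⟩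
          χ (shared i) I - Y (a (suc j)) I         ≈⟨ R.+-congʳ (reflexive (χ≡ (shared i) I)) ⟩
          ⟦ _ ⟧ - Y (a (suc j)) I                  ≈⟨ R.+-congʳ (reflexive (cong ⟦_⟧ (≡.trans
            (isMax-peak (proj₂ I) (shared i) (subst (λ p → up (pred p) ≡ true) (≡.sym (pos-shared i)) (proj₁ (peak-at i odd)))
              (subst (λ p → dn p ≡ true) (≡.sym (pos-shared i)) (proj₂ (peak-at i odd))))
            (cong (bits (proj₁ I)) (pos-shared i))))) ⟩
          Y (a (suc j)) I - Y (a (suc j)) I        ≈⟨ R.-‿inverseʳ _ ⟩
          0#                                       ∎)) null
        go (inj₂ ≡.refl) = T-resp (λ I → sym (begin
          χ-shared t I - Y (a t) I   ≈⟨ +-cong (reflexive (χ-sharedₜ I)) (-‿cong (reflexive (cong ⟦_⟧ (≡.trans (cong (bits (proj₁ I)) aₜ≡1+n)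
                                          (≡.trans (bits-end (proj₁ I)) (dec-false (2 ∣? t) odd)))))) ⟩
          0# - 0#                    ≈⟨ R.-‿inverseʳ 0# ⟩
          0#                         ∎)) null

      -- At a valley it is τ that equals 1 - y, and χ differs from τ by -T. At 0 and at an even t
      -- the virtual bit is true, so 1 - y is the zero of the convention.
      χ-shared-even : ∀ j → j ℕ.≤ t → 2 ∣ j → AffineSpan T (λ I → χ-shared j I - (1# - Y (a j) I))
      χ-shared-even zero    _        _    = T-resp (λ I → sym (begin
        χ-shared 0 I - (1# - 1#)  ≈⟨ R.+-congʳ (reflexive (χ-shared₀ I)) ⟩
        0# - (1# - 1#)            ≈⟨ solve 0 (con 0ℚ :- (con 1ℚ :- con 1ℚ) := con 0ℚ) refl ⟩
        0#                        ∎)) null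
      χ-shared-even (suc j) (s≤s j≤) even = go (shared-or-last j j≤)
        where
        go : (∃[ i ] toℕ {suc k} i ≡ j) ⊎ j ≡ suc k → AffineSpan T (λ I → χ-shared (suc j) I - (1# - Y (a (suc j)) I))
        go (inj₁ (i , ≡.refl)) = T-resp (λ I → begin
          - 1# * T (shared i) I                           ≈⟨ R.*-congˡ (T≈τ-χ (shared i) I) ⟩
          - 1# * (τ (shared i) I - χ (shared i) I)        ≈⟨ solve 2 (λ a b → :- con 1ℚ :* (a :- b) := b :- a) refl (τ (shared i) I) (χ (shared i) I) ⟩
          χ (shared i) I - τ (shared i) I                 ≈⟨ +-cong (sym (reflexive (χ-sharedᵢ i I))) (-‿cong (trans (reflexive (cong ⟦_⟧ (≡.trans
            (isMin-valley (proj₂ I) (shared i) (subst (λ p → dn (pred p) ≡ true) (≡.sym (pos-shared i)) (proj₁ (valley-at i even)))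
              (subst (λ p → up p ≡ true) (≡.sym (pos-shared i)) (proj₂ (valley-at i even))))
            (cong (not ∘ bits (proj₁ I)) (pos-shared i))))) (⟦not⟧ _))) ⟩
          χ-shared (suc j) I - (1# - Y (a (suc j)) I)     ∎) (T-scale (- 1#) (member-AffineSpan T (shared i)))
        go (inj₂ ≡.refl) = T-resp (λ I → sym (begin
          χ-shared t I - (1# - Y (a t) I)   ≈⟨ +-cong (reflexive (χ-sharedₜ I)) (-‿cong (R.+-congˡ (-‿cong (reflexive (cong ⟦_⟧ (≡.trans
                                                 (cong (bits (proj₁ I)) aₜ≡1+n)
                                                 (≡.trans (bits-end (proj₁ I)) (dec-true (2 ∣? t) even)))))))) ⟩
          0# - (1# - 1#)                    ≈⟨ solve 0 (con 0ℚ :- (con 1ℚ :- con 1ℚ) := con 0ℚ) refl ⟩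
          0#                                ∎)) null

      module _ (i : Fin t) where

        open Segment i
        open ArithmeticProgression T-quotient using (difference; progression)

        private
          u : ℕ → 𝒥 → ℝ
          u m = Y (m ℕ.+ s)

          d : 𝒥 → ℝ
          d I = u 1 I - u 0 I

          direction : ∀ m → suc m ℕ.< N →
            (Ascending (m ℕ.+ s) × Ascending (suc m ℕ.+ s)) ⊎ (Descending (m ℕ.+ s) × Descending (suc m ℕ.+ s))
          direction m m<N = go (2 ∣? number i)
            where
            go : Dec (2 ∣ number i) → _
            go (yes even) = inj₂ (descending even (ℕ.<⇒≤ m<N) , descending even m<N)
            go (no odd)   = inj₁ (ascending odd (ℕ.<⇒≤ m<N) , ascending odd m<N)

          harmonic : ∀ m → suc m ℕ.< N → AffineSpan T (λ I → (u m I + u (2 ℕ.+ m) I) - (u (suc m) I + u (suc m) I))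
          harmonic m m<N = let x , x≡ , _ = interior (suc m) (s≤s z≤n) m<N in
            T-resp (second-difference x x≡ (direction m m<N)) (member-AffineSpan T x)

          step : ∀ m → m ℕ.< N → AffineSpan T (λ I → u (suc m) I - (d I + u m I))
          step = difference u N harmonic

          total : AffineSpan T (λ I → u N I - (fromℕ N * d I + u 0 I))
          total = T-resp (λ I → R.+-congˡ (-‿cong (R.+-congʳ (⋆-pointwise N I)))) (progression u N harmonic N ℕ.≤-refl)
            where
            open Algebra.Properties.Monoid.Mult (AbelianGroup.monoid T-quotient) using () renaming (_×_ to _⋆_)
            ⋆-pointwise : ∀ m I → (m ⋆ d) I ≈ fromℕ m * d I
            ⋆-pointwise zero    I = sym (R.zeroˡ (d I))
            ⋆-pointwise (suc m) I = begin
              d I + (m ⋆ d) I          ≈⟨ R.+-congˡ (⋆-pointwise m I) ⟩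
              d I + fromℕ m * d I      ≈⟨ solve 2 (λ m d → d :+ m :* d := (con 1ℚ :+ m) :* d) refl (fromℕ m) (d I) ⟩
              (1# + fromℕ m) * d I     ≈⟨ R.*-congʳ (fromℕ-suc m) ⟨
              fromℕ (suc m) * d I      ∎

          upper-end : ∀ {f : ℝ → ℝ} → AffineSpan T (λ I → χ-shared (number i) I - f (Y (a (number i)) I)) →
                      AffineSpan T (λ I → χ-shared (number i) I - f (u N I))
          upper-end {f} = subst (λ j → AffineSpan T (λ I → χ-shared (number i) I - f (Y j I))) (≡.sym N+s≡)

          ascending-member : ¬ 2 ∣ number i → ∀ m x → suc m ℕ.< N → pos x ≡ suc m ℕ.+ s → AffineSpan T (basisElement i x)
          ascending-member odd m x m<N x≡ = T-resp pointwise
            -- Here χ_x is minus the step from x to its successor. The factors - α_i and 1 cancel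
            -- the common difference `d`, and the added constant 1 absorbs the one left by 1 - y at
            -- the lower end.
            (T-add (T-lin (- fromℕ N) 1# (step (suc m) m<N) total)
              (T-add (constant-AffineSpan T 1#) (T-add (χ-shared-even (toℕ i) (ℕ.<⇒≤ (Fin.toℕ<n i)) (even-pred odd))
                (upper-end {λ z → z} (χ-shared-odd (number i) (Fin.toℕ<n i) odd)))))
            where
            pointwise : ∀ I →
              - fromℕ N * (u (2 ℕ.+ m) I - (d I + u (suc m) I)) + 1# * (u N I - (fromℕ N * d I + u 0 I)) +
              (1# + (χ-shared (toℕ i) I - (1# - u 0 I) + (χ-shared (number i) I - u N I))) ≈ basisElement i x I
            pointwise I = begin
              - fromℕ N * (u (2 ℕ.+ m) I - (d I + u (suc m) I)) + 1# * (u N I - (fromℕ N * d I + u 0 I)) +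
              (1# + (χ-shared (toℕ i) I - (1# - u 0 I) + (χ-shared (number i) I - u N I)))
                ≈⟨ solve 8 (λ α q p d u₀ uₙ σ σ′ →
                     :- α :* (q :- (d :+ p)) :+ con 1ℚ :* (uₙ :- (α :* d :+ u₀)) :+ (con 1ℚ :+ (σ :- (con 1ℚ :- u₀) :+ (σ′ :- uₙ)))
                     := α :* (p :- q) :+ σ :+ σ′) refl
                   (fromℕ N) (u (2 ℕ.+ m) I) (u (suc m) I) (d I) (u 0 I) (u N I) (χ-shared (toℕ i) I) (χ-shared (number i) I) ⟩
              fromℕ N * (u (suc m) I - u (2 ℕ.+ m) I) + χ-shared (toℕ i) I + χ-shared (number i) I
                ≈⟨ R.+-congʳ (R.+-congʳ (R.*-congˡ (χ-ascending x x≡ (ascending odd (ℕ.<⇒≤ m<N)) (ascending odd m<N) I))) ⟨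
              fromℕ N * χ x I + χ-shared (toℕ i) I + χ-shared (number i) I
                ≈⟨ basisElement≈ i x I ⟨
              basisElement i x I ∎

          descending-member : 2 ∣ number i → ∀ m x → suc m ℕ.< N → pos x ≡ suc m ℕ.+ s → AffineSpan T (basisElement i x)
          descending-member even m x m<N x≡ = T-resp pointwise
            -- In a descending segment χ_x is the step from the predecessor of x to x, hence
            -- `step m` and the opposite signs.
            (T-add (T-lin (fromℕ N) (- 1#) (step m (ℕ.<⇒≤ m<N)) total)
              (T-add (constant-AffineSpan T 1#) (T-add
                (χ-shared-odd (toℕ i) (ℕ.<⇒≤ (Fin.toℕ<n i)) (λ even′ → even⇒odd-suc even′ even))
                (upper-end {λ z → 1# - z} (χ-shared-even (number i) (Fin.toℕ<n i) even)))))
            where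
            pointwise : ∀ I →
              fromℕ N * (u (suc m) I - (d I + u m I)) + - 1# * (u N I - (fromℕ N * d I + u 0 I)) +
              (1# + (χ-shared (toℕ i) I - u 0 I + (χ-shared (number i) I - (1# - u N I)))) ≈ basisElement i x I
            pointwise I = begin
              fromℕ N * (u (suc m) I - (d I + u m I)) + - 1# * (u N I - (fromℕ N * d I + u 0 I)) +
              (1# + (χ-shared (toℕ i) I - u 0 I + (χ-shared (number i) I - (1# - u N I))))
                ≈⟨ solve 8 (λ α q p d u₀ uₙ σ σ′ →
                     α :* (p :- (d :+ q)) :+ :- con 1ℚ :* (uₙ :- (α :* d :+ u₀)) :+ (con 1ℚ :+ (σ :- u₀ :+ (σ′ :- (con 1ℚ :- uₙ))))
                     := α :* (p :- q) :+ σ :+ σ′) refl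
                   (fromℕ N) (u m I) (u (suc m) I) (d I) (u 0 I) (u N I) (χ-shared (toℕ i) I) (χ-shared (number i) I) ⟩
              fromℕ N * (u (suc m) I - u m I) + χ-shared (toℕ i) I + χ-shared (number i) I
                ≈⟨ R.+-congʳ (R.+-congʳ (R.*-congˡ (χ-descending x x≡ (descending even (ℕ.<⇒≤ m<N)) (descending even m<N) I))) ⟨
              fromℕ N * χ x I + χ-shared (toℕ i) I + χ-shared (number i) I
                ≈⟨ basisElement≈ i x I ⟨
              basisElement i x I ∎

        basisElement-AffineSpan : ∀ x → UnsharedSegment i x → AffineSpan T (basisElement i x)
        basisElement-AffineSpan x unshared = go (pos x ℕ.∸ s) (ℕ.m<n⇒0<n∸m s<x) (∸s<N s<x x<a) (≡.sym (ℕ.m∸n+n≡m (ℕ.<⇒≤ s<x)))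
          where
          s<x = proj₁ (unshared⇒within i unshared)
          x<a = proj₂ (unshared⇒within i unshared)
          go : ∀ m → 0 ℕ.< m → m ℕ.< N → pos x ≡ m ℕ.+ s → AffineSpan T (basisElement i x)
          go (suc m) _ m<N x≡ = case 2 ∣? number i of λ
            { (yes even) → descending-member even m x m<N x≡
            ; (no odd)   → ascending-member odd m x m<N x≡ }

      χ-shared-Span : ∀ j → j ℕ.≤ t → Span χ (χ-shared j)
      χ-shared-Span zero    _        = S.resp (λ I → sym (reflexive (χ-shared₀ I))) S.null
        where module S = IsSubspace (Span-isSubspace χ)
      χ-shared-Span (suc j) (s≤s j≤) = go (shared-or-last j j≤)
        where
        module S = IsSubspace (Span-isSubspace χ)
        go : (∃[ i ] toℕ {suc k} i ≡ j) ⊎ j ≡ suc k → Span χ (χ-shared (suc j))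
        go (inj₁ (i , ≡.refl)) = S.resp (λ I → sym (reflexive (χ-sharedᵢ i I))) (member-Span χ (shared i))
        go (inj₂ ≡.refl)       = S.resp (λ I → sym (reflexive (χ-sharedₜ I))) S.null

      basisElement-Span : ∀ i x → Span χ (basisElement i x)
      basisElement-Span i x = S.resp (λ I → sym (basisElement≈ i x I))
        (S.add (S.add (S.scale (fromℕ (lookup α i)) (member-Span χ x)) (χ-shared-Span (toℕ i) (ℕ.<⇒≤ (Fin.toℕ<n i))))
          (χ-shared-Span (number i) (Fin.toℕ<n i)))
        where module S = IsSubspace (Span-isSubspace χ)

      χ-shared-↓ : ∀ j → j ℕ.≤ t → ∀ {x} → ¬ IsShared x → χ-shared j (↓ x) ≈ 0#
      χ-shared-↓ zero    _        {x} _        = reflexive (χ-shared₀ (↓ x))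
      χ-shared-↓ (suc j) (s≤s j≤) {x} unshared = go (shared-or-last j j≤)
        where
        go : (∃[ i ] toℕ {suc k} i ≡ j) ⊎ j ≡ suc k → χ-shared (suc j) (↓ x) ≈ 0#
        go (inj₁ (i , ≡.refl)) = trans (reflexive (χ-sharedᵢ i (↓ x))) (χ-↓-≢ λ sᵢ≡x → unshared (i , ≡.sym sᵢ≡x))
        go (inj₂ ≡.refl)       = reflexive (χ-sharedₜ (↓ x))

      basisElement-↓ : ∀ i x {z} → ¬ IsShared z → basisElement i x (↓ z) ≈ fromℕ (lookup α i) * χ x (↓ z)
      basisElement-↓ i x {z} unshared = begin
        basisElement i x (↓ z)
          ≈⟨ basisElement≈ i x (↓ z) ⟩
        fromℕ (lookup α i) * χ x (↓ z) + χ-shared (toℕ i) (↓ z) + χ-shared (number i) (↓ z)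
          ≈⟨ +-cong (R.+-congˡ (χ-shared-↓ (toℕ i) (ℕ.<⇒≤ (Fin.toℕ<n i)) unshared)) (χ-shared-↓ (number i) (Fin.toℕ<n i) unshared) ⟩
        fromℕ (lookup α i) * χ x (↓ z) + 0# + 0#
          ≈⟨ trans (R.+-identityʳ _) (R.+-identityʳ _) ⟩
        fromℕ (lookup α i) * χ x (↓ z) ∎

      A-T-basis : ∀ {bs} → List.map (uncurry basisElement) unsharedElements ≡ bs → IsBasis (Span χ ∩ AffineSpan T) bs
      A-T-basis ≡.refl = biorthogonal⇒basis (uncurry basisElement) (↓ ∘ proj₂)
        (λ (i , _) → fromℕ (lookup α i)) (λ (i , _) → proj₁ (fromℕ-inverse (lookup α i) (α≥1 i)))
        (λ (i , _) → proj₂ (fromℕ-inverse (lookup α i) (α≥1 i)))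
        A-T-isSubspace unsharedElements unsharedElements-unique
        (λ (i , x) ix∈ → basisElement-Span i x , basisElement-AffineSpan i x (∈-unsharedElements⁻ ix∈))
        (λ (i , x) ix∈ → trans (basisElement-↓ i x (proj₂ (∈-unsharedElements⁻ ix∈)))
          (trans (R.*-congˡ (χ-↓-≡ x)) (R.*-identityʳ _)))
        (λ (i , x) (i′ , x′) ix∈ ix′∈ ≢ → trans (basisElement-↓ i′ x′ (proj₂ (∈-unsharedElements⁻ ix∈)))
          (trans (R.*-congˡ (χ-↓-≢ λ x′≡x →
            ≢ (same-element (∈-unsharedElements⁻ ix∈) (∈-unsharedElements⁻ ix′∈) x′≡x))) (R.zeroʳ _)))
        (λ h Vh h≈0 → A-T-determined h Vh λ i x unshared → h≈0 (i , x) (∈-unsharedElements⁺ unshared))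
        where
        -- An unshared element lies in one segment only, so distinct pairs belong to distinct
        -- elements and the matrix of values is diagonal.
        same-element : ∀ {i x i′ x′} → UnsharedSegment i x → UnsharedSegment i′ x′ → x′ ≡ x → (i′ , x′) ≡ (i , x)
        same-element {i} {x} {i′} unshared unshared′ ≡.refl =
          let lo , hi = unshared⇒within i unshared ; lo′ , hi′ = unshared⇒within i′ unshared′
          in cong (_, x) (within-unique i′ i lo′ hi′ lo hi)

-- Transfer to the Cauchy reals

module ℝ-Algebra = RationalAlgebra Reals.ℝ Reals._≈_ Reals._+_ Reals._*_ Reals.-_ Reals.fromℚ
  (CommutativeRing.isCommutativeRing Reals.ℝ-commutativeRing)
  (λ _ _ → Reals.pointwise λ _ → ≡.refl) (λ _ _ → Reals.pointwise λ _ → ≡.refl) (λ _ → Reals.pointwise λ _ → ≡.refl)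

module RealFunctionSpace (X : Set) where

  open Reals
  module Abstract = ℝ-Algebra.FunctionSpace X
  open CommutativeRing ℝ-commutativeRing using (trans; sym; reflexive)
  open Algebra.Properties.CommutativeMonoid.Sum (CommutativeRing.+-commutativeMonoid ℝ-commutativeRing) using (sum)

  -- Stated for a variable family, so that the abstract and the concrete sum are compared without
  -- unfolding any particular statistic.
  combination≡ : ∀ {m} (c : Fin m → ℝ) v I → Abstract.combination c v I ≡ LinearAlgebra.combination X c v I
  combination≡ c v I = ≡.refl

  Span⁺ : ∀ {m} (v : Fin m → X → ℝ) {f} → Abstract.Span v f → LinearAlgebra.Span X v f
  Span⁺ v (c , f≐) = c , λ I → trans (f≐ I) (reflexive (combination≡ c v I))

  Span⁻ : ∀ {m} (v : Fin m → X → ℝ) {f} → LinearAlgebra.Span X v f → Abstract.Span v f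
  Span⁻ v (c , f≐) = c , λ I → trans (f≐ I) (reflexive (≡.sym (combination≡ c v I)))

  affine≡ : ∀ {m} b (c : Fin m → ℝ) v I → b ℝ-Algebra.+ Abstract.combination c v I ≡ b + sum (λ i → c i * v i I)
  affine≡ b c v I = ≡.refl

  AffineSpan⁺ : ∀ {m} (v : Fin m → X → ℝ) {f} → Abstract.AffineSpan v f →
                Σ ℝ λ c → Σ (Fin m → ℝ) λ c′ → ∀ I → f I ≈ c + sum (λ i → c′ i * v i I)
  AffineSpan⁺ v (c , c′ , f≈) = c , c′ , λ I → trans (f≈ I) (reflexive (affine≡ c c′ v I))

  AffineSpan⁻ : ∀ {m} (v : Fin m → X → ℝ) {f} →
                (Σ ℝ λ c → Σ (Fin m → ℝ) λ c′ → ∀ I → f I ≈ c + sum (λ i → c′ i * v i I)) → Abstract.AffineSpan v f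
  AffineSpan⁻ v (c , c′ , f≈) = c , c′ , λ I → trans (f≈ I) (reflexive (≡.sym (affine≡ c c′ v I)))

  IsBasis⁺ : ∀ {V V′ : Pred (X → ℝ) 0ℓ} {bs} → (∀ {f} → V f → V′ f) → (∀ {f} → V′ f → V f) →
             Abstract.IsBasis V bs → LinearAlgebra.IsBasis X V′ bs
  IsBasis⁺ {bs = bs} V⊆V′ V′⊆V (bs∈V , independent , spanning) =
    All.map V⊆V′ bs∈V ,
    (λ c c≐0 → independent c λ I → trans (reflexive (combination≡ c (List.lookup bs) I)) (c≐0 I)) ,
    (λ f V′f → Span⁺ (List.lookup bs) (spanning f (V′⊆V V′f)))

module RealOrderIdeals {n} {_≤_ : Rel (Fin n) 0ℓ} (isDecPartialOrder : IsDecPartialOrder _≡_ _≤_) where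

  open RealFunctionSpace (OrderIdeals.𝒥 isDecPartialOrder)

  A-T⁺ : ∀ {f} → (Abstract.Span (OrderIdeals.χ isDecPartialOrder) ∩ Abstract.AffineSpan (OrderIdeals.T isDecPartialOrder)) f →
         OrderIdeals.A-T isDecPartialOrder f
  A-T⁺ (f∈Span , f∈AffineSpan) =
    Span⁺ (OrderIdeals.χ isDecPartialOrder) f∈Span , AffineSpan⁺ (OrderIdeals.T isDecPartialOrder) f∈AffineSpan

  A-T⁻ : ∀ {f} → OrderIdeals.A-T isDecPartialOrder f →
         (Abstract.Span (OrderIdeals.χ isDecPartialOrder) ∩ Abstract.AffineSpan (OrderIdeals.T isDecPartialOrder)) f
  A-T⁻ (f∈Span , f≡const) =
    Span⁻ (OrderIdeals.χ isDecPartialOrder) f∈Span , AffineSpan⁻ (OrderIdeals.T isDecPartialOrder) f≡const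

  IsBasis-A-T⁺ : ∀ {bs} →
    Abstract.IsBasis (Abstract.Span (OrderIdeals.χ isDecPartialOrder) ∩ Abstract.AffineSpan (OrderIdeals.T isDecPartialOrder)) bs →
    LinearAlgebra.IsBasis (OrderIdeals.𝒥 isDecPartialOrder) (OrderIdeals.A-T isDecPartialOrder) bs
  IsBasis-A-T⁺ {bs} = IsBasis⁺
    {Abstract.Span (OrderIdeals.χ isDecPartialOrder) ∩ Abstract.AffineSpan (OrderIdeals.T isDecPartialOrder)}
    {OrderIdeals.A-T isDecPartialOrder} {bs} (λ {f} → A-T⁺ {f}) (λ {f} → A-T⁻ {f})

-- Matching on this equation, rather than naming the order, keeps the order in the syntactic
-- form it has in the definitions of Fence; comparing two forms by unfolding them is infeasible.
IsFenceOrder : ∀ {k} (α : Vec ℕ (2 ℕ.+ k)) (α≥1 : ∀ i → 1 ℕ.≤ lookup α i) →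
  IsDecPartialOrder _≡_ (GradedOrder._≤_ (Fence._⋖?_ α α≥1) (Fence.rank α α≥1) (λ {x} {y} → Fence.rank-⋖ α α≥1 {x} {y})) → Set
IsFenceOrder α α≥1 order =
  order ≡ GradedOrder.isDecPartialOrder (Fence._⋖?_ α α≥1) (Fence.rank α α≥1) (λ {x} {y} → Fence.rank-⋖ α α≥1 {x} {y})

module RealFence {k} (α : Vec ℕ (2 ℕ.+ k)) (α≥1 : ∀ i → 1 ℕ.≤ lookup α i) where

  χ-def : ∀ {order} → IsFenceOrder α α≥1 order → ∀ q I → OrderIdeals.χ order q I ≡
    (if does (Fence.isMax? α α≥1 (proj₁ I) q) then Reals.fromℚ 1ℚ else Reals.fromℚ 0ℚ)
  χ-def ≡.refl q I = ≡.refl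

  T-def : ∀ {order} → IsFenceOrder α α≥1 order → ∀ q I → OrderIdeals.T order q I ≡
    (if does (Fence.isMinOfComplement? α α≥1 (proj₁ I) q) then Reals.fromℚ 1ℚ else
     if does (Fence.isMax? α α≥1 (proj₁ I) q) then Reals.- Reals.fromℚ 1ℚ else Reals.fromℚ 0ℚ)
  T-def ≡.refl q I = ≡.refl

  χ-sharedᵢ : ∀ {order} → IsFenceOrder α α≥1 order → ∀ i I →
    Fence.χ-shared α α≥1 (suc (toℕ i)) I ≡ OrderIdeals.χ order (Fence.shared α α≥1 i) I
  χ-sharedᵢ {order} ≡.refl i I = ≡.trans (χ-shared-unfold (toℕ i)) (inside (toℕ i ℕ.<? suc k))
    where
    -- The case distinction of `χ-shared` as a function of the decision, which can then be matched
    -- on by `inside`.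
    value : ∀ {j} → Dec (j ℕ.< suc k) → Reals.ℝ
    value (yes j<) = OrderIdeals.χ order (Fence.shared α α≥1 (fromℕ< j<)) I
    value (no _)   = Reals.0#
    χ-shared-unfold : ∀ j → Fence.χ-shared α α≥1 (suc j) I ≡ value (j ℕ.<? suc k)
    χ-shared-unfold j with j ℕ.<? suc k
    ... | yes _ = ≡.refl
    ... | no  _ = ≡.refl
    inside : (i< : Dec (toℕ i ℕ.< suc k)) → value i< ≡ OrderIdeals.χ order (Fence.shared α α≥1 i) I
    inside (yes i<) = cong (λ s → OrderIdeals.χ order (Fence.shared α α≥1 s) I) (Fin.fromℕ<-toℕ i i<)
    inside (no i≮)  = contradiction (Fin.toℕ<n i) i≮

  χ-sharedₜ : ∀ I → Fence.χ-shared α α≥1 (2 ℕ.+ k) I ≡ Reals.0#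
  χ-sharedₜ I with suc k ℕ.<? suc k
  ... | yes k<k = contradiction ≡.refl (ℕ.<⇒≢ k<k)
  ... | no  _   = ≡.refl

  basisElement-def : ∀ {order} → IsFenceOrder α α≥1 order → ∀ i x I → Fence.basisElement α α≥1 i x I ≡
    Reals.fromℕ (lookup α i) Reals.* OrderIdeals.χ order x I
      Reals.+ Fence.χ-shared α α≥1 (Fence.number α α≥1 i ℕ.∸ 1) I Reals.+ Fence.χ-shared α α≥1 (Fence.number α α≥1 i) I
  basisElement-def ≡.refl i x I = ≡.refl

  module _ (α₁≥2 : 2 ℕ.≤ head α) (αₜ≥2 : 2 ℕ.≤ last α) where

    isBasis : ∀ {order} → IsFenceOrder α α≥1 order →
      ∀ {bs} → List.map (uncurry (Fence.basisElement α α≥1)) (FencePositions.unsharedElements α α≥1 α₁≥2 αₜ≥2) ≡ bs →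
      LinearAlgebra.IsBasis (OrderIdeals.𝒥 order) (OrderIdeals.A-T order) bs
    isBasis {order} fence {bs} bs≡ = RealOrderIdeals.IsBasis-A-T⁺ order {bs}
      (ℝ-Algebra.FenceStatistics.A-T-basis α α≥1 α₁≥2 αₜ≥2 (OrderIdeals.χ order) (OrderIdeals.T order)
        (χ-def {order} fence) (T-def {order} fence)
        (Fence.χ-shared α α≥1) (λ _ → ≡.refl) (χ-sharedᵢ {order} fence) χ-sharedₜ
        (Fence.basisElement α α≥1) Reals.fromℕ (λ _ → ≡.refl) (basisElement-def {order} fence) bs≡)

    ℬ-A≡ : List.map (uncurry (Fence.basisElement α α≥1)) (FencePositions.unsharedElements α α≥1 α₁≥2 αₜ≥2) ≡ Fence.ℬ-A α α≥1
    ℬ-A≡ = map-filter-cartesianProduct (Fence.unsharedSegment? α α≥1) (Fence.basisElement α α≥1)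
      (allFin (2 ℕ.+ k)) (allFin (Fence.n α α≥1))

    ℬ-A-isBasis : ∀ {order} → IsFenceOrder α α≥1 order →
      LinearAlgebra.IsBasis (OrderIdeals.𝒥 order) (OrderIdeals.A-T order) (Fence.ℬ-A α α≥1)
    ℬ-A-isBasis {order} isFenceOrder = isBasis {order} isFenceOrder {Fence.ℬ-A α α≥1} ℬ-A≡

    fence-isBasis : ∀ {order} → IsFenceOrder α α≥1 order →
      ∀ {V bs} → V ≡ Fence.A-T α α≥1 → bs ≡ Fence.ℬ-A α α≥1 → Fence.IsBasis α α≥1 V bs
    fence-isBasis {order} ≡.refl ≡.refl ≡.refl = ℬ-A-isBasis {order} ≡.refl

    ℬ-A-length : length (Fence.ℬ-A α α≥1) ≡ Vec.sum (Vec.map (ℕ._∸ 1) α)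
    ℬ-A-length = FencePositions.length-segments α α≥1 α₁≥2 αₜ≥2 (Fence.basisElement α α≥1)

open import Data.Nat.Base using (_+_; _∸_; _≤_)
open import Data.Vec.Base using (map; sum)

-- The variables V and bs keep conversion from unfolding A-T and ℬ-A of the local module F.
basis-and-dimension : ∀ {k} (α : Vec ℕ (2 + k)) (α≥1 : ∀ i → 1 ≤ lookup α i) → 2 ≤ head α → 2 ≤ last α →
    let module F = Fence α α≥1 in
    ∀ V bs → V ≡ F.A-T → bs ≡ F.ℬ-A → F.IsBasis V bs × F.HasDimension V (sum (map (_∸ 1) α))
basis-and-dimension α α≥1 α₁≥2 αₜ≥2 V bs V≡ bs≡ =
  basis , bs , basis , ≡.trans (cong length bs≡) (RealFence.ℬ-A-length α α≥1 α₁≥2 αₜ≥2)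
  where
  basis : Fence.IsBasis α α≥1 V bs
  basis = RealFence.fence-isBasis α α≥1 α₁≥2 αₜ≥2 ≡.refl V≡ bs≡

theorem3p5 : ∀ {k} (α : Vec ℕ (2 + k)) (α≥1 : ∀ i → 1 ≤ lookup α i) → 2 ≤ head α → 2 ≤ last α →
    let module F = Fence α α≥1 in
    F.IsBasis F.A-T F.ℬ-A × F.HasDimension F.A-T (sum (map (_∸ 1) α))
theorem3p5 α α≥1 α₁≥2 αₜ≥2 = basis-and-dimension α α≥1 α₁≥2 αₜ≥2 _ _ ≡.refl ≡.refl
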